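{- There is an $\mathcal{L}^*$-formula $\varphi(x)$ such that whenever $\mathcal{M}$ is a countable model of $\mathsf{PA}$, $J$ is an exponentially closed cut of $\mathcal{M}$, and $I \subseteq \omega$, then there is a minimal elementary extension $\mathcal{N} \succ \mathcal{M}$ such that $\mathrm{gcis}(\mathcal{M},\mathcal{N}) = J$, $\mathrm{cod}(\mathcal{N}/J) = \mathrm{cod}(\mathcal{M}/J)$, $\mathcal{N}$ does not fill $J$, and $\varphi(x)$ defines $I$ in $(\mathcal{N},M)$, i.e. $\{a \in N : (\mathcal{N},M) \models \varphi(a)\} = I$.
   Context: All structures $\mathcal{M},\mathcal{N},\mathcal{K}$ are models of Peano Arithmetic ($\mathsf{PA}$) in the language $\mathcal{L}=\{+,\times,0,1,\leq\}$, with domains $M,N,K$; the standard model $(\omega,\dots)$ is regarded as a substructure of every nonstandard model. $\mathcal{M}\prec\mathcal{N}$ means $\mathcal{N}$ is a proper elementary extension of $\mathcal{M}$ ($\preccurlyeq$ allows equality). $\mathcal{L}^*=\mathcal{L}\cup\{M\}$ with $M$ a new unary predicate, so that for $\mathcal{M}\prec\mathcal{N}$ the pair $(\mathcal{N},M)$ is an $\mathcal{L}^*$-structure (the predicate interpreted as $M$). $\mathrm{Def}(\mathcal{M})$ is the set of subsets of $M$ definable in $\mathcal{M}$ with parameters. A cut of $\mathcal{M}$ is a set $J\subseteq M$ with $0\in J\neq M$ such that whenever $a\leq b\in J$ then $a+1\in J$; it is exponentially closed if $2^a\in J$ whenever $a\in J$. For a cut $J$, $\mathrm{cod}(\mathcal{M}/J)=\{A\cap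 J: A\in\mathrm{Def}(\mathcal{M})\}$. For $\mathcal{M}\prec\mathcal{N}$, $\mathrm{gcis}(\mathcal{M},\mathcal{N})=\{b\in M: \text{whenever } \mathcal{N}\models a\leq b \text{ then } a\in M\}$. $\mathcal{N}$ fills the cut $J$ of $\mathcal{M}$ if there is $b\in N$ with $\mathcal{N}\models a<b<c$ for all $a\in J$ and $c\in M\setminus J$. $\mathcal{N}\succ\mathcal{M}$ is a minimal (elementary) extension if there is no $\mathcal{K}$ with $\mathcal{M}\prec\mathcal{K}\prec\mathcal{N}$. -}

module Defs where

open import Data.Nat using (ℕ; zero; suc)
open import Data.Bool using (Bool; true; false)
open import Data.Fin using (Fin)
open import Data.Vec.Functional using (_∷_)
open import Data.Product using (Σ; _×_; _,_; ∃)
open import Data.Sum using (_⊎_)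
open import Data.Empty using (⊥)
open import Data.Unit using (⊤)
open import Relation.Nullary using (¬_)
open import Relation.Binary.PropositionalEquality using (_≡_; _≢_)

-- Syntax.  Fm false n : L-formulas with n free variables (de Bruijn),
--          Fm true  n : L*-formulas (may use the unary predicate M).

data Term (n : ℕ) : Set where
  var        : Fin n → Term n
  0ₜ 1ₜ      : Term n
  _+ₜ_ _*ₜ_  : Term n → Term n → Term n

data Fm : Bool → ℕ → Set where
  _≐_ _≼_   : ∀ {b n} → Term n → Term n → Fm b n
  mem       : ∀ {n} → Term n → Fm true n
  ⊥f        : ∀ {b n} → Fm b n
  _⇒_ _∧f_ _∨f_ : ∀ {b n} → Fm b n → Fm b n → Fm b n
  all ex    : ∀ {b n} → Fm b (suc n) → Fm b n

record Str : Set₁ where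
  field
    C     : Set
    z o   : C
    _⊕_   : C → C → C
    _⊗_   : C → C → C
    _≤_   : C → C → Set

module _ (S : Str) where
  open Str S

  eval : ∀ {n} → Term n → (Fin n → C) → C
  eval (var i)   ρ = ρ i
  eval 0ₜ        ρ = z
  eval 1ₜ        ρ = o
  eval (s +ₜ t)  ρ = eval s ρ ⊕ eval t ρ
  eval (s *ₜ t)  ρ = eval s ρ ⊗ eval t ρ

  Sat : ∀ {b n} → (C → Set) → Fm b n → (Fin n → C) → Set
  Sat P (s ≐ t)   ρ = eval s ρ ≡ eval t ρ
  Sat P (s ≼ t)   ρ = eval s ρ ≤ eval t ρ
  Sat P (mem t)   ρ = P (eval t ρ)
  Sat P ⊥f        ρ = ⊥
  Sat P (φ ⇒ ψ)   ρ = Sat P φ ρ → Sat P ψ ρ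
  Sat P (φ ∧f ψ)  ρ = Sat P φ ρ × Sat P ψ ρ
  Sat P (φ ∨f ψ)  ρ = Sat P φ ρ ⊎ Sat P ψ ρ
  Sat P (all φ)   ρ = (x : C) → Sat P φ (x ∷ ρ)
  Sat P (ex φ)    ρ = Σ C (λ x → Sat P φ (x ∷ ρ))

  -- satisfaction of L-formulas (the predicate plays no role)
  SatL : ∀ {n} → Fm false n → (Fin n → C) → Set
  SatL φ ρ = Sat (λ _ → ⊤) φ ρ

  succ : C → C
  succ x = x ⊕ o

  _<_ : C → C → Set
  x < y = (x ≤ y) × (x ≢ y)

  num : ℕ → C
  num zero    = z
  num (suc k) = succ (num k)

  record IsPA : Set where
    field
      succ≢0   : ∀ x → succ x ≢ z
      succ-inj : ∀ x y → succ x ≡ succ y → x ≡ y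
      +-0      : ∀ x → x ⊕ z ≡ x
      +-succ   : ∀ x y → x ⊕ succ y ≡ succ (x ⊕ y)
      *-0      : ∀ x → x ⊗ z ≡ z
      *-succ   : ∀ x y → x ⊗ succ y ≡ (x ⊗ y) ⊕ x
      ≤-def₁   : ∀ x y → x ≤ y → Σ C (λ w → x ⊕ w ≡ y)
      ≤-def₂   : ∀ x y w → x ⊕ w ≡ y → x ≤ y
      induction : ∀ {n} (φ : Fm false (suc n)) (ρ : Fin n → C) →
                  SatL φ (z ∷ ρ) →
                  (∀ x → SatL φ (x ∷ ρ) → SatL φ (succ x ∷ ρ)) →
                  ∀ x → SatL φ (x ∷ ρ)

  Countable : Set
  Countable = Σ (ℕ → C) (λ e → ∀ x → Σ ℕ (λ k → e k ≡ x))

  Definable : (C → Set) → Set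
  Definable A = Σ ℕ (λ n → Σ (Fm false (suc n)) (λ φ → Σ (Fin n → C) (λ ρ →
                  ∀ x → (A x → SatL φ (x ∷ ρ)) × (SatL φ (x ∷ ρ) → A x))))

  -- x = 2^a : witnessed by a definable relation ψ(u,v) which is single-valued
  -- on [0,a], contains (0,1), is closed under (u,v) ↦ (u+1,v+v) for u<a,
  -- and contains (a,x).  In a model of PA this is exactly the graph of 2^u
  -- restricted to u ≤ a (by induction).
  IsPow2 : C → C → Set
  IsPow2 a x = Σ ℕ (λ n → Σ (Fm false (suc (suc n))) (λ ψ → Σ (Fin n → C) (λ ρ →
      let R = λ u v → SatL ψ (u ∷ (v ∷ ρ)) in
      R z o
    × (∀ u v → u < a → R u v → R (succ u) (v ⊕ v))
    × (∀ u v v′ → u ≤ a → R u v → R u v′ → v ≡ v′)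
    × R a x)))

  record IsCut (J : C → Set) : Set where
    field
      zero∈   : J z
      proper  : Σ C (λ x → ¬ J x)
      closed  : ∀ a b → a ≤ b → J b → J (succ a)

  ExpClosed : (C → Set) → Set
  ExpClosed J = ∀ a → J a → Σ C (λ x → IsPow2 a x × J x)

record ElemEmb (M N : Str) : Set where
  field
    f    : Str.C M → Str.C N
    elem : ∀ {n} (φ : Fm false n) (ρ : Fin n → Str.C M) →
           (SatL M φ ρ → SatL N φ (λ i → f (ρ i))) ×
           (SatL N φ (λ i → f (ρ i)) → SatL M φ ρ)

-- image of M inside N (the interpretation of the predicate M in (N,M))
Img : ∀ {M N} → ElemEmb M N → Str.C N → Set
Img {M} e b = Σ (Str.C M) (λ a → ElemEmb.f e a ≡ b)

Proper : ∀ {M N} → ElemEmb M N → Set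
Proper {N = N} e = Σ (Str.C N) (λ b → ¬ Img e b)

Minimal : ∀ {M N} → ElemEmb M N → Set₁
Minimal {M} {N} e = ∀ (K : Str) (g : ElemEmb M K) (h : ElemEmb K N) →
  (∀ a → ElemEmb.f h (ElemEmb.f g a) ≡ ElemEmb.f e a) →
  Proper g → Proper h → ⊥

module _ {M N : Str} (e : ElemEmb M N) where
  private
    f = ElemEmb.f e

  Gcis : Str.C M → Set
  Gcis b = ∀ a → Str._≤_ N a (f b) → Img e a

  SameCod : (Str.C M → Set) → Set₁
  SameCod J =
      (∀ B → Definable N B → Σ (Str.C M → Set) (λ A → Definable M A ×
          (∀ a → J a → (A a → B (f a)) × (B (f a) → A a))))
    × (∀ A → Definable M A → Σ (Str.C N → Set) (λ B → Definable N B ×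
          (∀ a → J a → (A a → B (f a)) × (B (f a) → A a))))

  Fills : (Str.C M → Set) → Set
  Fills J = Σ (Str.C N) (λ c →
      (∀ a → J a → _<_ N (f a) c) × (∀ d → ¬ J d → _<_ N c (f d)))

  DefinesStd : Fm true 1 → (ℕ → Set) → Set
  DefinesStd φ I = ∀ b →
      (Sat N (Img e) φ (b ∷ (λ ())) → Σ ℕ (λ k → num N k ≡ b × I k))
    × (Σ ℕ (λ k → num N k ≡ b × I k) → Sat N (Img e) φ (b ∷ (λ ())))

{-# OPTIONS --safe #-}
module Submission where

-- N is the ultrapower of M by coded functions modulo a generic ultrafilter on the leaves of a coded
-- tree in which the nodes of type n have n + 3 children.  The conditions are coded sets of leaves
-- together with a coded set Q of types; a set has rank r + 1 if, for every type in Q, it has a node of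
-- that type all of whose children have rank r.  Rank is subadditive, so a condition of rank above J can
-- be cut down to decide sets and to make functions constant or injective; each such step costs an
-- exponential factor, which is affordable because J is exponentially closed.  This gives minimality
-- and the statements about J.  Every type other than 0 and k + 1 (k ∈ I) is removed at some stage.
--
-- To read off I in (N , M), call a set free for a list of orders, indexed below some n in J, if each of
-- its elements lies between any two others in one of the orders.  On a condition aligned with these
-- orders a free set meets at most one leaf below each child of a single node, and conversely suitable
-- lexicographic orders make the children of all nodes of a given type free.  So k + 4 is the arity of a
-- branching type exactly when some element has, in each of its neighbourhoods coded in M, a free set of
-- size k + 4, while no other orders make these sets extendable to free sets of size k + 5.

open import Defs hiding (_<_)
open import Data.Nat using (ℕ; zero; suc; _⊔_) renaming (_+_ to _+ℕ_; _≤_ to _≤ℕ_; _<_ to _<ℕ_)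
import Data.Nat.Properties as ℕₚ
open import Data.Bool using (Bool; true; false)
open import Data.Fin using (Fin; zero; suc)
open import Data.Vec.Functional using (_∷_; tail)
open import Data.Product using (Σ; _×_; _,_; proj₁; proj₂)
open import Data.Sum using (_⊎_; inj₁; inj₂)
open import Data.Empty using (⊥; ⊥-elim)
open import Data.Unit using (⊤)
open import Level using (0ℓ)
open import Axiom.ExcludedMiddle using (ExcludedMiddle)
open import Axiom.UniquenessOfIdentityProofs using (module Decidable⇒UIP)
open import Algebra.Bundles using (CommutativeSemiring)
import Algebra.Solver.Ring.NaturalCoefficients.Default as NatCoeff
open import Relation.Nullary using (¬_; yes; no)
open import Relation.Binary.PropositionalEquality using (_≡_; _≢_; refl; sym; trans; cong; cong₂; subst; subst₂; isEquivalence)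
open import Function using (_∘_; id)

-- J has no definition in M, so no requirement can mention it there. It enters through prices only:
-- a step that has to leave rank `l` asks for rank `G l`, with `G` definable and J closed under `G`,
-- and overspill finds an `l` outside J with `G l` below any given rank outside J.
--
-- Three is the least number of children because "between two others" speaks of triples. Type 0
-- provides branching even if I is empty.
--
-- The formula sees neither the tree nor the generator. It speaks of an arbitrary `d` and of orders,
-- coded in M, on the values of `d`. This does no harm: an element outside M is represented by an
-- injective function on some condition, so orders can be moved between the leaves and the values of
-- `d`.
--
-- The obstacle in reading off I is the order of quantifiers. Orders that extend the free sets must
-- be fixed before the neighbourhood is known in which the extension has to be found. So one list of
-- orders must serve at all nodes at once; at each node it favours a definable choice of digits,
-- namely the least code that lists the digits of a free set there together with one more digit.

_⇔_ : Set → Set → Set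
A ⇔ B = (A → B) × (B → A)

-- Renaming of variables, and predicates definable with parameters.

liftF : ∀ {n m} → (Fin n → Fin m) → Fin (suc n) → Fin (suc m)
liftF r zero    = zero
liftF r (suc i) = suc (r i)

renT : ∀ {n m} → (Fin n → Fin m) → Term n → Term m
renT r (var i)  = var (r i)
renT r 0ₜ       = 0ₜ
renT r 1ₜ       = 1ₜ
renT r (s +ₜ t) = renT r s +ₜ renT r t
renT r (s *ₜ t) = renT r s *ₜ renT r t

ren : ∀ {b n m} → (Fin n → Fin m) → Fm b n → Fm b m
ren r (s ≐ t)  = renT r s ≐ renT r t
ren r (s ≼ t)  = renT r s ≼ renT r t
ren r (mem t)  = mem (renT r t)
ren r ⊥f       = ⊥f
ren r (φ ⇒ ψ)  = ren r φ ⇒ ren r ψ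
ren r (φ ∧f ψ) = ren r φ ∧f ren r ψ
ren r (φ ∨f ψ) = ren r φ ∨f ren r ψ
ren r (all φ)  = all (ren (liftF r) φ)
ren r (ex φ)   = ex (ren (liftF r) φ)

module Semantics (S : Str) where
  open Str S

  Env : ℕ → Set
  Env n = Fin n → C

  eval-ren : ∀ {n m} (r : Fin n → Fin m) (t : Term n) {ρ : Env m} {σ : Env n} →
             (∀ i → ρ (r i) ≡ σ i) → eval S (renT r t) ρ ≡ eval S t σ
  eval-ren r (var i) h  = h i
  eval-ren r 0ₜ h       = refl
  eval-ren r 1ₜ h       = refl
  eval-ren r (s +ₜ t) h = cong₂ _⊕_ (eval-ren r s h) (eval-ren r t h)
  eval-ren r (s *ₜ t) h = cong₂ _⊗_ (eval-ren r s h) (eval-ren r t h)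

  lift-∷ : ∀ {n m} (r : Fin n → Fin m) {ρ : Env m} {σ : Env n} (x : C) →
           (∀ i → ρ (r i) ≡ σ i) → ∀ i → (x ∷ ρ) (liftF r i) ≡ (x ∷ σ) i
  lift-∷ r x h zero    = refl
  lift-∷ r x h (suc i) = h i

  Sat-ren : ∀ {b n m} {P : C → Set} (r : Fin n → Fin m) (φ : Fm b n) {ρ : Env m} {σ : Env n} →
            (∀ i → ρ (r i) ≡ σ i) → Sat S P (ren r φ) ρ ⇔ Sat S P φ σ
  Sat-ren r (s ≐ t) h =
    (λ p → trans (sym (eval-ren r s h)) (trans p (eval-ren r t h))) ,
    (λ p → trans (eval-ren r s h) (trans p (sym (eval-ren r t h))))
  Sat-ren r (s ≼ t) h =
    (λ p → subst (_≤ _) (eval-ren r s h) (subst (_ ≤_) (eval-ren r t h) p)) ,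
    (λ p → subst (_≤ _) (sym (eval-ren r s h)) (subst (_ ≤_) (sym (eval-ren r t h)) p))
  Sat-ren {P = P} r (mem t) h = subst P (eval-ren r t h) , subst P (sym (eval-ren r t h))
  Sat-ren r ⊥f h       = id , id
  Sat-ren r (φ ⇒ ψ) h  =
    (λ f p → proj₁ (Sat-ren r ψ h) (f (proj₂ (Sat-ren r φ h) p))) ,
    (λ f p → proj₂ (Sat-ren r ψ h) (f (proj₁ (Sat-ren r φ h) p)))
  Sat-ren r (φ ∧f ψ) h =
    (λ p → proj₁ (Sat-ren r φ h) (proj₁ p) , proj₁ (Sat-ren r ψ h) (proj₂ p)) ,
    (λ p → proj₂ (Sat-ren r φ h) (proj₁ p) , proj₂ (Sat-ren r ψ h) (proj₂ p))
  Sat-ren r (φ ∨f ψ) h =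
    (λ { (inj₁ p) → inj₁ (proj₁ (Sat-ren r φ h) p) ; (inj₂ p) → inj₂ (proj₁ (Sat-ren r ψ h) p) }) ,
    (λ { (inj₁ p) → inj₁ (proj₂ (Sat-ren r φ h) p) ; (inj₂ p) → inj₂ (proj₂ (Sat-ren r ψ h) p) })
  Sat-ren r (all φ) h  =
    (λ f x → proj₁ (Sat-ren (liftF r) φ (lift-∷ r x h)) (f x)) ,
    (λ f x → proj₂ (Sat-ren (liftF r) φ (lift-∷ r x h)) (f x))
  Sat-ren r (ex φ) h   =
    (λ { (x , p) → x , proj₁ (Sat-ren (liftF r) φ (lift-∷ r x h)) p }) ,
    (λ { (x , p) → x , proj₂ (Sat-ren (liftF r) φ (lift-∷ r x h)) p })

  -- Environments that agree pointwise need not be equal as functions; renaming along `id` passes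
  -- from one to the other.
  Sat-id : ∀ {b n} {P : C → Set} (φ : Fm b n) {ρ σ : Env n} →
           (∀ i → ρ i ≡ σ i) → Sat S P φ ρ → Sat S P φ σ
  Sat-id φ {ρ} h p = proj₁ (Sat-ren id φ h) (proj₂ (Sat-ren id φ {ρ = ρ} (λ i → refl)) p)

  app : ∀ n {k} → Env n → Env k → Env (n +ℕ k)
  app zero    ρ p = p
  app (suc n) ρ p = ρ zero ∷ app n (tail ρ) p

  inL : ∀ n {k} → Fin n → Fin (n +ℕ k)
  inL (suc n) zero    = zero
  inL (suc n) (suc i) = suc (inL n i)

  inR : ∀ n {k} → Fin k → Fin (n +ℕ k)
  inR zero    i = i
  inR (suc n) i = suc (inR n i)

  app-L : ∀ n {k} (ρ : Env n) (p : Env k) i → app n ρ p (inL n i) ≡ ρ i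
  app-L (suc n) ρ p zero    = refl
  app-L (suc n) ρ p (suc i) = app-L n (tail ρ) p i

  app-R : ∀ n {k} (ρ : Env n) (p : Env k) i → app n ρ p (inR n i) ≡ p i
  app-R zero    ρ p i = refl
  app-R (suc n) ρ p i = app-R n (tail ρ) p i

  -- A renaming of n object variables and of the parameters behind them.
  bi : ∀ n m {k l} → (Fin n → Fin m) → (Fin k → Fin l) → Fin (n +ℕ k) → Fin (m +ℕ l)
  bi zero    m f g i       = inR m (g i)
  bi (suc n) m f g zero    = inL m (f zero)
  bi (suc n) m f g (suc i) = bi n m (f ∘ suc) g i

  app-bi : ∀ n m {k l} (f : Fin n → Fin m) (g : Fin k → Fin l) (ρ : Env m) (p : Env l) (q : Env k) →
           (∀ i → p (g i) ≡ q i) → ∀ i → app m ρ p (bi n m f g i) ≡ app n (ρ ∘ f) q i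
  app-bi zero    m f g ρ p q h i       = trans (app-R m ρ p (g i)) (h i)
  app-bi (suc n) m f g ρ p q h zero    = app-L m ρ p (f zero)
  app-bi (suc n) m f g ρ p q h (suc i) = app-bi n m (f ∘ suc) g ρ p q h i

  -- Definability is a certificate attached to an Agda predicate, so that induction and
  -- comprehension apply to predicates written in Agda. The parameters stand behind the object
  -- variables: a quantifier binds position 0 and leaves them alone.
  record Dfn (n : ℕ) (P : Env n → Set) : Set where
    constructor dfn
    field
      k   : ℕ
      fm  : Fm false (n +ℕ k)
      par : Env k
      iff : ∀ ρ → P ρ ⇔ SatL S fm (app n ρ par)

  -- Only the graph has to be definable. This admits functions that are not terms, such as `dec` and
  -- `exp2`, inside definable predicates.
  record DF (n : ℕ) (f : Env n → C) : Set where
    constructor dfun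
    field
      graph : Dfn (suc n) (λ ρ → ρ zero ≡ f (tail ρ))
  open DF

  private
    variable
      n m : ℕ

  D-iff : {P Q : Env n → Set} → (∀ ρ → Q ρ ⇔ P ρ) → Dfn n P → Dfn n Q
  D-iff e (dfn k fm par iff) = dfn k fm par
    (λ ρ → (λ q → proj₁ (iff ρ) (proj₁ (e ρ) q)) , (λ s → proj₂ (e ρ) (proj₂ (iff ρ) s)))

  D-ren : {P : Env n → Set} (r : Fin n → Fin m) → Dfn n P → Dfn m (λ ρ → P (ρ ∘ r))
  D-ren {n = n} {m = m} r (dfn k fm par iff) = dfn k (ren (bi n m r id) fm) par λ ρ →
    let e = Sat-ren (bi n m r id) fm (app-bi n m r id ρ par par (λ _ → refl)) in
    (λ p → proj₂ e (proj₁ (iff (ρ ∘ r)) p)) , (λ s → proj₂ (iff (ρ ∘ r)) (proj₁ e s))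

  private
    wkL : ∀ {n k} l {P : Env n → Set} (fm : Fm false (n +ℕ k)) (par : Env k) (q : Env l) →
          (∀ ρ → P ρ ⇔ SatL S fm (app n ρ par)) →
          ∀ ρ → P ρ ⇔ SatL S (ren (bi n n id (inL k)) fm) (app n ρ (app k par q))
    wkL {n} {k} l fm par q iff ρ =
      let e = Sat-ren (bi n n id (inL k)) fm (app-bi n n id (inL k) ρ (app k par q) par (app-L k par q)) in
      (λ p → proj₂ e (proj₁ (iff ρ) p)) , (λ s → proj₂ (iff ρ) (proj₁ e s))

    wkR : ∀ {n k} l {P : Env n → Set} (fm : Fm false (n +ℕ k)) (par : Env k) (q : Env l) →
          (∀ ρ → P ρ ⇔ SatL S fm (app n ρ par)) →
          ∀ ρ → P ρ ⇔ SatL S (ren (bi n n id (inR l)) fm) (app n ρ (app l q par))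
    wkR {n} {k} l fm par q iff ρ =
      let e = Sat-ren (bi n n id (inR l)) fm (app-bi n n id (inR l) ρ (app l q par) par (app-R l q par)) in
      (λ p → proj₂ e (proj₁ (iff ρ) p)) , (λ s → proj₂ (iff ρ) (proj₁ e s))

  D× : {P Q : Env n → Set} → Dfn n P → Dfn n Q → Dfn n (λ ρ → P ρ × Q ρ)
  D× {n} (dfn k f p i) (dfn l g q j) = dfn (k +ℕ l)
    (ren (bi n n id (inL k)) f ∧f ren (bi n n id (inR k)) g) (app k p q) λ ρ →
    (λ { (a , b) → proj₁ (wkL l f p q i ρ) a , proj₁ (wkR k g q p j ρ) b }) ,
    (λ { (a , b) → proj₂ (wkL l f p q i ρ) a , proj₂ (wkR k g q p j ρ) b })

  D⊎ : {P Q : Env n → Set} → Dfn n P → Dfn n Q → Dfn n (λ ρ → P ρ ⊎ Q ρ)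
  D⊎ {n} (dfn k f p i) (dfn l g q j) = dfn (k +ℕ l)
    (ren (bi n n id (inL k)) f ∨f ren (bi n n id (inR k)) g) (app k p q) λ ρ →
    (λ { (inj₁ a) → inj₁ (proj₁ (wkL l f p q i ρ) a) ; (inj₂ b) → inj₂ (proj₁ (wkR k g q p j ρ) b) }) ,
    (λ { (inj₁ a) → inj₁ (proj₂ (wkL l f p q i ρ) a) ; (inj₂ b) → inj₂ (proj₂ (wkR k g q p j ρ) b) })

  D→ : {P Q : Env n → Set} → Dfn n P → Dfn n Q → Dfn n (λ ρ → P ρ → Q ρ)
  D→ {n} (dfn k f p i) (dfn l g q j) = dfn (k +ℕ l)
    (ren (bi n n id (inL k)) f ⇒ ren (bi n n id (inR k)) g) (app k p q) λ ρ →
    (λ h a → proj₁ (wkR k g q p j ρ) (h (proj₂ (wkL l f p q i ρ) a))) ,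
    (λ h a → proj₂ (wkR k g q p j ρ) (h (proj₁ (wkL l f p q i ρ) a)))

  D⊥ : Dfn n (λ _ → ⊥)
  D⊥ = dfn 0 ⊥f (λ ()) λ ρ → id , id

  D¬ : {P : Env n → Set} → Dfn n P → Dfn n (λ ρ → ¬ P ρ)
  D¬ d = D→ d D⊥

  D∀ : {P : C → Env n → Set} → Dfn (suc n) (λ ρ → P (ρ zero) (tail ρ)) → Dfn n (λ ρ → (x : C) → P x ρ)
  D∀ (dfn k f p i) = dfn k (all f) p λ ρ →
    (λ h x → proj₁ (i (x ∷ ρ)) (h x)) , (λ h x → proj₂ (i (x ∷ ρ)) (h x))

  D∃ : {P : C → Env n → Set} → Dfn (suc n) (λ ρ → P (ρ zero) (tail ρ)) → Dfn n (λ ρ → Σ C (λ x → P x ρ))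
  D∃ (dfn k f p i) = dfn k (ex f) p λ ρ →
    (λ { (x , h) → x , proj₁ (i (x ∷ ρ)) h }) , (λ { (x , h) → x , proj₂ (i (x ∷ ρ)) h })

  module _ {R : C → Set} (d : Dfn 1 (λ ρ → R (ρ zero))) where
    -- A value that no term denotes is named by an existential quantifier over the graph; `rel2`,
    -- `rel3` and `rel4` do the same for more arguments.
    rel1 : {f : Env n → C} → DF n f → Dfn n (λ ρ → R (f ρ))
    rel1 {n} {f} df = D-iff (λ ρ → (λ r → f ρ , refl , r) , (λ { (_ , refl , r) → r }))
      (D∃ {P = λ x ρ → (x ≡ f ρ) × R x} (D× (graph df) (D-ren (λ _ → zero) d)))

  wkF : {f : Env n → C} → DF n f → DF (suc n) (λ ρ → f (tail ρ))
  wkF {f = f} df = dfun (D-ren {P = λ ρ → ρ zero ≡ f (tail ρ)} (liftF suc) (graph df))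

  private
    two : Fin 2 → Fin (suc (suc n))
    two zero = suc zero
    two (suc zero) = zero

    three : Fin 3 → Fin (suc (suc (suc n)))
    three zero = suc (suc zero)
    three (suc zero) = suc zero
    three (suc (suc zero)) = zero

    four : Fin 4 → Fin (suc (suc (suc (suc n))))
    four zero = suc (suc (suc zero))
    four (suc zero) = suc (suc zero)
    four (suc (suc zero)) = suc zero
    four (suc (suc (suc zero))) = zero

  module _ {R : C → C → Set} (d : Dfn 2 (λ ρ → R (ρ zero) (ρ (suc zero)))) where
    rel2 : {f g : Env n → C} → DF n f → DF n g → Dfn n (λ ρ → R (f ρ) (g ρ))
    rel2 {n} {f} {g} df dg = D-iff (λ ρ → (λ r → f ρ , refl , g ρ , refl , r) , (λ { (_ , refl , _ , refl , r) → r }))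
      (D∃ {P = λ x ρ → (x ≡ f ρ) × Σ C (λ y → (y ≡ g ρ) × R x y)}
        (D× (graph df) (D∃ {P = λ y ρ → (y ≡ g (tail ρ)) × R (ρ zero) y} (D× (graph (wkF dg)) (D-ren two d)))))

  module _ {R : C → C → C → Set} (d : Dfn 3 (λ ρ → R (ρ zero) (ρ (suc zero)) (ρ (suc (suc zero))))) where
    rel3 : {f g h : Env n → C} → DF n f → DF n g → DF n h → Dfn n (λ ρ → R (f ρ) (g ρ) (h ρ))
    rel3 {n} {f} {g} {h} df dg dh =
      D-iff (λ ρ → (λ r → f ρ , refl , g ρ , refl , h ρ , refl , r) , (λ { (_ , refl , _ , refl , _ , refl , r) → r }))
      (D∃ {P = λ x ρ → (x ≡ f ρ) × Σ C (λ y → (y ≡ g ρ) × Σ C (λ w → (w ≡ h ρ) × R x y w))}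
        (D× (graph df) (D∃ {P = λ y ρ → (y ≡ g (tail ρ)) × Σ C (λ w → (w ≡ h (tail ρ)) × R (ρ zero) y w)}
          (D× (graph (wkF dg)) (D∃ {P = λ w ρ → (w ≡ h (tail (tail ρ))) × R (ρ (suc zero)) (ρ zero) w}
            (D× (graph (wkF (wkF dh))) (D-ren three d)))))))

  module _ {R : C → C → C → C → Set}
           (d : Dfn 4 (λ ρ → R (ρ zero) (ρ (suc zero)) (ρ (suc (suc zero))) (ρ (suc (suc (suc zero)))))) where
    rel4 : {f g h l : Env n → C} → DF n f → DF n g → DF n h → DF n l → Dfn n (λ ρ → R (f ρ) (g ρ) (h ρ) (l ρ))
    rel4 {n} {f} {g} {h} {l} df dg dh dl =
      D-iff (λ ρ → (λ r → f ρ , refl , g ρ , refl , h ρ , refl , l ρ , refl , r) ,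
                   (λ { (_ , refl , _ , refl , _ , refl , _ , refl , r) → r }))
      (D∃ {P = λ x ρ → (x ≡ f ρ) × Σ C (λ y → (y ≡ g ρ) × Σ C (λ w → (w ≡ h ρ) × Σ C (λ v → (v ≡ l ρ) × R x y w v)))}
        (D× (graph df) (D∃ {P = λ y ρ → (y ≡ g (tail ρ)) × Σ C (λ w → (w ≡ h (tail ρ)) × Σ C (λ v → (v ≡ l (tail ρ)) × R (ρ zero) y w v))}
          (D× (graph (wkF dg)) (D∃ {P = λ w ρ → (w ≡ h (tail (tail ρ))) × Σ C (λ v → (v ≡ l (tail (tail ρ))) × R (ρ (suc zero)) (ρ zero) w v)}
            (D× (graph (wkF (wkF dh))) (D∃ {P = λ v ρ → (v ≡ l (tail (tail (tail ρ)))) × R (ρ (suc (suc zero))) (ρ (suc zero)) (ρ zero) v}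
              (D× (graph (wkF (wkF (wkF dl)))) (D-ren four d)))))))))

  fm≐ : (s t : Term n) → Dfn n (λ ρ → eval S s ρ ≡ eval S t ρ)
  fm≐ {n} s t = dfn 0 (renT (inL n) s ≐ renT (inL n) t) (λ ()) λ ρ →
    (λ p → proj₂ (Sat-ren {b = false} {P = λ _ → ⊤} (inL n) (s ≐ t) {σ = ρ} (app-L n ρ _)) p) ,
    (λ p → proj₁ (Sat-ren {b = false} {P = λ _ → ⊤} (inL n) (s ≐ t) (app-L n ρ _)) p)

  fm≼ : (s t : Term n) → Dfn n (λ ρ → eval S s ρ ≤ eval S t ρ)
  fm≼ {n} s t = dfn 0 (renT (inL n) s ≼ renT (inL n) t) (λ ()) λ ρ →
    (λ p → proj₂ (Sat-ren {b = false} {P = λ _ → ⊤} (inL n) (s ≼ t) {σ = ρ} (app-L n ρ _)) p) ,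
    (λ p → proj₁ (Sat-ren {b = false} {P = λ _ → ⊤} (inL n) (s ≼ t) (app-L n ρ _)) p)

  DFvar : (i : Fin n) → DF n (λ ρ → ρ i)
  DFvar i = dfun (fm≐ (var zero) (var (suc i)))

  DFcon : (c : C) → DF n (λ _ → c)
  DFcon {n} c = dfun (dfn 1 (var zero ≐ var (suc (inR n zero))) (λ _ → c) λ ρ →
    (λ p → trans p (sym (app-R n (tail ρ) _ zero))) , (λ p → trans p (app-R n (tail ρ) _ zero)))

  D≡ : {f g : Env n → C} → DF n f → DF n g → Dfn n (λ ρ → f ρ ≡ g ρ)
  D≡ = rel2 {R = _≡_} (fm≐ (var zero) (var (suc zero)))

  D≢ : {f g : Env n → C} → DF n f → DF n g → Dfn n (λ ρ → f ρ ≢ g ρ)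
  D≢ df dg = D¬ (D≡ df dg)

  D≤ : {f g : Env n → C} → DF n f → DF n g → Dfn n (λ ρ → f ρ ≤ g ρ)
  D≤ = rel2 {R = _≤_} (fm≼ (var zero) (var (suc zero)))

  module _ {F : C → C} (d : Dfn 2 (λ ρ → ρ zero ≡ F (ρ (suc zero)))) where
    fun1 : {f : Env n → C} → DF n f → DF n (λ ρ → F (f ρ))
    fun1 df = dfun (rel2 {R = λ a b → a ≡ F b} d (DFvar zero) (wkF df))

  module _ {F : C → C → C} (d : Dfn 3 (λ ρ → ρ zero ≡ F (ρ (suc zero)) (ρ (suc (suc zero))))) where
    fun2 : {f g : Env n → C} → DF n f → DF n g → DF n (λ ρ → F (f ρ) (g ρ))
    fun2 df dg = dfun (rel3 {R = λ a b c → a ≡ F b c} d (DFvar zero) (wkF df) (wkF dg))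

  module _ {F : C → C → C → C} (d : Dfn 4 (λ ρ → ρ zero ≡ F (ρ (suc zero)) (ρ (suc (suc zero))) (ρ (suc (suc (suc zero)))))) where
    fun3 : {f g h : Env n → C} → DF n f → DF n g → DF n h → DF n (λ ρ → F (f ρ) (g ρ) (h ρ))
    fun3 df dg dh = dfun (rel4 {R = λ a b c e → a ≡ F b c e} d (DFvar zero) (wkF df) (wkF dg) (wkF dh))

  DF⊕ : {f g : Env n → C} → DF n f → DF n g → DF n (λ ρ → f ρ ⊕ g ρ)
  DF⊕ = fun2 {F = _⊕_} (fm≐ (var zero) (var (suc zero) +ₜ var (suc (suc zero))))

  DF⊗ : {f g : Env n → C} → DF n f → DF n g → DF n (λ ρ → f ρ ⊗ g ρ)
  DF⊗ = fun2 {F = _⊗_} (fm≐ (var zero) (var (suc zero) *ₜ var (suc (suc zero))))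

  DFz : DF n (λ _ → z)
  DFz = dfun (fm≐ (var zero) 0ₜ)

  DFo : DF n (λ _ → o)
  DFo = dfun (fm≐ (var zero) 1ₜ)

-- The formula `phi`.

module Formulas where
  private
    variable
      b : Bool
      n : ℕ

    v0 : Term (suc n)
    v0 = var zero
    v1 : Term (suc (suc n))
    v1 = var (suc zero)
    v2 : Term (suc (suc (suc n)))
    v2 = var (suc (suc zero))
    v3 : Term (suc (suc (suc (suc n))))
    v3 = var (suc (suc (suc zero)))
    v4 : Term (suc (suc (suc (suc (suc n)))))
    v4 = var (suc (suc (suc (suc zero))))
    v5 : Term (suc (suc (suc (suc (suc (suc n))))))
    v5 = var (suc (suc (suc (suc (suc zero)))))
    v6 : Term (suc (suc (suc (suc (suc (suc (suc n)))))))
    v6 = var (suc (suc (suc (suc (suc (suc zero))))))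
    v7 : Term (suc (suc (suc (suc (suc (suc (suc (suc n))))))))
    v7 = var (suc (suc (suc (suc (suc (suc (suc zero)))))))
    v8 : Term (suc (suc (suc (suc (suc (suc (suc (suc (suc n)))))))))
    v8 = var (suc (suc (suc (suc (suc (suc (suc (suc zero))))))))

    wk : Term n → Term (suc n)
    wk = renT suc

    sT : Term n → Term n
    sT t = t +ₜ 1ₜ

    lt : Term n → Term n → Fm b n
    lt p q = sT p ≼ q

    ¬f : Fm b n → Fm b n
    ¬f φ = φ ⇒ ⊥f

    pairT : Term n → Term n → Term n
    pairT p q = ((p +ₜ q) *ₜ (p +ₜ q)) +ₜ p

  -- Membership by Gödel's β-function: the code is a triple of `u`, `v` and a bound. The formula
  -- copies `Mem` quantifier by quantifier, so its satisfaction in M unfolds to `Mem`.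
  memF : Term n → Term n → Fm b n
  memF x a = ex (ex (ex ((wk (wk (wk a)) ≐ pairT (pairT v1 v0) v2) ∧f (lt (wk (wk (wk x))) v2 ∧f
    ex ((sT (sT (wk (wk (wk (wk x)))) *ₜ v1) *ₜ v0) ≐ v2)))))

  -- Decoding is total and single-valued: the least value listed for `x`, and 0 if none is listed.
  valF : Term n → Term n → Term n → Fm b n
  valF y a x = (memF (pairT x y) a ∧f all (lt v0 (wk y) ⇒ ¬f (memF (pairT (wk x) v0) (wk a))))
            ∨f ((y ≐ 0ₜ) ∧f all (¬f (memF (pairT (wk x) v0) (wk a))))

  -- Variables p X n g m: p is a g-free sequence of length m in X.
  opaque
    freeF : Fm false 5
    freeF = all (all (all (lt v2 v7 ⇒ (lt v1 v7 ⇒ (lt v0 v7 ⇒ (¬f (v2 ≐ v1) ⇒ (¬f (v2 ≐ v0) ⇒ (¬f (v1 ≐ v0) ⇒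
      ex (lt v0 v6 ∧f ex (valF v0 v8 v1 ∧f
        ex (valF v0 v6 v4 ∧f ex (valF v0 v7 v6 ∧f ex (valF v0 v8 v5 ∧f
        ex (valF v0 v4 v3 ∧f ex (valF v0 v5 v3 ∧f ex (valF v0 v6 v3 ∧f (lt v2 v1 ∧f lt v1 v0)))))))))))))))))
      ∧f all (lt v0 v5 ⇒ ex (valF v0 v2 v1 ∧f memF v0 v3))

  pick : ∀ {A : Set} → A → A → A → A → A → Fin 5 → A
  pick a c d e f zero = a
  pick a c d e f (suc zero) = c
  pick a c d e f (suc (suc zero)) = d
  pick a c d e f (suc (suc (suc zero))) = e
  pick a c d e f (suc (suc (suc (suc zero)))) = f

  pick3 : ∀ {A : Set} → A → A → A → Fin 3 → A
  pick3 a c d zero = a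
  pick3 a c d (suc zero) = c
  pick3 a c d (suc (suc zero)) = d

  pick2 : ∀ {A : Set} → A → A → Fin 2 → A
  pick2 a c zero = a
  pick2 a c (suc zero) = c

  private
    f0 : Fin (suc n)
    f0 = zero
    f1 : Fin (suc (suc n))
    f1 = suc zero
    f2 : Fin (suc (suc (suc n)))
    f2 = suc (suc zero)
    f3 : Fin (suc (suc (suc (suc n))))
    f3 = suc (suc (suc zero))
    f4 : Fin (suc (suc (suc (suc (suc n)))))
    f4 = suc (suc (suc (suc zero)))
    f5 : Fin (suc (suc (suc (suc (suc (suc n))))))
    f5 = suc (suc (suc (suc (suc zero))))
    f6 : Fin (suc (suc (suc (suc (suc (suc (suc n)))))))
    f6 = suc (suc (suc (suc (suc (suc zero)))))
    f8 : Fin (suc (suc (suc (suc (suc (suc (suc (suc (suc n)))))))))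
    f8 = suc (suc (suc (suc (suc (suc (suc (suc zero)))))))

  rA4 : Fin 5 → Fin 6
  rA4 = pick f0 f1 f2 f3 f5
  rAin : Fin 2 → Fin 5
  rAin = pick2 f3 f0
  rB4 rB5 : Fin 5 → Fin 9
  rB4 = pick f1 f2 f5 f6 f8
  rB5 = pick f0 f2 f3 f4 f8
  rBx : Fin 3 → Fin 9
  rBx = pick3 f1 f0 f8
  rBin : Fin 2 → Fin 7
  rBin = pick2 f5 f0
  r5 : Fin 5 → Fin 6
  r5 = pick f1 f2 f3 f4 f0

  -- Variables p X n g x, for sequences of length x + 4 and x + 5.
  opaque
    free4 free5 : Fm false 5
    free4 = ex ((v0 ≐ sT (sT (sT (sT v5)))) ∧f ren r5 freeF)
    free5 = ex ((v0 ≐ sT (sT (sT (sT (sT v5))))) ∧f ren r5 freeF)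

  -- Variables p q x.
  opaque
    extF : Fm false 3
    extF = ex ((v0 ≐ sT (sT (sT (sT v3)))) ∧f all (lt v0 v1 ⇒ ex (valF v0 v3 v1 ∧f valF v0 v4 v1)))

  opaque
    inF : Fm false 2
    inF = memF v0 v1

  lift : Fm false n → Fm true n
  lift (p ≐ q)  = p ≐ q
  lift (p ≼ q)  = p ≼ q
  lift ⊥f       = ⊥f
  lift (φ ⇒ ψ)  = lift φ ⇒ lift ψ
  lift (φ ∧f ψ) = lift φ ∧f lift ψ
  lift (φ ∨f ψ) = lift φ ∨f lift ψ
  lift (all φ)  = all (lift φ)
  lift (ex φ)   = ex (lift φ)

  Sat-lift : ∀ (S : Str) {P : Str.C S → Set} {n} (φ : Fm false n) (ρ : Fin n → Str.C S) → Sat S P (lift φ) ρ ⇔ SatL S φ ρ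
  Sat-lift S (p ≐ q) ρ = id , id
  Sat-lift S (p ≼ q) ρ = id , id
  Sat-lift S ⊥f ρ = id , id
  Sat-lift S (φ ⇒ ψ) ρ = (λ f p → proj₁ (Sat-lift S ψ ρ) (f (proj₂ (Sat-lift S φ ρ) p))) , (λ f p → proj₂ (Sat-lift S ψ ρ) (f (proj₁ (Sat-lift S φ ρ) p)))
  Sat-lift S (φ ∧f ψ) ρ = (λ (p , q) → proj₁ (Sat-lift S φ ρ) p , proj₁ (Sat-lift S ψ ρ) q) , (λ (p , q) → proj₂ (Sat-lift S φ ρ) p , proj₂ (Sat-lift S ψ ρ) q)
  Sat-lift S (φ ∨f ψ) ρ =
    (λ { (inj₁ p) → inj₁ (proj₁ (Sat-lift S φ ρ) p) ; (inj₂ q) → inj₂ (proj₁ (Sat-lift S ψ ρ) q) }) ,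
    (λ { (inj₁ p) → inj₁ (proj₂ (Sat-lift S φ ρ) p) ; (inj₂ q) → inj₂ (proj₂ (Sat-lift S ψ ρ) q) })
  Sat-lift S (all φ) ρ = (λ f x → proj₁ (Sat-lift S φ (x ∷ ρ)) (f x)) , (λ f x → proj₂ (Sat-lift S φ (x ∷ ρ)) (f x))
  Sat-lift S (ex φ) ρ = (λ (x , p) → x , proj₁ (Sat-lift S φ (x ∷ ρ)) p) , (λ (x , p) → x , proj₂ (Sat-lift S φ (x ∷ ρ)) p)

  -- The cut gcis(M , N) in the pair (N , M).
  cutF : Term n → Fm true n
  cutF t = mem t ∧f all ((v0 ≼ wk t) ⇒ mem v0)

  opaque
    -- A coded neighbourhood of `d` is an element `X` of M with `d` in `X`. The sequence is also
    -- taken from M, so that its freeness can be evaluated in M; only `d` lies outside.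
    partA : Fm true 4
    partA = all (mem v0 ⇒ (lift (ren rAin inF) ⇒ ex (mem v0 ∧f lift (ren rA4 free4))))

    -- The rival orders come before `X`: each list of orders is defeated in some neighbourhood,
    -- which may depend on the list. Their number is bounded by an element of the cut, for only then
    -- can a condition be aligned with them.
    partB : Fm true 4
    partB = all (all (mem v1 ⇒ (cutF v0 ⇒ ex (mem v0 ∧f (lift (ren rBin inF) ∧f
      all (all (mem v1 ⇒ (mem v0 ⇒ (lift (ren rB4 free4) ⇒ (lift (ren rB5 free5) ⇒ (lift (ren rBx extF) ⇒ ⊥f)))))))))))

  -- Variables inside the three quantifiers: n g d x.
  phi : Fm true 1
  phi = cutF v0 ∧f ex (ex (ex (mem v1 ∧f (cutF v0 ∧f (partA ∧f partB)))))

-- Arithmetic in a model of PA.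

module InModel (em : ExcludedMiddle 0ℓ) (M : Str) (pa : IsPA M) where
  open Semantics M public
  open Str M public renaming (_⊕_ to infixl 6 _+_; _⊗_ to infixl 7 _*_; _≤_ to infix 4 _≤_)
  module PA = IsPA pa

  s : C → C
  s x = x + o

  infix 4 _<_
  _<_ : C → C → Set
  x < y = s x ≤ y

  DFs : ∀ {n} {f : Env n → C} → DF n f → DF n (λ ρ → s (f ρ))
  DFs df = DF⊕ df DFo

  D< : ∀ {n} {f g : Env n → C} → DF n f → DF n g → Dfn n (λ ρ → f ρ < g ρ)
  D< df dg = D≤ (DFs df) dg

  opaque
    ind : (P : C → Set) → Dfn 1 (λ ρ → P (ρ zero)) → P z → (∀ x → P x → P (s x)) → ∀ x → P x
    ind P (dfn k fm par iff) b st x = proj₂ (iff (λ _ → x))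
      (PA.induction fm par (proj₁ (iff (λ _ → z)) b)
        (λ y p → proj₁ (iff (λ _ → s y)) (st y (proj₂ (iff (λ _ → y)) p))) x)

  opaque
    cases : ∀ x → (x ≡ z) ⊎ Σ C (λ y → x ≡ s y)
    cases = ind (λ x → (x ≡ z) ⊎ Σ C (λ y → x ≡ s y)) (D⊎ (D≡ (DFvar _) (DFcon _)) (D∃ (D≡ (DFvar _) (DFs (DFvar _))))) (inj₁ refl) (λ x _ → inj₂ (x , refl))

  +0 : ∀ x → x + z ≡ x
  +0 = PA.+-0
  +s : ∀ x y → x + s y ≡ s (x + y)
  +s = PA.+-succ

  opaque
    0+ : ∀ x → z + x ≡ x
    0+ = ind (λ x → z + x ≡ x) (D≡ (DF⊕ (DFcon _) (DFvar _)) (DFvar _)) (+0 z) (λ x p → trans (+s z x) (cong s p))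

  opaque
    s+ : ∀ x y → s x + y ≡ s (x + y)
    s+ x = ind (λ y → s x + y ≡ s (x + y)) (D≡ (DF⊕ (DFcon _) (DFvar _)) (DFs (DF⊕ (DFcon _) (DFvar _)))) (trans (+0 (s x)) (cong s (sym (+0 x))))
      (λ y p → trans (+s (s x) y) (trans (cong s p) (cong s (sym (+s x y)))))

  opaque
    +c : ∀ x y → x + y ≡ y + x
    +c x = ind (λ y → x + y ≡ y + x) (D≡ (DF⊕ (DFcon _) (DFvar _)) (DF⊕ (DFvar _) (DFcon _))) (trans (+0 x) (sym (0+ x)))
      (λ y p → trans (+s x y) (trans (cong s p) (sym (s+ y x))))

  opaque
    +a : ∀ x y w → (x + y) + w ≡ x + (y + w)
    +a x y = ind (λ w → (x + y) + w ≡ x + (y + w)) (D≡ (DF⊕ (DFcon _) (DFvar _)) (DF⊕ (DFcon _) (DF⊕ (DFcon _) (DFvar _)))) (trans (+0 _) (cong (x +_) (sym (+0 y))))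
      (λ w p → trans (+s (x + y) w) (trans (cong s p) (trans (sym (+s x (y + w))) (cong (x +_) (sym (+s y w))))))

  *0 : ∀ x → x * z ≡ z
  *0 = PA.*-0
  *s : ∀ x y → x * s y ≡ x * y + x
  *s = PA.*-succ

  opaque
    0* : ∀ x → z * x ≡ z
    0* = ind (λ x → z * x ≡ z) (D≡ (DF⊗ (DFcon _) (DFvar _)) (DFcon _)) (*0 z) (λ x p → trans (*s z x) (trans (+0 _) p))

  private
    4+ : ∀ a b c d → (a + b) + (c + d) ≡ (a + c) + (b + d)
    4+ a b c d = trans (+a a b (c + d)) (trans (cong (a +_) (trans (sym (+a b c d)) (trans (cong (_+ d) (+c b c)) (+a c b d)))) (sym (+a a c (b + d))))

  opaque
    s* : ∀ x y → s x * y ≡ x * y + y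
    s* x = ind (λ y → s x * y ≡ x * y + y) (D≡ (DF⊗ (DFcon _) (DFvar _)) (DF⊕ (DF⊗ (DFcon _) (DFvar _)) (DFvar _))) (trans (*0 _) (sym (trans (+0 _) (*0 x))))
      (λ y p → trans (*s (s x) y) (trans (cong (_+ s x) p) (trans (4+ (x * y) y x o) (cong (_+ s y) (sym (*s x y))))))

  opaque
    *c : ∀ x y → x * y ≡ y * x
    *c x = ind (λ y → x * y ≡ y * x) (D≡ (DF⊗ (DFcon _) (DFvar _)) (DF⊗ (DFvar _) (DFcon _))) (trans (*0 x) (sym (0* x)))
      (λ y p → trans (*s x y) (trans (cong (_+ x) p) (sym (s* y x))))

  opaque
    *d : ∀ x y w → x * (y + w) ≡ x * y + x * w
    *d x y = ind (λ w → x * (y + w) ≡ x * y + x * w) (D≡ (DF⊗ (DFcon _) (DF⊕ (DFcon _) (DFvar _))) (DF⊕ (DFcon _) (DF⊗ (DFcon _) (DFvar _))))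
      (trans (cong (x *_) (+0 y)) (sym (trans (cong (x * y +_) (*0 x)) (+0 _))))
      (λ w p → trans (cong (x *_) (+s y w)) (trans (*s x (y + w)) (trans (cong (_+ x) p) (trans (+a (x * y) (x * w) x) (cong (x * y +_) (sym (*s x w)))))))

  *d' : ∀ x y w → (y + w) * x ≡ y * x + w * x
  *d' x y w = trans (*c _ x) (trans (*d x y w) (cong₂ _+_ (*c x y) (*c x w)))

  opaque
    *a : ∀ x y w → (x * y) * w ≡ x * (y * w)
    *a x y = ind (λ w → (x * y) * w ≡ x * (y * w)) (D≡ (DF⊗ (DFcon _) (DFvar _)) (DF⊗ (DFcon _) (DF⊗ (DFcon _) (DFvar _)))) (trans (*0 _) (sym (trans (cong (x *_) (*0 y)) (*0 x))))
      (λ w p → trans (*s (x * y) w) (trans (cong (_+ x * y) p) (sym (trans (cong (x *_) (*s y w)) (*d x (y * w) y)))))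

  o≡s0 : o ≡ s z
  o≡s0 = sym (0+ o)

  *1 : ∀ x → x * o ≡ x
  *1 x = trans (cong (x *_) o≡s0) (trans (*s x z) (trans (cong (_+ x) (*0 x)) (0+ x)))

  1* : ∀ x → o * x ≡ x
  1* x = trans (*c o x) (*1 x)

  semiring : CommutativeSemiring 0ℓ 0ℓ
  semiring = record
    { Carrier = C ; _≈_ = _≡_ ; _+_ = _+_ ; _*_ = _*_ ; 0# = z ; 1# = o
    ; isCommutativeSemiring = record
      { isSemiring = record
        { isSemiringWithoutAnnihilatingZero = record
          { +-isCommutativeMonoid = record
            { isMonoid = record
              { isSemigroup = record { isMagma = record { isEquivalence = isEquivalence ; ∙-cong = cong₂ _+_ } ; assoc = +a }
              ; identity = 0+ , +0 }
            ; comm = +c }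
          ; *-cong = cong₂ _*_ ; *-assoc = *a ; *-identity = 1* , *1 ; distrib = *d , *d' }
        ; zero = 0* , *0 }
      ; *-comm = *c } }

  open NatCoeff semiring using (solve; _:=_; _:+_; _:*_; con)

  le : ∀ {x y} w → x + w ≡ y → x ≤ y
  le {x} {y} w p = PA.≤-def₂ x y w p

  un : ∀ {x y} → x ≤ y → Σ C (λ w → x + w ≡ y)
  un {x} {y} = PA.≤-def₁ x y

  ≤r : ∀ {x} → x ≤ x
  ≤r {x} = le z (+0 x)

  ≡⇒≤ : ∀ {x y} → x ≡ y → x ≤ y
  ≡⇒≤ refl = ≤r

  ≤t : ∀ {x y w} → x ≤ y → y ≤ w → x ≤ w
  ≤t p q with un p | un q
  ... | a , refl | b , refl = le (a + b) (sym (+a _ a b))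

  0≤ : ∀ {x} → z ≤ x
  0≤ {x} = le x (0+ x)

  s≢0 : ∀ {x} → s x ≢ z
  s≢0 {x} = PA.succ≢0 x

  s-inj : ∀ {x y} → s x ≡ s y → x ≡ y
  s-inj {x} {y} = PA.succ-inj x y

  opaque
    +cancelʳ : ∀ w {x y} → x + w ≡ y + w → x ≡ y
    +cancelʳ w {x} {y} = ind (λ w → x + w ≡ y + w → x ≡ y) (D→ (D≡ (DF⊕ (DFcon _) (DFvar _)) (DF⊕ (DFcon _) (DFvar _))) (D≡ (DFcon _) (DFcon _)))
      (λ p → trans (sym (+0 x)) (trans p (+0 y)))
      (λ v h p → h (s-inj (trans (sym (+s x v)) (trans p (+s y v))))) w

  +cancelˡ : ∀ w {x y} → w + x ≡ w + y → x ≡ y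
  +cancelˡ w {x} {y} p = +cancelʳ w (trans (+c x w) (trans p (+c w y)))

  +≡0 : ∀ {x y} → x + y ≡ z → x ≡ z
  +≡0 {x} {y} p with cases x
  ... | inj₁ q = q
  ... | inj₂ (v , refl) = ⊥-elim (s≢0 (trans (sym (s+ v y)) p))

  ≤0 : ∀ {x} → x ≤ z → x ≡ z
  ≤0 p = +≡0 (proj₂ (un p))

  ≤a : ∀ {x y} → x ≤ y → y ≤ x → x ≡ y
  ≤a {x} p q with un p | un q
  ... | a , refl | b , e with +≡0 (+cancelˡ x (trans (sym (+a x a b)) (trans e (sym (+0 x)))))
  ... | refl = sym (+0 x)

  s≤s : ∀ {x y} → x ≤ y → s x ≤ s y
  s≤s {x} p with un p
  ... | w , refl = le w (s+ x w)

  s≤s⁻ : ∀ {x y} → s x ≤ s y → x ≤ y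
  s≤s⁻ {x} p with un p
  ... | w , e = le w (s-inj (trans (sym (s+ x w)) e))

  <s : ∀ {x} → x < s x
  <s = ≤r

  <⇒≤ : ∀ {x y} → x < y → x ≤ y
  <⇒≤ p = ≤t (le o refl) p

  ≤s : ∀ {x} → x ≤ s x
  ≤s = le o refl

  <irr : ∀ {x} → ¬ (x < x)
  <irr {x} p with un p
  ... | w , e = s≢0 (trans (sym (+s z w)) (trans (0+ (s w)) (+cancelˡ x (trans (+s x w) (trans (sym (s+ x w)) (trans e (sym (+0 x))))))))

  <≢ : ∀ {x y} → x < y → x ≢ y
  <≢ p refl = <irr p

  <t : ∀ {x y w} → x < y → y < w → x < w
  <t p q = ≤t p (<⇒≤ q)

  ≤<t : ∀ {x y w} → x ≤ y → y < w → x < w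
  ≤<t p q = ≤t (s≤s p) q

  <≤t : ∀ {x y w} → x < y → y ≤ w → x < w
  <≤t = ≤t

  opaque
    tri : ∀ x y → x < y ⊎ (x ≡ y ⊎ y < x)
    tri x = ind (λ y → x < y ⊎ (x ≡ y ⊎ y < x)) (D⊎ (D< (DFcon _) (DFvar _)) (D⊎ (D≡ (DFcon _) (DFvar _)) (D< (DFvar _) (DFcon _)))) base step
      where
      base : x < z ⊎ (x ≡ z ⊎ z < x)
      base with cases x
      ... | inj₁ p = inj₂ (inj₁ p)
      ... | inj₂ (v , refl) = inj₂ (inj₂ (s≤s 0≤))
      step : ∀ y → x < y ⊎ (x ≡ y ⊎ y < x) → x < s y ⊎ (x ≡ s y ⊎ s y < x)
      step y (inj₁ p) = inj₁ (≤t p ≤s)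
      step y (inj₂ (inj₁ refl)) = inj₁ ≤r
      step y (inj₂ (inj₂ p)) with un p
      ... | w , e with cases w
      ... | inj₁ refl = inj₂ (inj₁ (trans (sym e) (+0 _)))
      ... | inj₂ (v , refl) = inj₂ (inj₂ (le v (trans (s+ (s y) v) (trans (sym (+s (s y) v)) e))))

  ≤⊎< : ∀ x y → x ≤ y ⊎ y < x
  ≤⊎< x y with tri x y
  ... | inj₁ p = inj₁ (<⇒≤ p)
  ... | inj₂ (inj₁ p) = inj₁ (≡⇒≤ p)
  ... | inj₂ (inj₂ p) = inj₂ p

  ≰⇒> : ∀ {x y} → ¬ (x ≤ y) → y < x
  ≰⇒> {x} {y} n with ≤⊎< x y
  ... | inj₁ p = ⊥-elim (n p)
  ... | inj₂ p = p

  ≮⇒≥ : ∀ {x y} → ¬ (x < y) → y ≤ x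
  ≮⇒≥ {x} {y} n with ≤⊎< y x
  ... | inj₁ p = p
  ... | inj₂ p = ⊥-elim (n p)

  <s⇒ : ∀ {x y} → x < s y → x < y ⊎ x ≡ y
  <s⇒ {x} {y} p with tri x y
  ... | inj₁ q = inj₁ q
  ... | inj₂ (inj₁ q) = inj₂ q
  ... | inj₂ (inj₂ q) = ⊥-elim (<irr (<≤t q (s≤s⁻ p)))

  ≤⇒<⊎≡ : ∀ {x y} → x ≤ y → x < y ⊎ x ≡ y
  ≤⇒<⊎≡ p = <s⇒ (s≤s p)

  ≢⇒<> : ∀ {x y} → x ≢ y → x < y ⊎ y < x
  ≢⇒<> {x} {y} n with tri x y
  ... | inj₁ p = inj₁ p
  ... | inj₂ (inj₁ p) = ⊥-elim (n p)
  ... | inj₂ (inj₂ p) = inj₂ p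

  x≮0 : ∀ {x} → ¬ (x < z)
  x≮0 p = s≢0 (≤0 p)

  0<s : ∀ {x} → z < s x
  0<s = s≤s 0≤

  ≢0⇒0< : ∀ {x} → x ≢ z → z < x
  ≢0⇒0< {x} n with cases x
  ... | inj₁ p = ⊥-elim (n p)
  ... | inj₂ (y , refl) = 0<s

  +mono : ∀ {a b c d} → a ≤ b → c ≤ d → a + c ≤ b + d
  +mono {a} {b} {c} {d} p q with un p | un q
  ... | u , refl | v , refl = le (u + v) (4+ a c u v)

  *mono : ∀ {a b c d} → a ≤ b → c ≤ d → a * c ≤ b * d
  *mono {a} {b} {c} {d} p q with un p | un q
  ... | u , refl | v , refl = le (a * v + (u * c + u * v))
    (solve 4 (λ a c u v → a :* c :+ (a :* v :+ (u :* c :+ u :* v)) := (a :+ u) :* (c :+ v)) refl a c u v)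

  ≤+ : ∀ {x} y → x ≤ x + y
  ≤+ y = le y refl

  ≤+' : ∀ {x} y → x ≤ y + x
  ≤+' {x} y = le y (+c x y)

  ≤* : ∀ {x} y → z < y → x ≤ x * y
  ≤* {x} y p = ≤t (≡⇒≤ (sym (*1 x))) (*mono ≤r (≤t (≡⇒≤ o≡s0) p))

  ≤*' : ∀ {x} y → z < y → x ≤ y * x
  ≤*' {x} y p = ≤t (≤* y p) (≡⇒≤ (*c x y))

  lem : (P : Set) → P ⊎ ¬ P
  lem P with em {P}
  ... | yes p = inj₁ p
  ... | no p = inj₂ p

  dne : {P : Set} → ¬ ¬ P → P
  dne {P} nn with em {P}
  ... | yes p = p
  ... | no p = ⊥-elim (nn p)

  ¬∀⇒∃ : {A : Set} {P : A → Set} → ¬ (∀ x → P x) → Σ A (λ x → ¬ P x)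
  ¬∀⇒∃ n = dne (λ h → n (λ x → dne (λ q → h (x , q))))

  Least : (C → Set) → C → Set
  Least P m = P m × (∀ y → y < m → ¬ P y)

  opaque
    lnp : (P : C → Set) → Dfn 1 (λ ρ → P (ρ zero)) → ∀ x → P x → Σ C (Least P)
    lnp P d x px = dne λ none →
      let noneBelow = ind (λ w → (y : C) → y < w → ¬ P y)
            (D∀ (D→ (D< (DFvar zero) (DFvar (suc zero))) (D¬ (D-ren (λ _ → zero) d))))
            (λ y y<0 _ → x≮0 y<0)
            (λ w h y y<sw py → none (y , py , λ v v<y → h v (<≤t v<y (s≤s⁻ y<sw))))
      in noneBelow (s x) x <s px

  *cancel< : ∀ w {x y} → x * w < y * w → x < y
  *cancel< w {x} {y} p with ≤⊎< y x
  ... | inj₁ q = ⊥-elim (<irr (<≤t p (*mono q ≤r)))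
  ... | inj₂ q = q

  opaque
    divmod : ∀ d → z < d → ∀ x → Σ C (λ q → Σ C (λ r → (x ≡ d * q + r) × r < d))
    divmod d d>0 = ind (λ x → Σ C (λ q → Σ C (λ r → (x ≡ d * q + r) × r < d))) (D∃ (D∃ (D× (D≡ (DFvar _) (DF⊕ (DF⊗ (DFcon _) (DFvar _)) (DFvar _))) (D< (DFvar _) (DFcon _)))))
      (z , z , sym (trans (+0 _) (*0 d)) , d>0) step
      where
      step : ∀ x → Σ C (λ q → Σ C (λ r → (x ≡ d * q + r) × r < d)) → Σ C (λ q → Σ C (λ r → (s x ≡ d * q + r) × r < d))
      step x (q , r , refl , r<d) with ≤⇒<⊎≡ r<d
      ... | inj₁ sr<d = q , s r , sym (+s (d * q) r) , sr<d
      ... | inj₂ refl = s q , z , trans (sym (+s (d * q) r)) (sym (trans (+0 _) (*s d q))) , d>0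

  -- Pairs, coded sets and coded functions.

  pair : C → C → C
  pair x y = (x + y) * (x + y) + x

  DFpair : ∀ {n} {f g : Env n → C} → DF n f → DF n g → DF n (λ ρ → pair (f ρ) (g ρ))
  DFpair df dg = DF⊕ (DF⊗ (DF⊕ df dg) (DF⊕ df dg)) df

  Dvd : C → C → Set
  Dvd d x = Σ C (λ q → d * q ≡ x)

  opaque
    D-Dvd : ∀ {n} {f g : Env n → C} → DF n f → DF n g → Dfn n (λ ρ → Dvd (f ρ) (g ρ))
    D-Dvd = rel2 {R = Dvd} (D∃ (D≡ (DF⊗ (DFvar _) (DFvar _)) (DFvar _)))

  -- With v divisible by all numbers up to b, the moduli 1 + (x + 1) v for x < b are pairwise coprime.
  Mem : C → C → Set
  Mem x a = Σ C (λ b → Σ C (λ u → Σ C (λ v → (a ≡ pair (pair u v) b) × (x < b × Dvd (s (s x * v)) u))))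

  opaque
    D-Mem : ∀ {n} {f g : Env n → C} → DF n f → DF n g → Dfn n (λ ρ → Mem (f ρ) (g ρ))
    D-Mem = rel2 {R = Mem} (D∃ (D∃ (D∃ (D× (D≡ (DFvar _) (DFpair (DFpair (DFvar _) (DFvar _)) (DFvar _))) (D× (D< (DFvar _) (DFvar _)) (D-Dvd (DFs (DF⊗ (DFs (DFvar _)) (DFvar _))) (DFvar _)))))))

  private
    pair-mono : ∀ {x y x' y'} → x + y < x' + y' → pair x y < pair x' y'
    pair-mono {x} {y} {x'} {y'} p =
      ≤t (≤t (le (x + y + y) e) (*mono p p)) (≤+ x')
      where
      e : s ((x + y) * (x + y) + x) + (x + y + y) ≡ s (x + y) * s (x + y)
      e = solve 2 (λ x y → ((x :+ y) :* (x :+ y) :+ x :+ con 1) :+ (x :+ y :+ y) := (x :+ y :+ con 1) :* (x :+ y :+ con 1)) refl x y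

  opaque
    -- The code lies between the squares of `x + y` and of its successor, so it determines the sum,
    -- and then `x` as the remainder.
    pair-inj : ∀ {x y x' y'} → pair x y ≡ pair x' y' → (x ≡ x') × (y ≡ y')
    pair-inj {x} {y} {x'} {y'} e with tri (x + y) (x' + y')
    ... | inj₁ p = ⊥-elim (<≢ (pair-mono p) e)
    ... | inj₂ (inj₂ p) = ⊥-elim (<≢ (pair-mono p) (sym e))
    ... | inj₂ (inj₁ p) = eqx , +cancelˡ x (trans p (cong (_+ y') (sym eqx)))
      where
      eqx : x ≡ x'
      eqx = +cancelˡ ((x + y) * (x + y)) (trans e (cong (_+ x') (cong₂ _*_ (sym p) (sym p))))

  dvd-* : ∀ {d a} b → Dvd d a → Dvd d (a * b)
  dvd-* {d} b (p , refl) = p * b , sym (*a d p b)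

  dvd-*' : ∀ {d a} b → Dvd d a → Dvd d (b * a)
  dvd-*' {d} {a} b h = subst (Dvd d) (*c a b) (dvd-* b h)

  *cancel≤ : ∀ w {x y} → z < w → w * x ≤ w * y → x ≤ y
  *cancel≤ w {x} {y} w>0 p with ≤⊎< x y
  ... | inj₁ q = q
  ... | inj₂ q = ⊥-elim (<irr (<≤t (≤t (≤t (s≤s (≡⇒≤ refl)) (≤t (≡⇒≤ (+c (w * y) o)) (+mono (≤t (≡⇒≤ o≡s0) w>0) ≤r))) (≤t (≡⇒≤ (trans (+c w (w * y)) (sym (*s w y)))) (*mono (≤r {w}) q))) p))

  dvd-∸ : ∀ {d a b} → z < d → Dvd d (a + b) → Dvd d a → Dvd d b
  dvd-∸ {d} {a} {b} d>0 (p , e) (q , refl) with un (*cancel≤ d d>0 (le b (sym e)))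
  ... | r , refl = r , +cancelˡ (d * q) (trans (sym (*d d q r)) e)

  private
    -- Coprimality in the form of Euclid's lemma, the only form in which it is used; no greatest
    -- common divisor is formed.
    Cop : C → C → Set
    Cop d c = ∀ u → Dvd d (u * c) → Dvd d u

    -- The modulus times `u` is `(y + 1) * (u * v) + u`; if it divides `u * v`, it divides the
    -- remaining summand `u`.
    cop-v : ∀ y v → Cop (s (s y * v)) v
    cop-v y v u h = dvd-∸ {a = s y * (u * v)} 0<s (subst (Dvd _) (e) (u , refl)) (dvd-*' (s y) h)
      where
      e : s (s y * v) * u ≡ s y * (u * v) + u
      e = solve 3 (λ y v u → ((y :+ con 1) :* v :+ con 1) :* u := (y :+ con 1) :* (u :* v) :+ u) refl y v u

    -- The two moduli differ by `D * v`, so a divisor of `u` times the one also divides `u * D * v`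
    -- when it is the other. Now `v` can be cancelled by `cop-v`; since `D` divides `v`, passing
    -- from `u * D` to `u * v` and cancelling again leaves `u`.
    cop-D : ∀ v x y D → Dvd D v → (x + D ≡ y ⊎ y + D ≡ x) → Cop (s (s y * v)) (s (s x * v))
    cop-D v x y D (q , e) xy u h = cop-v y v u (subst (Dvd _) e3 (dvd-* q (cop-v y v (u * D) (h2 x y xy h))))
      where
      h2 : ∀ x y → x + D ≡ y ⊎ y + D ≡ x → Dvd (s (s y * v)) (u * s (s x * v)) → Dvd (s (s y * v)) ((u * D) * v)
      h2 x _ (inj₁ refl) h = dvd-∸ {a = u * s (s x * v)} 0<s (subst (Dvd _) e1 (dvd-*' u (o , *1 _))) h
        where
        e1 : u * s (s (x + D) * v) ≡ u * s (s x * v) + (u * D) * v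
        e1 = solve 4 (λ u x D v → u :* ((x :+ D :+ con 1) :* v :+ con 1) := u :* ((x :+ con 1) :* v :+ con 1) :+ (u :* D) :* v) refl u x D v
      h2 _ y (inj₂ refl) h = dvd-∸ {a = u * s (s y * v)} 0<s (subst (Dvd _) e1 h) (dvd-*' u (o , *1 _))
        where
        e1 : u * s (s (y + D) * v) ≡ u * s (s y * v) + (u * D) * v
        e1 = solve 4 (λ u x D v → u :* ((x :+ D :+ con 1) :* v :+ con 1) := u :* ((x :+ con 1) :* v :+ con 1) :+ (u :* D) :* v) refl u y D v
      e3 : (u * D) * q ≡ u * v
      e3 = trans (*a u D _) (cong (u *_) e)

    diff : ∀ {x y} → x < y → Σ C (λ w → x + s w ≡ y)
    diff {x} p with un p
    ... | w , e = w , trans (+s x w) (trans (sym (s+ x w)) e)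

    cop-m : ∀ b v → (∀ i → z < i → i ≤ b → Dvd i v) → ∀ x y → x < b → y < b → x ≢ y → Cop (s (s y * v)) (s (s x * v))
    cop-m b v cmul x y x<b y<b x≢y with ≢⇒<> x≢y
    ... | inj₁ p with diff p
    ...   | w , e = cop-D v x y (s w) (cmul (s w) 0<s (≤t (≤t (≤+' x) (≡⇒≤ e)) (<⇒≤ y<b))) (inj₁ e)
    cop-m b v cmul x y x<b y<b x≢y | inj₂ p with diff p
    ...   | w , e = cop-D v x y (s w) (cmul (s w) 0<s (≤t (≤t (≤+' y) (≡⇒≤ e)) (<⇒≤ x<b))) (inj₂ e)

  opaque
    common-multiple : ∀ b → Σ C (λ v → z < v × ((i : C) → z < i → i ≤ b → Dvd i v))
    common-multiple = ind (λ b → Σ C (λ v → z < v × ((i : C) → z < i → i ≤ b → Dvd i v))) (D∃ (D× (D< (DFcon _) (DFvar _)) (D∀ (D→ (D< (DFcon _) (DFvar _)) (D→ (D≤ (DFvar _) (DFvar _)) (D-Dvd (DFvar _) (DFvar _)))))))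
      (o , ≤t (≡⇒≤ (sym o≡s0)) ≤r , λ i p q → ⊥-elim (x≮0 (<≤t p q)))
      (λ b (v , v>0 , h) → v * s b , <≤t v>0 (≤* (s b) 0<s) , λ i p q → step b v h i p (≤⇒<⊎≡ q))
      where
      step : ∀ b v → (∀ i → z < i → i ≤ b → Dvd i v) → ∀ i → z < i → i < s b ⊎ i ≡ s b → Dvd i (v * s b)
      step b v h i p (inj₁ q) = dvd-* (s b) (h i p (s≤s⁻ q))
      step b v h i p (inj₂ refl) = v , *c _ v

  opaque
    -- `u` is the product of the moduli that belong to the elements of the set. It is built by
    -- induction on a bound `c` for the elements: one factor is multiplied in or not, and
    -- coprimality leaves the other memberships unchanged.
    comp-raw : (b : C) (P : C → Set) → Dfn 1 (λ ρ → P (ρ zero)) →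
               Σ C (λ u → Σ C (λ v → (x : C) → x < b → (Dvd (s (s x * v)) u → P x) × (P x → Dvd (s (s x * v)) u)))
    comp-raw b P d with common-multiple b
    ... | v , v>0 , cm = proj₁ fin , v , λ x x<b → (λ h → proj₂ (proj₁ (proj₂ fin x x<b) h)) , (λ p → proj₂ (proj₂ fin x x<b) (x<b , p))
      where
      Q : C → C → Set
      Q c u = (x : C) → x < b → (Dvd (s (s x * v)) u → x < c × P x) × (x < c × P x → Dvd (s (s x * v)) u)
      fin : Σ C (λ u → Q b u)
      fin = ind (λ c → Σ C (λ u → (x : C) → x < b → (Dvd (s (s x * v)) u → x < c × P x) × (x < c × P x → Dvd (s (s x * v)) u)))
        (D∃ (D∀ (D→ (D< (DFvar _) (DFcon _)) (D× (D→ (D-Dvd (DFs (DF⊗ (DFs (DFvar _)) (DFcon _))) (DFvar _)) (D× (D< (DFvar _) (DFvar _)) (rel1 {R = P} d (DFvar _)))) (D→ (D× (D< (DFvar _) (DFvar _)) (rel1 {R = P} d (DFvar _))) (D-Dvd (DFs (DF⊗ (DFs (DFvar _)) (DFcon _))) (DFvar _)))))))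
        -- The empty set has `u` equal to 1, for every modulus exceeds 1 as `v` is positive.
        (o , λ x x<b → (λ (q , e) → ⊥-elim (no1 x q e)) , λ (h , _) → ⊥-elim (x≮0 h))
        step b
        where
        no1 : ∀ x q → s (s x * v) * q ≢ o
        no1 x q e with cases q
        ... | inj₁ refl = s≢0 (trans (sym o≡s0) (trans (sym e) (*0 _)))
        ... | inj₂ (q' , refl) = <irr (<≤t (≤t (≡⇒≤ (cong s o≡s0)) (≤t (s≤s (≤t v>0 (≤*' (s x) 0<s))) (≤* (s q') 0<s))) (≡⇒≤ e))
        step : ∀ c → Σ C (λ u → Q c u) → Σ C (λ u → Q (s c) u)
        step c (u , h) with lem (c < b × P c)
        ... | inj₂ n = u , λ x x<b → (λ k → let (p , q) = proj₁ (h x x<b) k in <t p <s , q) ,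
                          (λ (p , q) → proj₂ (h x x<b) (low x x<b p q , q))
          where
          low : ∀ x → x < b → x < s c → P x → x < c
          low x x<b p q with <s⇒ p
          ... | inj₁ r = r
          ... | inj₂ refl = ⊥-elim (n (x<b , q))
        ... | inj₁ (c<b , pc) = u * s (s c * v) , λ x x<b → to x x<b , from x x<b
          where
          to : ∀ x → x < b → Dvd (s (s x * v)) (u * s (s c * v)) → x < s c × P x
          to x x<b k with lem (x ≡ c)
          ... | inj₁ refl = <s , pc
          ... | inj₂ ne = let (p , q) = proj₁ (h x x<b) (cop-m b v cm c x c<b x<b (λ e → ne (sym e)) u k) in <t p <s , q
          from : ∀ x → x < b → x < s c × P x → Dvd (s (s x * v)) (u * s (s c * v))
          from x x<b (p , q) with <s⇒ p
          ... | inj₁ r = dvd-* _ (proj₂ (h x x<b) (r , q))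
          ... | inj₂ refl = dvd-*' u (o , *1 _)

  opaque
    comp : (b : C) (P : C → Set) → Dfn 1 (λ ρ → P (ρ zero)) →
           Σ C (λ a → (x : C) → (Mem x a → x < b × P x) × (x < b × P x → Mem x a))
    comp b P d with comp-raw b P d
    ... | u , v , h = pair (pair u v) b , λ x → to x , λ (p , q) → b , u , v , refl , p , proj₂ (h x p) q
      where
      to : ∀ x → Mem x (pair (pair u v) b) → x < b × P x
      to x (b' , u' , v' , e , p , q) with pair-inj e
      ... | e1 , refl with pair-inj e1
      ... | refl , refl = p , proj₁ (h x p) q

  opaque
    coll : (b : C) (R : C → C → Set) → Dfn 2 (λ ρ → R (ρ zero) (ρ (suc zero))) →
           (∀ x → x < b → Σ C (R x)) → Σ C (λ B → (x : C) → x < b → Σ C (λ y → y < B × R x y))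
    coll b R d h = ind (λ c → c ≤ b → Σ C (λ B → (x : C) → x < c → Σ C (λ y → y < B × R x y))) (D→ (D≤ (DFvar _) (DFcon _)) (D∃ (D∀ (D→ (D< (DFvar _) (DFvar _)) (D∃ (D× (D< (DFvar _) (DFvar _)) (rel2 {R = R} d (DFvar _) (DFvar _))))))))
      (λ _ → z , λ x p → ⊥-elim (x≮0 p)) step b ≤r
      where
      step : ∀ c → (c ≤ b → Σ C (λ B → (x : C) → x < c → Σ C (λ y → y < B × R x y))) → s c ≤ b → Σ C (λ B → (x : C) → x < s c → Σ C (λ y → y < B × R x y))
      step c ih p with ih (<⇒≤ p) | h c p
      ... | B , k | y , r = B + s y , λ x q → go x (<s⇒ q)
        where
        go : ∀ x → x < c ⊎ x ≡ c → Σ C (λ y' → y' < B + s y × R x y')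
        go x (inj₁ q) = let (y' , l , r') = k x q in y' , <≤t l (≤+ (s y)) , r'
        go x (inj₂ refl) = y , ≤+' B , r

  IsVal : C → C → C → Set
  IsVal y a x = (Mem (pair x y) a × ((w : C) → w < y → ¬ Mem (pair x w) a)) ⊎ ((y ≡ z) × ((w : C) → ¬ Mem (pair x w) a))

  opaque
    D-IsVal : ∀ {n} {f g h : Env n → C} → DF n f → DF n g → DF n h → Dfn n (λ ρ → IsVal (f ρ) (g ρ) (h ρ))
    D-IsVal = rel3 {R = IsVal} (D⊎ (D× (D-Mem (DFpair (DFvar _) (DFvar _)) (DFvar _)) (D∀ (D→ (D< (DFvar _) (DFvar _)) (D¬ (D-Mem (DFpair (DFvar _) (DFvar _)) (DFvar _)))))) (D× (D≡ (DFvar _) (DFcon _)) (D∀ (D¬ (D-Mem (DFpair (DFvar _) (DFvar _)) (DFvar _))))))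

  opaque
    val : ∀ a x → Σ C (λ y → IsVal y a x)
    val a x with lem (Σ C (λ y → Mem (pair x y) a))
    ... | inj₁ (y , p) = let (m , q , r) = lnp (λ y → Mem (pair x y) a) (D-Mem (DFpair (DFcon _) (DFvar _)) (DFcon _)) y p in m , inj₁ (q , r)
    ... | inj₂ n = z , inj₂ (refl , λ w p → n (w , p))

  dec : C → C → C
  dec a x = proj₁ (val a x)

  dec-val : ∀ a x → IsVal (dec a x) a x
  dec-val a x = proj₂ (val a x)

  opaque
    val-unique : ∀ {a x y y'} → IsVal y a x → IsVal y' a x → y ≡ y'
    val-unique {y = y} {y'} (inj₁ (p , q)) (inj₁ (p' , q')) with tri y y'
    ... | inj₁ l = ⊥-elim (q' y l p)
    ... | inj₂ (inj₁ e) = e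
    ... | inj₂ (inj₂ l) = ⊥-elim (q y' l p')
    val-unique (inj₁ (p , q)) (inj₂ (_ , n)) = ⊥-elim (n _ p)
    val-unique (inj₂ (_ , n)) (inj₁ (p , q)) = ⊥-elim (n _ p)
    val-unique (inj₂ (refl , _)) (inj₂ (refl , _)) = refl

  opaque
    DFdec : ∀ {n} {f g : Env n → C} → DF n f → DF n g → DF n (λ ρ → dec (f ρ) (g ρ))
    DFdec = fun2 {F = dec} (D-iff (λ ρ → (λ { e → subst (λ y → IsVal y _ _) (sym e) (dec-val _ _) }) , (λ p → val-unique p (dec-val _ _)))
      (D-IsVal (DFvar zero) (DFvar (suc zero)) (DFvar (suc (suc zero)))))

  opaque
    -- Choice inside M: collection bounds the witnesses, comprehension codes all pairs of the
    -- relation below the bound, and `dec` picks the least.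
    code-rel : (b : C) (R : C → C → Set) → Dfn 2 (λ ρ → R (ρ zero) (ρ (suc zero))) →
               (∀ x → x < b → Σ C (R x)) → Σ C (λ a → (x : C) → x < b → R x (dec a x))
    code-rel b R d h with coll b R d h
    ... | B , k with comp (s (pair b B)) (λ w → Σ C (λ x → Σ C (λ y → (w ≡ pair x y) × (x < b × R x y)))) (D∃ (D∃ (D× (D≡ (DFvar _) (DFpair (DFvar _) (DFvar _))) (D× (D< (DFvar _) (DFcon _)) (rel2 {R = R} d (DFvar _) (DFvar _))))))
    ... | a , c = a , λ x x<b → go x x<b (k x x<b) (dec-val a x)
      where
      pair≤ : ∀ {x y} → x < b → y < B → pair x y < s (pair b B)
      pair≤ p q = s≤s (+mono (*mono (+mono (<⇒≤ p) (<⇒≤ q)) (+mono (<⇒≤ p) (<⇒≤ q))) (<⇒≤ p))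
      go : ∀ x → x < b → Σ C (λ y → y < B × R x y) → IsVal (dec a x) a x → R x (dec a x)
      go x x<b (y , y<B , r) (inj₂ (_ , n)) = ⊥-elim (n y (proj₂ (c (pair x y)) (pair≤ x<b y<B , x , y , refl , x<b , r)))
      go x x<b _ (inj₁ (p , _)) with proj₁ (c _) p
      ... | _ , x' , y' , e , _ , r with pair-inj e
      ... | refl , e' = subst (R x) (sym e') r

  opaque
    code : (b : C) (F : C → C) → DF 1 (λ ρ → F (ρ zero)) → Σ C (λ a → (x : C) → x < b → dec a x ≡ F x)
    code b F d = code-rel b (λ x y → y ≡ F x)
      (D≡ (DFvar (suc zero)) (fun1 {F = F} (DF.graph d) (DFvar zero))) (λ x _ → F x , refl)

  -- Exponentiation and the pigeonhole principle.

  IsExp : C → C → Set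
  IsExp y a = Σ C (λ c → (dec c z ≡ o) × (((x : C) → x < a → dec c (s x) ≡ dec c x + dec c x) × (y ≡ dec c a)))

  opaque
    D-IsExp : ∀ {n} {f g : Env n → C} → DF n f → DF n g → Dfn n (λ ρ → IsExp (f ρ) (g ρ))
    D-IsExp = rel2 {R = IsExp} (D∃ (D× (D≡ (DFdec (DFvar _) (DFcon _)) (DFcon _)) (D× (D∀ (D→ (D< (DFvar _) (DFvar _)) (D≡ (DFdec (DFvar _) (DFs (DFvar _))) (DF⊕ (DFdec (DFvar _) (DFvar _)) (DFdec (DFvar _) (DFvar _)))))) (D≡ (DFvar _) (DFdec (DFvar _) (DFvar _))))))

  opaque
    exists-exp : ∀ a → Σ C (λ y → IsExp y a)
    exists-exp = ind (λ a → Σ C (λ y → IsExp y a)) (D∃ (D-IsExp (DFvar _) (DFvar _))) base step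
      where
      base : Σ C (λ y → IsExp y z)
      base with code (s z) (λ _ → o) DFo
      ... | c , h = dec c z , c , h z <s , (λ x p → ⊥-elim (x≮0 p)) , refl
      step : ∀ a → Σ C (λ y → IsExp y a) → Σ C (λ y → IsExp y (s a))
      step a (y , c , h0 , hs , e)
        with code-rel (s (s a)) (λ x w → (x ≤ a × w ≡ dec c x) ⊎ (a < x × w ≡ dec c a + dec c a)) (D⊎ (D× (D≤ (DFvar _) (DFcon _)) (D≡ (DFvar _) (DFdec (DFcon _) (DFvar _)))) (D× (D< (DFcon _) (DFvar _)) (D≡ (DFvar _) (DFcon _))))
               (λ x _ → total x (≤⊎< x a))
        where
        total : ∀ x → x ≤ a ⊎ a < x → Σ C (λ w → (x ≤ a × w ≡ dec c x) ⊎ (a < x × w ≡ dec c a + dec c a))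
        total x (inj₁ p) = dec c x , inj₁ (p , refl)
        total x (inj₂ p) = dec c a + dec c a , inj₂ (p , refl)
      ... | c' , k = dec c' (s a) , c' , trans (low z 0≤) h0 , st , refl
        where
        low : ∀ x → x ≤ a → dec c' x ≡ dec c x
        low x p with k x (s≤s (≤t p ≤s))
        ... | inj₁ (_ , q) = q
        ... | inj₂ (q , _) = ⊥-elim (<irr (<≤t q p))
        st : ∀ x → x < s a → dec c' (s x) ≡ dec c' x + dec c' x
        st x p with <s⇒ p
        ... | inj₁ q = trans (low (s x) q) (trans (hs x q) (cong₂ _+_ (sym (low x (<⇒≤ q))) (sym (low x (<⇒≤ q)))))
        ... | inj₂ refl with k (s a) <s
        ...   | inj₁ (q , _) = ⊥-elim (<irr q)
        ...   | inj₂ (_ , q) = trans q (cong₂ _+_ (sym (low a ≤r)) (sym (low a ≤r)))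

  exp2 : C → C
  exp2 a = proj₁ (exists-exp a)

  opaque
    exp-unique : ∀ {a y y'} → IsExp y a → IsExp y' a → y ≡ y'
    exp-unique {a} (c , h0 , hs , refl) (c' , h0' , hs' , refl) =
      ind (λ x → x ≤ a → dec c x ≡ dec c' x) (D→ (D≤ (DFvar _) (DFcon _)) (D≡ (DFdec (DFcon _) (DFvar _)) (DFdec (DFcon _) (DFvar _)))) (λ _ → trans h0 (sym h0'))
        (λ x ih p → trans (hs x p) (trans (cong₂ _+_ (ih (<⇒≤ p)) (ih (<⇒≤ p))) (sym (hs' x p)))) a ≤r

  opaque
    exp0 : exp2 z ≡ o
    exp0 with exists-exp z
    ... | y , c , h , _ , e = trans e h

    exps : ∀ x → exp2 (s x) ≡ exp2 x + exp2 x
    exps x with exists-exp (s x)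
    ... | y , c , h , k , e = trans e (trans (k x <s) (cong₂ _+_ q q))
      where
      q : dec c x ≡ exp2 x
      q = exp-unique (c , h , (λ w p → k w (<t p <s)) , refl) (proj₂ (exists-exp x))

  opaque
    DFexp : ∀ {n} {f : Env n → C} → DF n f → DF n (λ ρ → exp2 (f ρ))
    DFexp = fun1 {F = exp2} (D-iff (λ ρ → (λ e → subst (λ y → IsExp y _) (sym e) (proj₂ (exists-exp _))) , (λ p → exp-unique p (proj₂ (exists-exp _))))
      (D-IsExp (DFvar zero) (DFvar (suc zero))))

  opaque
    exp+ : ∀ x y → exp2 (x + y) ≡ exp2 x * exp2 y
    exp+ x = ind (λ y → exp2 (x + y) ≡ exp2 x * exp2 y) (D≡ (DFexp (DF⊕ (DFcon _) (DFvar _))) (DF⊗ (DFcon _) (DFexp (DFvar _))))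
      (trans (cong exp2 (+0 x)) (sym (trans (cong (exp2 x *_) exp0) (*1 _))))
      (λ y p → trans (cong exp2 (+s x y)) (trans (exps _) (trans (cong₂ _+_ p p) (sym (trans (cong (exp2 x *_) (exps y)) (*d _ _ _))))))

  opaque
    x<exp : ∀ x → x < exp2 x
    x<exp = ind (λ x → x < exp2 x) (D< (DFvar _) (DFexp (DFvar _))) (≤t (≡⇒≤ (sym o≡s0)) (≡⇒≤ (sym exp0)))
      (λ x p → ≤t (≤t (≡⇒≤ (cong s (sym (+0 (s x))))) (≤t (≡⇒≤ (sym (+s (s x) z))) (+mono p (≤t (s≤s 0≤) p)))) (≡⇒≤ (sym (exps x))))

  exp>0 : ∀ {x} → z < exp2 x
  exp>0 {x} = ≤<t 0≤ (x<exp x)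

  exp-mono : ∀ {x y} → x ≤ y → exp2 x ≤ exp2 y
  exp-mono {x} p with un p
  ... | w , refl = ≤t (≤* (exp2 w) exp>0) (≡⇒≤ (sym (exp+ x w)))

  private
    upd : ∀ b D v k → Σ C (λ D' → (i : C) → i < b → ((dec D i ≡ k) × (dec D' i ≡ v)) ⊎ ((dec D i ≢ k) × (dec D' i ≡ dec D i)))
    upd b D v k = code-rel b (λ i y → ((dec D i ≡ k) × (y ≡ v)) ⊎ ((dec D i ≢ k) × (y ≡ dec D i))) (D⊎ (D× (D≡ (DFdec (DFcon _) (DFvar _)) (DFcon _)) (D≡ (DFvar _) (DFcon _))) (D× (D≢ (DFdec (DFcon _) (DFvar _)) (DFcon _)) (D≡ (DFvar _) (DFdec (DFcon _) (DFvar _))))) (λ i _ → tot i (lem (dec D i ≡ k)))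
      where
      tot : ∀ i → (dec D i ≡ k) ⊎ ¬ (dec D i ≡ k) → Σ C (λ y → ((dec D i ≡ k) × (y ≡ v)) ⊎ ((dec D i ≢ k) × (y ≡ dec D i)))
      tot i (inj₁ p) = v , inj₁ (p , refl)
      tot i (inj₂ p) = dec D i , inj₂ (p , refl)

  opaque
    -- In the induction step the value `m + 1` is renamed to the last value of `D`, so that the
    -- hypothesis applies to the first `m` places. If the number it gives is the last value itself,
    -- then `m + 1` was never taken.
    missed : ∀ m D → Σ C (λ j → j ≤ m × ((i : C) → i < m → dec D i ≢ j))
    missed = ind (λ m → (D : C) → Σ C (λ j → j ≤ m × ((i : C) → i < m → dec D i ≢ j))) (D∀ (D∃ (D× (D≤ (DFvar _) (DFvar _)) (D∀ (D→ (D< (DFvar _) (DFvar _)) (D≢ (DFdec (DFvar _) (DFvar _)) (DFvar _)))))))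
      (λ D → z , ≤r , λ i p → ⊥-elim (x≮0 p)) step
      where
      step : ∀ m → ((D : C) → Σ C (λ j → j ≤ m × ((i : C) → i < m → dec D i ≢ j))) → (D : C) → Σ C (λ j → j ≤ s m × ((i : C) → i < s m → dec D i ≢ j))
      step m ih D with upd m D (dec D m) (s m)
      ... | D' , h with ih D'
      ... | j , j≤m , nj with lem (j ≡ dec D m)
      ...   | inj₂ ne = j , ≤t j≤m ≤s , λ i p → go i (<s⇒ p)
        where
        go : ∀ i → i < m ⊎ i ≡ m → dec D i ≢ j
        go i (inj₂ refl) e = ne (sym e)
        go i (inj₁ p) e with h i p
        ... | inj₁ (e1 , _) = <irr (≤t (≡⇒≤ (trans (sym e1) e)) j≤m)
        ... | inj₂ (_ , e2) = nj i p (trans e2 e)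
      ...   | inj₁ refl = s m , ≤r , λ i p → go i (<s⇒ p)
        where
        go : ∀ i → i < m ⊎ i ≡ m → dec D i ≢ s m
        go i (inj₂ refl) e = <irr (≤t (≡⇒≤ (sym e)) j≤m)
        go i (inj₁ p) e with h i p
        ... | inj₁ (_ , e2) = nj i p e2
        ... | inj₂ (ne , _) = ne e

  opaque
    -- Otherwise `k < m`, and an inverse of `D`, coded on the numbers below `k`, misses some `i` up
    -- to `k`; but its value at `dec D i` is `i`.
    php : ∀ m k D → (∀ i → i < m → dec D i < k) → (∀ i j → i < m → j < m → dec D i ≡ dec D j → i ≡ j) → m ≤ k
    php m k D lt inj with ≤⊎< m k
    ... | inj₁ p = p
    ... | inj₂ k<m with code-rel k (λ j i → ((i < m) × (dec D i ≡ j)) ⊎ (((w : C) → w < m → dec D w ≢ j) × (i ≡ z))) (D⊎ (D× (D< (DFvar _) (DFcon _)) (D≡ (DFdec (DFcon _) (DFvar _)) (DFvar _))) (D× (D∀ (D→ (D< (DFvar _) (DFcon _)) (D≢ (DFdec (DFcon _) (DFvar _)) (DFvar _)))) (D≡ (DFvar _) (DFcon _)))) (λ j _ → tot j (lem _))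
      where
      tot : ∀ j → Σ C (λ i → (i < m) × (dec D i ≡ j)) ⊎ ¬ Σ C (λ i → (i < m) × (dec D i ≡ j)) →
            Σ C (λ i → ((i < m) × (dec D i ≡ j)) ⊎ (((w : C) → w < m → dec D w ≢ j) × (i ≡ z)))
      tot j (inj₁ (i , p)) = i , inj₁ p
      tot j (inj₂ n) = z , inj₂ ((λ w p q → n (w , p , q)) , refl)
    ... | E , h with missed k E
    ... | i , i≤k , ni with h (dec D i) (lt i (≤<t i≤k k<m))
    ...   | inj₁ (p , q) = ⊥-elim (ni (dec D i) (lt i (≤<t i≤k k<m)) (inj _ _ p (≤<t i≤k k<m) q))
    ...   | inj₂ (n , _) = ⊥-elim (n i (≤<t i≤k k<m) refl)

  -- The coded tree and the rank of sets of leaves.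

  c3 : C
  c3 = s (s (s z))

  -- Leaves that agree below `k` pass through the same node of level `k`; nodes have no codes of
  -- their own.
  agree : C → C → C → Set
  agree k x y = (i : C) → i < k → dec x i ≡ dec y i

  opaque
    D-agree : ∀ {n} {f g h : Env n → C} → DF n f → DF n g → DF n h → Dfn n (λ ρ → agree (f ρ) (g ρ) (h ρ))
    D-agree = rel3 {R = agree} (D∀ (D→ (D< (DFvar _) (DFvar _)) (D≡ (DFdec (DFvar _) (DFvar _)) (DFdec (DFvar _) (DFvar _)))))

  agree-refl : ∀ {k x} → agree k x x
  agree-refl i p = refl

  agree-sym : ∀ {k x y} → agree k x y → agree k y x
  agree-sym h i p = sym (h i p)

  agree-trans : ∀ {k x y w} → agree k x y → agree k y w → agree k x w
  agree-trans h g i p = trans (h i p) (g i p)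

  agree-≤ : ∀ {k k' x y} → k ≤ k' → agree k' x y → agree k x y
  agree-≤ l h i p = h i (<≤t p l)

  agree-s : ∀ {k x y} → agree k x y → dec x k ≡ dec y k → agree (s k) x y
  agree-s h e i p with <s⇒ p
  ... | inj₁ q = h i q
  ... | inj₂ refl = e

  Leaf : C → C → C → Set
  Leaf X k x = Σ C (λ y → Mem y X × agree k x y)

  -- The ambient tree: levels below ℓ, leaves below b, the nodes of level k have type dec τ k,
  -- and nodes of type n have n + 3 children. A node is given by its level k and a leaf x below it.
  module Tree (ℓ b τ : C) where

    HasNode : (C → C → Set) → C → C → C → Set
    HasNode R k x n = Σ C (λ k' → Σ C (λ y → (y < b) × ((k ≤ k') × ((k' < ℓ) × (agree k x y × ((dec τ k' ≡ n) × ((j : C) → j < n + c3 → Σ C (λ y' → (y' < b) × (agree k' y y' × ((dec y' k' ≡ j) × R (s k') y'))))))))))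

    Good : C → C → C → C → C → C → Set
    Good Q X S r k x = Leaf X k x × ((r' : C) → r ≡ s r' → (n : C) → Mem n Q → HasNode (λ k y → Mem (pair r' (pair k y)) S) k x n)

    HasNode-map : ∀ {R R' : C → C → Set} {k x n} → (∀ k' y → R k' y → R' k' y) → HasNode R k x n → HasNode R' k x n
    HasNode-map f (k' , y , p1 , p2 , p3 , p4 , p5 , h) = k' , y , p1 , p2 , p3 , p4 , p5 ,
      λ j l → let (y' , q1 , q2 , q3 , q4) = h j l in y' , q1 , q2 , q3 , f _ _ q4

    opaque
      -- Rank at least r (for the types in Q) of the set X at a node, witnessed by a set of triples
      -- (rank, level, leaf) that is closed under unfolding.
      Rk : C → C → C → C → C → Set
      Rk Q X r k x = Σ C (λ S → ((r : C) → (k : C) → (x : C) → Mem (pair r (pair k x)) S → (Σ C (λ y → Mem y X × agree k x y)) × ((r' : C) → r ≡ s r' → (n : C) → Mem n Q → Σ C (λ k' → Σ C (λ y → (y < b) × ((k ≤ k') × ((k' < ℓ) × (agree k x y × ((dec τ k' ≡ n) × ((j : C) → j < n + c3 → Σ C (λ y' → (y' < b) × (agree k' y y' × ((dec y' k' ≡ j) × Mem (pair r' (pair (s k') y')) S)))))))))))) × Mem (pair r (pair k x)) S)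

      D-Rk : ∀ {Q n} {f g h l : Env n → C} → DF n f → DF n g → DF n h → DF n l → Dfn n (λ ρ → Rk Q (f ρ) (g ρ) (h ρ) (l ρ))
      D-Rk {Q} = rel4 {R = Rk Q} (D∃ (D× (D∀ (D∀ (D∀ (D→ (D-Mem (DFpair (DFvar _) (DFpair (DFvar _) (DFvar _))) (DFvar _)) (D× (D∃ (D× (D-Mem (DFvar _) (DFvar _)) (D-agree (DFvar _) (DFvar _) (DFvar _)))) (D∀ (D→ (D≡ (DFvar _) (DFs (DFvar _))) (D∀ (D→ (D-Mem (DFvar _) (DFcon _)) (D∃ (D∃ (D× (D< (DFvar _) (DFcon _)) (D× (D≤ (DFvar _) (DFvar _)) (D× (D< (DFvar _) (DFcon _)) (D× (D-agree (DFvar _) (DFvar _) (DFvar _)) (D× (D≡ (DFdec (DFcon _) (DFvar _)) (DFvar _)) (D∀ (D→ (D< (DFvar _) (DF⊕ (DFvar _) (DFcon _))) (D∃ (D× (D< (DFvar _) (DFcon _)) (D× (D-agree (DFvar _) (DFvar _) (DFvar _)) (D× (D≡ (DFdec (DFvar _) (DFvar _)) (DFvar _)) (D-Mem (DFpair (DFvar _) (DFpair (DFs (DFvar _)) (DFvar _))) (DFvar _)))))))))))))))))))))))) (D-Mem (DFpair (DFvar _) (DFpair (DFvar _) (DFvar _))) (DFvar _))))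

      Rk-leaf : ∀ {Q X r k x} → Rk Q X r k x → Leaf X k x
      Rk-leaf (S , c , m) = proj₁ (c _ _ _ m)

      Rk-unfold : ∀ {Q X r k x} → Rk Q X (s r) k x → ∀ n → Mem n Q → HasNode (Rk Q X r) k x n
      Rk-unfold {Q} {X} {r} (S , c , m) n q = HasNode-map {R' = Rk Q X r} (λ k' y p → S , c , p) (proj₂ (c _ _ _ m) _ refl n q)

      Rk-intro : ∀ {Q X r k x} S → ((r : C) → (k : C) → (x : C) → Mem (pair r (pair k x)) S → Good Q X S r k x) → Mem (pair r (pair k x)) S → Rk Q X r k x
      Rk-intro S c m = S , c , m

    opaque
      Rk-zero : ∀ {Q X k x} → Leaf X k x → Rk Q X z k x
      Rk-zero {Q} {X} {k} {x} l with comp (s (pair z (pair k x))) (λ w → w ≡ pair z (pair k x)) (D≡ (DFvar _) (DFcon _))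
      ... | S , h = Rk-intro S cert (proj₂ (h _) (<s , refl))
        where
        cert : (r : C) → (k : C) → (x : C) → Mem (pair r (pair k x)) S → Good Q X S r k x
        cert r k' x' m = let (e0 , e1) = pair-inj (proj₂ (proj₁ (h _) m)) ; (e3 , e4) = pair-inj e1 in
          (proj₁ l , proj₁ (proj₂ l) , subst₂ (λ a c → agree a c (proj₁ l)) (sym e3) (sym e4) (proj₂ (proj₂ l))) ,
          λ r' e → ⊥-elim (s≢0 (trans (sym e) e0))

    opaque
      -- The children come with different certificates. Instead of uniting these, the new
      -- certificate collects every triple within the bounds whose rank up to `r` is certified at
      -- all, together with the new triple. The bounds on levels and leaves are what makes this a
      -- coded set.
      Rk-fold : ∀ {Q X r k x} → x < b → k ≤ ℓ → Leaf X k x → (∀ n → Mem n Q → HasNode (Rk Q X r) k x n) → Rk Q X (s r) k x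
      Rk-fold {Q} {X} {r} {k} {x} x<b k≤ℓ l hn = Rk-intro S (λ r1 k1 x1 m → cert r1 k1 x1 (proj₂ (proj₁ (h _) m))) (proj₂ (h _) (small ≤r k≤ℓ (<⇒≤ x<b) , inj₂ refl))
        where
        Old : C → Set
        Old w = Σ C (λ r' → Σ C (λ k' → Σ C (λ x' → (w ≡ pair r' (pair k' x')) × ((r' ≤ r) × ((k' ≤ ℓ) × ((x' < b) × Rk Q X r' k' x'))))))
        cmp : Σ C (λ a → (w : C) → (Mem w a → w < s (pair (s r) (pair ℓ b)) × (Old w ⊎ (w ≡ pair (s r) (pair k x)))) × (w < s (pair (s r) (pair ℓ b)) × (Old w ⊎ (w ≡ pair (s r) (pair k x))) → Mem w a))
        cmp = comp (s (pair (s r) (pair ℓ b)))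
          (λ w → (Σ C (λ r' → Σ C (λ k' → Σ C (λ x' → (w ≡ pair r' (pair k' x')) × ((r' ≤ r) × ((k' ≤ ℓ) × ((x' < b) × Rk Q X r' k' x'))))))) ⊎ (w ≡ pair (s r) (pair k x)))
          (D⊎ (D∃ (D∃ (D∃ (D× (D≡ (DFvar _) (DFpair (DFvar _) (DFpair (DFvar _) (DFvar _)))) (D× (D≤ (DFvar _) (DFcon _)) (D× (D≤ (DFvar _) (DFcon _)) (D× (D< (DFvar _) (DFcon _)) (D-Rk (DFcon _) (DFvar _) (DFvar _) (DFvar _))))))))) (D≡ (DFvar _) (DFcon _)))
        S : C
        S = proj₁ cmp
        h : (w : C) → (Mem w S → w < s (pair (s r) (pair ℓ b)) × (Old w ⊎ (w ≡ pair (s r) (pair k x)))) × (w < s (pair (s r) (pair ℓ b)) × (Old w ⊎ (w ≡ pair (s r) (pair k x))) → Mem w S)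
        h = proj₂ cmp
        pm : ∀ {x y x' y'} → x ≤ x' → y ≤ y' → pair x y ≤ pair x' y'
        pm p q = +mono (*mono (+mono p q) (+mono p q)) p
        small : ∀ {r' k' x'} → r' ≤ s r → k' ≤ ℓ → x' ≤ b → pair r' (pair k' x') < s (pair (s r) (pair ℓ b))
        small p q t = s≤s (pm p (pm q t))
        inS : ∀ {r' k' x'} → r' ≤ r → k' ≤ ℓ → x' < b → Rk Q X r' k' x' → Mem (pair r' (pair k' x')) S
        inS p q t m = proj₂ (h _) (small (≤t p ≤s) q (<⇒≤ t) , inj₁ (_ , _ , _ , refl , p , q , t , m))
        good : ∀ r1 k1 x1 → s r1 ≤ s r → Leaf X k1 x1 → (∀ n → Mem n Q → HasNode (Rk Q X r1) k1 x1 n) → Good Q X S (s r1) k1 x1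
        good r1 k1 x1 le1 lf nd = lf , λ r2 e2 n mn →
          let (k'' , y , q1 , q2 , q3 , q4 , q5 , hh) = nd n mn in
          k'' , y , q1 , q2 , q3 , q4 , q5 , λ j lj → let (y' , u1 , u2 , u3 , u4) = hh j lj in
            y' , u1 , u2 , u3 , subst (λ w → Mem (pair w (pair (s k'') y')) S) (s-inj e2) (inS (s≤s⁻ le1) q3 u1 u4)
        old : ∀ r1 k1 x1 → r1 ≤ r → Rk Q X r1 k1 x1 → (r1 ≡ z) ⊎ Σ C (λ r2 → r1 ≡ s r2) → Good Q X S r1 k1 x1
        old r1 k1 x1 p m (inj₁ e) = Rk-leaf m , λ r2 e2 → ⊥-elim (s≢0 (trans (sym e2) e))
        old r1 k1 x1 p m (inj₂ (r2 , e)) = subst (λ w → Good Q X S w k1 x1) (sym e)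
          (good r2 k1 x1 (≤t (≡⇒≤ (sym e)) (≤t p ≤s)) (Rk-leaf m) (Rk-unfold (subst (λ w → Rk Q X w k1 x1) e m)))
        tr : ∀ {r1 k1 x1 r2 k2 x2} → pair r1 (pair k1 x1) ≡ pair r2 (pair k2 x2) → Good Q X S r2 k2 x2 → Good Q X S r1 k1 x1
        tr e g = let (e1 , e2) = pair-inj e ; (e3 , e4) = pair-inj e2 in
          subst (λ w → Good Q X S w _ _) (sym e1) (subst (λ w → Good Q X S _ w _) (sym e3) (subst (λ w → Good Q X S _ _ w) (sym e4) g))
        cert : ∀ r1 k1 x1 → Old (pair r1 (pair k1 x1)) ⊎ (pair r1 (pair k1 x1) ≡ pair (s r) (pair k x)) → Good Q X S r1 k1 x1
        cert r1 k1 x1 (inj₁ (r' , k' , x' , e , p , q , t , rk)) = tr e (old r' k' x' p rk (cases r'))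
        cert r1 k1 x1 (inj₂ e) = tr e (good r k x ≤r l hn)

    opaque
      Rk-local : ∀ {Q X Y r k x} → x < b → k ≤ ℓ → (∀ y → Mem y X → agree k x y → Mem y Y) → Rk Q X r k x → Rk Q Y r k x
      Rk-local {Q} {X} {Y} {r} {k} {x} x<b k≤ℓ sub = ind (λ r → (k : C) → (x : C) → x < b → k ≤ ℓ → ((y : C) → Mem y X → agree k x y → Mem y Y) → Rk Q X r k x → Rk Q Y r k x)
        (D∀ (D∀ (D→ (D< (DFvar _) (DFcon _)) (D→ (D≤ (DFvar _) (DFcon _)) (D→ (D∀ (D→ (D-Mem (DFvar _) (DFcon _)) (D→ (D-agree (DFvar _) (DFvar _) (DFvar _)) (D-Mem (DFvar _) (DFcon _))))) (D→ (D-Rk (DFcon _) (DFvar _) (DFvar _) (DFvar _)) (D-Rk (DFcon _) (DFvar _) (DFvar _) (DFvar _)))))))) (λ k x p q h m → Rk-zero (lf h (Rk-leaf m))) step r k x x<b k≤ℓ sub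
        where
        lf : ∀ {k x} → (∀ y → Mem y X → agree k x y → Mem y Y) → Leaf X k x → Leaf Y k x
        lf h (y , m , a) = y , h y m a , a
        step : ∀ r → ((k : C) → (x : C) → x < b → k ≤ ℓ → ((y : C) → Mem y X → agree k x y → Mem y Y) → Rk Q X r k x → Rk Q Y r k x) →
               (k : C) → (x : C) → x < b → k ≤ ℓ → ((y : C) → Mem y X → agree k x y → Mem y Y) → Rk Q X (s r) k x → Rk Q Y (s r) k x
        step r ih k x p q h m = Rk-fold p q (lf h (Rk-leaf m)) λ n mn →
          let (k' , y , q1 , q2 , q3 , q4 , q5 , hh) = Rk-unfold m n mn in
          k' , y , q1 , q2 , q3 , q4 , q5 , λ j lj → let (y' , u1 , u2 , u3 , u4) = hh j lj in
            y' , u1 , u2 , u3 , ih (s k') y' u1 q3 (λ w mw aw → h w mw (agree-trans q4 (agree-trans (agree-≤ q2 u2) (agree-≤ (≤t q2 ≤s) aw)))) u4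

    Rk-sub : ∀ {Q X Y r k x} → x < b → k ≤ ℓ → (∀ y → Mem y X → Mem y Y) → Rk Q X r k x → Rk Q Y r k x
    Rk-sub p q h = Rk-local p q (λ y m _ → h y m)

    opaque
      Rk-types : ∀ {Q Q' X r k x} → x < b → k ≤ ℓ → (∀ n → Mem n Q' → Mem n Q) → Rk Q X r k x → Rk Q' X r k x
      Rk-types {Q} {Q'} {X} {r} {k} {x} x<b k≤ℓ sub = ind (λ r → (k : C) → (x : C) → x < b → k ≤ ℓ → Rk Q X r k x → Rk Q' X r k x)
        (D∀ (D∀ (D→ (D< (DFvar _) (DFcon _)) (D→ (D≤ (DFvar _) (DFcon _)) (D→ (D-Rk (DFcon _) (DFvar _) (DFvar _) (DFvar _)) (D-Rk (DFcon _) (DFvar _) (DFvar _) (DFvar _))))))) (λ k x p q m → Rk-zero (Rk-leaf m))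
        (λ r ih k x p q m → Rk-fold p q (Rk-leaf m) λ n mn →
          let (k' , y , q1 , q2 , q3 , q4 , q5 , hh) = Rk-unfold m n (sub n mn) in
          k' , y , q1 , q2 , q3 , q4 , q5 , λ j lj → let (y' , u1 , u2 , u3 , u4) = hh j lj in
            y' , u1 , u2 , u3 , ih (s k') y' u1 q3 u4) r k x x<b k≤ℓ

    opaque
      Rk-pred : ∀ {Q X r k x} → x < b → k ≤ ℓ → Rk Q X (s r) k x → Rk Q X r k x
      Rk-pred {Q} {X} {r} {k} {x} x<b k≤ℓ = ind (λ r → (k : C) → (x : C) → x < b → k ≤ ℓ → Rk Q X (s r) k x → Rk Q X r k x)
        (D∀ (D∀ (D→ (D< (DFvar _) (DFcon _)) (D→ (D≤ (DFvar _) (DFcon _)) (D→ (D-Rk (DFcon _) (DFs (DFvar _)) (DFvar _) (DFvar _)) (D-Rk (DFcon _) (DFvar _) (DFvar _) (DFvar _))))))) (λ k x p q m → Rk-zero (Rk-leaf m))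
        (λ r ih k x p q m → Rk-fold p q (Rk-leaf m) λ n mn →
          let (k' , y , q1 , q2 , q3 , q4 , q5 , hh) = Rk-unfold m n mn in
          k' , y , q1 , q2 , q3 , q4 , q5 , λ j lj → let (y' , u1 , u2 , u3 , u4) = hh j lj in
            y' , u1 , u2 , u3 , ih (s k') y' u1 q3 u4) r k x x<b k≤ℓ

    opaque
      Rk-≤ : ∀ {Q X r r' k x} → x < b → k ≤ ℓ → r ≤ r' → Rk Q X r' k x → Rk Q X r k x
      Rk-≤ {Q} {X} {r} {r'} {k} {x} x<b k≤ℓ l with un l
      ... | w , refl = ind (λ w → Rk Q X (r + w) k x → Rk Q X r k x) (D→ (D-Rk (DFcon _) (DF⊕ (DFcon _) (DFvar _)) (DFcon _) (DFcon _)) (D-Rk (DFcon _) (DFcon _) (DFcon _) (DFcon _)))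
        (subst (λ t → Rk Q X t k x) (+0 r)) (λ w ih m → ih (Rk-pred x<b k≤ℓ (subst (λ t → Rk Q X t k x) (+s r w) m))) w

    opaque
      -- The nodes that witness a rank may lie anywhere below, so an ancestor can use those of its
      -- descendant.
      Rk-lift : ∀ {Q X r k x k' y} → x < b → k ≤ ℓ → k ≤ k' → agree k x y → Rk Q X r k' y → Rk Q X r k x
      Rk-lift {r = r} x<b k≤ℓ kk a m with Rk-leaf m
      ... | w , mw , aw with cases r
      ...   | inj₁ refl = Rk-zero (w , mw , agree-trans a (agree-≤ kk aw))
      ...   | inj₂ (r' , refl) = Rk-fold x<b k≤ℓ (w , mw , agree-trans a (agree-≤ kk aw)) λ n mn →
                let (k'' , v , q1 , q2 , q3 , q4 , q5 , hh) = Rk-unfold m n mn in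
                k'' , v , q1 , ≤t kk q2 , q3 , agree-trans a (agree-≤ kk q4) , q5 , hh

    -- The partition lemma: rank is subadditive.
    opaque
      split : ∀ {Q X Y Z r₁ r₂ k x} → x < b → k ≤ ℓ → (∀ y → Mem y X → Mem y Y ⊎ Mem y Z) →
              Rk Q X (r₁ + r₂) k x → Rk Q Y r₁ k x ⊎ Rk Q Z r₂ k x
      split {Q} {X} {Y} {Z} {r₁} {r₂} {k} {x} x<b k≤ℓ cov m with lem (Rk Q Y r₁ k x)
      ... | inj₁ p = inj₁ p
      ... | inj₂ np = inj₂ (ind (λ r₁ → (k : C) → (x : C) → x < b → k ≤ ℓ → Rk Q X (r₁ + r₂) k x → ¬ Rk Q Y r₁ k x → Rk Q Z r₂ k x)
          (D∀ (D∀ (D→ (D< (DFvar _) (DFcon _)) (D→ (D≤ (DFvar _) (DFcon _)) (D→ (D-Rk (DFcon _) (DF⊕ (DFvar _) (DFcon _)) (DFvar _) (DFvar _)) (D→ (D¬ (D-Rk (DFcon _) (DFvar _) (DFvar _) (DFvar _))) (D-Rk (DFcon _) (DFcon _) (DFvar _) (DFvar _)))))))) (λ k x p q m n → noleaf k x p q z m (λ l → n (Rk-zero l))) step r₁ k x x<b k≤ℓ m np)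
        where
        noleaf : ∀ k x → x < b → k ≤ ℓ → ∀ r → Rk Q X (r + r₂) k x → ¬ Leaf Y k x → Rk Q Z r₂ k x
        noleaf k x p q r m n = Rk-≤ p q (≤+' r) (Rk-local p q loc m)
          where
          loc : ∀ y → Mem y X → agree k x y → Mem y Z
          loc y my a with cov y my
          ... | inj₁ h = ⊥-elim (n (y , h , a))
          ... | inj₂ h = h
        step : ∀ r₁ → ((k : C) → (x : C) → x < b → k ≤ ℓ → Rk Q X (r₁ + r₂) k x → ¬ Rk Q Y r₁ k x → Rk Q Z r₂ k x) →
               (k : C) → (x : C) → x < b → k ≤ ℓ → Rk Q X (s r₁ + r₂) k x → ¬ Rk Q Y (s r₁) k x → Rk Q Z r₂ k x
        step r₁ ih k x p q m ny with lem (Leaf Y k x)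
        ... | inj₂ n = noleaf k x p q (s r₁) m n
        -- If `Z` failed to have rank `r₂` here, it would fail at every child as well, since ranks
        -- go up to ancestors. By induction `Y` then has rank `r₁` at every child of the nodes that
        -- witness the rank of `X`, hence rank `r₁ + 1` here.
        ... | inj₁ l = dne λ nz → ny (Rk-fold p q l λ n mn →
                let (k' , y , q1 , q2 , q3 , q4 , q5 , hh) = Rk-unfold (subst (λ t → Rk Q X t k x) (s+ r₁ r₂) m) n mn in
                k' , y , q1 , q2 , q3 , q4 , q5 , λ j lj → let (y' , u1 , u2 , u3 , u4) = hh j lj in
                  y' , u1 , u2 , u3 , dne λ nr → nz (Rk-lift p q (≤t q2 ≤s) (agree-trans q4 (agree-≤ q2 u2)) (ih (s k') y' u1 q3 u4 nr)))

  -- Cutting down sets of large rank.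

  Mem-bound : ∀ {y X} → Mem y X → y < X
  Mem-bound {y} {X} (c , u , v , refl , p , _) = <≤t p (≤t (≤+' (pair u v)) (≤t (sq (pair u v + c)) (≤+ (pair u v))))
    where
    sq : ∀ w → w ≤ w * w
    sq w with cases w
    ... | inj₁ refl = 0≤
    ... | inj₂ (w' , refl) = ≤* (s w') 0<s

  _⊆_ : C → C → Set
  X ⊆ Y = (y : C) → Mem y X → Mem y Y

  opaque
    filt : (X : C) (P : C → Set) → Dfn 1 (λ ρ → P (ρ zero)) → Σ C (λ Y → (y : C) → (Mem y Y → Mem y X × P y) × (Mem y X × P y → Mem y Y))
    filt X P d with comp X (λ y → Mem y X × P y) (D× (D-Mem (DFvar _) (DFcon _)) (rel1 {R = P} d (DFvar _)))
    ... | Y , h = Y , λ y → (λ m → proj₂ (proj₁ (h y) m)) , (λ p → proj₂ (h y) (Mem-bound (proj₁ p) , p))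

  Tri : C → C → C → Set
  Tri f V W = ((x : C) → (y : C) → Mem x V → Mem y W → dec f x < dec f y)
            ⊎ (((x : C) → (y : C) → Mem x V → Mem y W → dec f y < dec f x)
            ⊎ ((x : C) → (y : C) → Mem x V → Mem y W → dec f x ≡ dec f y))

  opaque
    D-⊆ : ∀ {n} {f g : Env n → C} → DF n f → DF n g → Dfn n (λ ρ → f ρ ⊆ g ρ)
    D-⊆ = rel2 {R = _⊆_} (D∀ (D→ (D-Mem (DFvar _) (DFvar _)) (D-Mem (DFvar _) (DFvar _))))

  opaque
    D-Tri : ∀ {n} {f g h : Env n → C} → DF n f → DF n g → DF n h → Dfn n (λ ρ → Tri (f ρ) (g ρ) (h ρ))
    D-Tri = rel3 {R = Tri} (D⊎ (D∀ (D∀ (D→ (D-Mem (DFvar _) (DFvar _)) (D→ (D-Mem (DFvar _) (DFvar _)) (D< (DFdec (DFvar _) (DFvar _)) (DFdec (DFvar _) (DFvar _))))))) (D⊎ (D∀ (D∀ (D→ (D-Mem (DFvar _) (DFvar _)) (D→ (D-Mem (DFvar _) (DFvar _)) (D< (DFdec (DFvar _) (DFvar _)) (DFdec (DFvar _) (DFvar _))))))) (D∀ (D∀ (D→ (D-Mem (DFvar _) (DFvar _)) (D→ (D-Mem (DFvar _) (DFvar _)) (D≡ (DFdec (DFvar _) (DFvar _)) (DFdec (DFvar _) (DFvar _)))))))))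

  Tri-sub : ∀ {f V W V' W'} → V' ⊆ V → W' ⊆ W → Tri f V W → Tri f V' W'
  Tri-sub p q (inj₁ h) = inj₁ (λ x y a c → h x y (p x a) (q y c))
  Tri-sub p q (inj₂ (inj₁ h)) = inj₂ (inj₁ (λ x y a c → h x y (p x a) (q y c)))
  Tri-sub p q (inj₂ (inj₂ h)) = inj₂ (inj₂ (λ x y a c → h x y (p x a) (q y c)))

  Tri-sym : ∀ {f V W} → Tri f V W → Tri f W V
  Tri-sym (inj₁ h) = inj₂ (inj₁ (λ x y a c → h y x c a))
  Tri-sym (inj₂ (inj₁ h)) = inj₁ (λ x y a c → h y x c a)
  Tri-sym (inj₂ (inj₂ h)) = inj₂ (inj₂ (λ x y a c → sym (h y x c a)))

  module Ramsey (ℓ b τ : C) where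
    open Tree ℓ b τ public

    Const : C → C → C → Set
    Const f Y a = (y : C) → Mem y Y → dec f y ≡ a

    Piece : C → C → (C → Set) → C → C → C → Set
    Piece Q X P r k x = Σ C (λ Y → (Y ⊆ X × (∀ y → Mem y Y → P y)) × Rk Q Y r k x)

    splitP : ∀ {Q X r₁ r₂ k x} (P : C → Set) → Dfn 1 (λ ρ → P (ρ zero)) → x < b → k ≤ ℓ → Rk Q X (r₁ + r₂) k x →
             Piece Q X P r₁ k x ⊎ Piece Q X (λ y → ¬ P y) r₂ k x
    splitP {Q} {X} {r₁} {r₂} {k} {x} P d x<b k≤ℓ m = fin (split x<b k≤ℓ cov m)
      where
      Y = filt X P d
      Z = filt X (λ y → ¬ P y) (D¬ d)
      cov : ∀ y → Mem y X → Mem y (proj₁ Y) ⊎ Mem y (proj₁ Z)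
      cov y my with lem (P y)
      ... | inj₁ p = inj₁ (proj₂ (proj₂ Y y) (my , p))
      ... | inj₂ p = inj₂ (proj₂ (proj₂ Z y) (my , p))
      fin : Rk Q (proj₁ Y) r₁ k x ⊎ Rk Q (proj₁ Z) r₂ k x → Piece Q X P r₁ k x ⊎ Piece Q X (λ y → ¬ P y) r₂ k x
      fin (inj₁ h) = inj₁ (proj₁ Y , ((λ y my → proj₁ (proj₁ (proj₂ Y y) my)) , (λ y my → proj₂ (proj₁ (proj₂ Y y) my))) , h)
      fin (inj₂ h) = inj₂ (proj₁ Z , ((λ y my → proj₁ (proj₁ (proj₂ Z y) my)) , (λ y my → proj₂ (proj₁ (proj₂ Z y) my))) , h)

    Monochrome : C → C → C → C → C → C → Set
    Monochrome Q X f r k x = Σ C (λ a → Σ C (λ Y → (Y ⊆ X × Const f Y a) × Rk Q Y r k x))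

    opaque
      -- Values are split off from the top one at a time, and by subadditivity each of them costs
      -- `r`.
      few-values : ∀ {Q r k x f} → x < b → k ≤ ℓ → ∀ c X → Rk Q X (r * c) k x → (∀ y → Mem y X → dec f y < c) → Monochrome Q X f r k x
      few-values {Q} {r} {k} {x} {f} x<b k≤ℓ = ind (λ c → (X : C) → Rk Q X (r * c) k x → ((y : C) → Mem y X → dec f y < c) →
          Σ C (λ a → Σ C (λ Y → (Y ⊆ X × ((y : C) → Mem y Y → dec f y ≡ a)) × Rk Q Y r k x))) (D∀ (D→ (D-Rk (DFvar _) (DF⊗ (DFcon _) (DFvar _)) (DFcon _) (DFcon _)) (D→ (D∀ (D→ (D-Mem (DFvar _) (DFvar _)) (D< (DFdec (DFcon _) (DFvar _)) (DFvar _)))) (D∃ (D∃ (D× (D× (D-⊆ (DFvar _) (DFvar _)) (D∀ (D→ (D-Mem (DFvar _) (DFvar _)) (D≡ (DFdec (DFcon _) (DFvar _)) (DFvar _))))) (D-Rk (DFvar _) (DFcon _) (DFcon _) (DFcon _)))))))) base step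
        where
        base : ∀ X → Rk Q X (r * z) k x → (∀ y → Mem y X → dec f y < z) → Monochrome Q X f r k x
        base X m h = let (y , my , _) = Rk-leaf m in ⊥-elim (x≮0 (h y my))
        step : ∀ c → (∀ X → Rk Q X (r * c) k x → (∀ y → Mem y X → dec f y < c) → Monochrome Q X f r k x) →
               ∀ X → Rk Q X (r * s c) k x → (∀ y → Mem y X → dec f y < s c) → Monochrome Q X f r k x
        step c ih X m h = go (splitP {r₁ = r * c} {r₂ = r} (λ y → dec f y < c) (D< (DFdec (DFcon _) (DFvar _)) (DFcon _)) x<b k≤ℓ (subst (λ t → Rk Q X t k x) (*s r c) m))
          where
          go : Piece Q X (λ y → dec f y < c) (r * c) k x ⊎ Piece Q X (λ y → ¬ (dec f y < c)) r k x → Monochrome Q X f r k x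
          go (inj₁ (Y , (sub , lt) , mY)) = let (a , Z , (sub' , cst) , mZ) = ih Y mY lt in a , Z , ((λ y q → sub y (sub' y q)) , cst) , mZ
          go (inj₂ (Y , (sub , nlt) , mY)) = c , Y , (sub , λ y q → fin y q (<s⇒ (h y (sub y q)))) , mY
            where
            fin : ∀ y → Mem y Y → dec f y < c ⊎ dec f y ≡ c → dec f y ≡ c
            fin y q (inj₁ l) = ⊥-elim (nlt y q l)
            fin y q (inj₂ e) = e

    Decided : C → C → C → Set
    Decided g Y a = ((y : C) → Mem y Y → Mem (pair a y) g) ⊎ ((y : C) → Mem y Y → ¬ Mem (pair a y) g)

    opaque
      -- Each decision halves the rank.
      decide-many : ∀ {Q r k x g} → x < b → k ≤ ℓ → ∀ c X → Rk Q X (r * exp2 c) k x →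
                    Σ C (λ Y → (Y ⊆ X × ((a : C) → a < c → Decided g Y a)) × Rk Q Y r k x)
      decide-many {Q} {r} {k} {x} {g} x<b k≤ℓ = ind (λ c → (X : C) → Rk Q X (r * exp2 c) k x →
          Σ C (λ Y → (Y ⊆ X × ((a : C) → a < c → ((y : C) → Mem y Y → Mem (pair a y) g) ⊎ ((y : C) → Mem y Y → ¬ Mem (pair a y) g))) × Rk Q Y r k x)) (D∀ (D→ (D-Rk (DFvar _) (DF⊗ (DFcon _) (DFexp (DFvar _))) (DFcon _) (DFcon _)) (D∃ (D× (D× (D-⊆ (DFvar _) (DFvar _)) (D∀ (D→ (D< (DFvar _) (DFvar _)) (D⊎ (D∀ (D→ (D-Mem (DFvar _) (DFvar _)) (D-Mem (DFpair (DFvar _) (DFvar _)) (DFcon _)))) (D∀ (D→ (D-Mem (DFvar _) (DFvar _)) (D¬ (D-Mem (DFpair (DFvar _) (DFvar _)) (DFcon _))))))))) (D-Rk (DFvar _) (DFcon _) (DFcon _) (DFcon _))))))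
          (λ X m → X , ((λ y q → q) , λ a l → ⊥-elim (x≮0 l)) , subst (λ t → Rk Q X t k x) (trans (cong (r *_) exp0) (*1 r)) m) step
        where
        T : C → C → Set
        T c X = Σ C (λ Y → (Y ⊆ X × ((a : C) → a < c → Decided g Y a)) × Rk Q Y r k x)
        step : ∀ c → (∀ X → Rk Q X (r * exp2 c) k x → T c X) → ∀ X → Rk Q X (r * exp2 (s c)) k x → T (s c) X
        step c ih X m = go (splitP {r₁ = r * exp2 c} {r₂ = r * exp2 c} (λ y → Mem (pair c y) g) (D-Mem (DFpair (DFcon _) (DFvar _)) (DFcon _)) x<b k≤ℓ
                         (subst (λ t → Rk Q X t k x) (trans (cong (r *_) (exps c)) (*d _ _ _)) m))
          where
          ext : ∀ Y → Y ⊆ X → Decided g Y c → T c Y → T (s c) X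
          ext Y sub dc (Z , (sub' , dz) , mZ) = Z , ((λ y q → sub y (sub' y q)) , λ a l → fin a (<s⇒ l)) , mZ
            where
            here : Decided g Y c → Decided g Z c
            here (inj₁ h) = inj₁ (λ y q → h y (sub' y q))
            here (inj₂ h) = inj₂ (λ y q → h y (sub' y q))
            fin : ∀ a → a < c ⊎ a ≡ c → Decided g Z a
            fin a (inj₁ l) = dz a l
            fin a (inj₂ refl) = here dc
          go : Piece Q X (λ y → Mem (pair c y) g) (r * exp2 c) k x ⊎ Piece Q X (λ y → ¬ Mem (pair c y) g) (r * exp2 c) k x → T (s c) X
          go (inj₁ (Y , (sub , p) , mY)) = ext Y sub (inj₁ p) (ih Y mY)
          go (inj₂ (Y , (sub , p) , mY)) = ext Y sub (inj₂ p) (ih Y mY)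

    const-or-large : ∀ {Q r k x f c X} → x < b → k ≤ ℓ → Rk Q X (r * c + r) k x →
                     Monochrome Q X f r k x ⊎ Piece Q X (λ y → c ≤ dec f y) r k x
    const-or-large {Q} {r} {k} {x} {f} {c} {X} x<b k≤ℓ m = go (splitP {r₁ = r * c} {r₂ = r} (λ y → dec f y < c) (D< (DFdec (DFcon _) (DFvar _)) (DFcon _)) x<b k≤ℓ m)
      where
      go : Piece Q X (λ y → dec f y < c) (r * c) k x ⊎ Piece Q X (λ y → ¬ (dec f y < c)) r k x → Monochrome Q X f r k x ⊎ Piece Q X (λ y → c ≤ dec f y) r k x
      go (inj₁ (Y , (sub , lt) , mY)) = let (a , Z , (sub' , cst) , mZ) = few-values x<b k≤ℓ c Y mY lt in
        inj₁ (a , Z , ((λ y q → sub y (sub' y q)) , cst) , mZ)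
      go (inj₂ (Y , (sub , nlt) , mY)) = inj₂ (Y , (sub , λ y q → ≮⇒≥ (nlt y q)) , mY)

    module _ {Q r f : C} where
      Low : C → C → C → C → Set
      Low W k x a = Σ C (λ Y → (Y ⊆ W × ((y : C) → Mem y Y → dec f y ≤ a)) × Rk Q Y (r + r) k x)

      Separated : C → C → C → C → C → C → Set
      Separated V kᵥ xᵥ W kᵤ xᵤ = Σ C (λ V' → Σ C (λ W' → (V' ⊆ V × W' ⊆ W) × ((Rk Q V' r kᵥ xᵥ × Rk Q W' r kᵤ xᵤ) × Tri f V' W')))

      -- `a` is the least bound under which one of the two sides, here `V`, has a piece of rank
      -- `r + r`. So the part of `W` with values below `a` does not have this rank, and the rest of
      -- `W` does. Cutting both pieces once more at `a` leaves values below `a` or equal to `a` in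
      -- `V`, and equal to `a` or above in `W`; all four combinations are comparable.
      core : ∀ {V k x W k' x' a} → x < b → k ≤ ℓ → x' < b → k' ≤ ℓ → Low V k x a → (∀ w → w < a → ¬ Low W k' x' w) →
             Rk Q W ((r + r) + (r + r)) k' x' → Separated V k x W k' x'
      core {V} {k} {x} {W} {k'} {x'} {a} p q p' q' (Y , (sY , lY) , mY) none mW = step1 (splitP {r₁ = r + r} {r₂ = r + r} (λ y → dec f y < a) (D< (DFdec (DFcon _) (DFvar _)) (DFcon _)) p' q' mW)
        where
        below : ∀ Z → (Z ⊆ W × (∀ y → Mem y Z → dec f y < a)) → Rk Q Z (r + r) k' x' → ⊥
        below Z (sZ , lZ) mZ with cases a
        ... | inj₁ refl = let (y , my , _) = Rk-leaf mZ in x≮0 (lZ y my)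
        ... | inj₂ (a' , refl) = none a' <s (Z , (sZ , λ y my → s≤s⁻ (lZ y my)) , mZ)
        comb : ∀ V' W' → V' ⊆ V → W' ⊆ W → Rk Q V' r k x → Rk Q W' r k' x' →
               ((∀ y → Mem y V' → dec f y < a) ⊎ (∀ y → Mem y V' → dec f y ≡ a)) →
               ((∀ y → Mem y W' → a < dec f y) ⊎ (∀ y → Mem y W' → dec f y ≡ a)) → Separated V k x W k' x'
        comb V' W' sV sW mV' mW' (inj₁ h) (inj₁ g) = V' , W' , (sV , sW) , (mV' , mW') , inj₁ (λ y w my mw → <t (h y my) (g w mw))
        comb V' W' sV sW mV' mW' (inj₁ h) (inj₂ g) = V' , W' , (sV , sW) , (mV' , mW') , inj₁ (λ y w my mw → <≤t (h y my) (≡⇒≤ (sym (g w mw))))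
        comb V' W' sV sW mV' mW' (inj₂ h) (inj₁ g) = V' , W' , (sV , sW) , (mV' , mW') , inj₁ (λ y w my mw → ≤<t (≡⇒≤ (h y my)) (g w mw))
        comb V' W' sV sW mV' mW' (inj₂ h) (inj₂ g) = V' , W' , (sV , sW) , (mV' , mW') , inj₂ (inj₂ (λ y w my mw → trans (h y my) (sym (g w mw))))
        step3 : ∀ Z → Z ⊆ W → (∀ y → Mem y Z → a ≤ dec f y) →
                Piece Q Y (λ y → dec f y < a) r k x ⊎ Piece Q Y (λ y → ¬ (dec f y < a)) r k x →
                Piece Q Z (λ y → a < dec f y) r k' x' ⊎ Piece Q Z (λ y → ¬ (a < dec f y)) r k' x' →
                Separated V k x W k' x'
        step3 Z sZ gZ vv ww = comb (proj₁ v1) (proj₁ w1) (proj₁ (proj₂ v1)) (proj₁ (proj₂ w1)) (proj₁ (proj₂ (proj₂ v1))) (proj₁ (proj₂ (proj₂ w1))) (proj₂ (proj₂ (proj₂ v1))) (proj₂ (proj₂ (proj₂ w1)))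
          where
          cv : Piece Q Y (λ y → dec f y < a) r k x ⊎ Piece Q Y (λ y → ¬ (dec f y < a)) r k x → Σ C (λ V' → V' ⊆ V × (Rk Q V' r k x × ((∀ y → Mem y V' → dec f y < a) ⊎ (∀ y → Mem y V' → dec f y ≡ a))))
          cv (inj₁ (V' , (s1 , h) , m1)) = V' , (λ y q → sY y (s1 y q)) , m1 , inj₁ h
          cv (inj₂ (V' , (s1 , h) , m1)) = V' , (λ y q → sY y (s1 y q)) , m1 , inj₂ (λ y q → ≤a (lY y (s1 y q)) (≮⇒≥ (h y q)))
          cw : Piece Q Z (λ y → a < dec f y) r k' x' ⊎ Piece Q Z (λ y → ¬ (a < dec f y)) r k' x' → Σ C (λ W' → W' ⊆ W × (Rk Q W' r k' x' × ((∀ y → Mem y W' → a < dec f y) ⊎ (∀ y → Mem y W' → dec f y ≡ a))))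
          cw (inj₁ (V' , (s1 , h) , m1)) = V' , (λ y q → sZ y (s1 y q)) , m1 , inj₁ h
          cw (inj₂ (V' , (s1 , h) , m1)) = V' , (λ y q → sZ y (s1 y q)) , m1 , inj₂ (λ y q → ≤a (≮⇒≥ (h y q)) (gZ y (s1 y q)))
          v1 = cv vv
          w1 = cw ww
        step1 : Piece Q W (λ y → dec f y < a) (r + r) k' x' ⊎ Piece Q W (λ y → ¬ (dec f y < a)) (r + r) k' x' → Separated V k x W k' x'
        step1 (inj₁ (Z , h , mZ)) = ⊥-elim (below Z h mZ)
        step1 (inj₂ (Z , (sZ , gZ) , mZ)) = step3 Z sZ (λ y q → ≮⇒≥ (gZ y q))
          (splitP (λ y → dec f y < a) (D< (DFdec (DFcon _) (DFvar _)) (DFcon _)) p q mY) (splitP (λ y → a < dec f y) (D< (DFcon _) (DFdec (DFcon _) (DFvar _))) p' q' mZ)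

      separate : ∀ {V k x W k' x'} → x < b → k ≤ ℓ → x' < b → k' ≤ ℓ → Rk Q V ((r + r) + (r + r)) k x → Rk Q W ((r + r) + (r + r)) k' x' →
                 Separated V k x W k' x'
      separate {V} {k} {x} {W} {k'} {x'} p q p' q' mV mW = fin least
        where
        bd : Σ C (λ B → (y : C) → y < V → Σ C (λ w → w < B × (w ≡ dec f y)))
        bd = coll V (λ y w → w ≡ dec f y) (D≡ (DFvar _) (DFdec (DFcon _) (DFvar _))) (λ y _ → dec f y , refl)
        start : Low V k x (proj₁ bd) ⊎ Low W k' x' (proj₁ bd)
        start = inj₁ (V , ((λ y m → m) , λ y m → let (w , l , e) = proj₂ bd y (Mem-bound m) in <⇒≤ (≤t (≡⇒≤ (cong s (sym e))) l)) , Rk-≤ p q (≤+ (r + r)) mV)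
        least : Σ C (λ a → (Low V k x a ⊎ Low W k' x' a) × (∀ w → w < a → ¬ (Low V k x w ⊎ Low W k' x' w)))
        least = lnp (λ a → Σ C (λ Y → (Y ⊆ V × ((y : C) → Mem y Y → dec f y ≤ a)) × Rk Q Y (r + r) k x) ⊎ Σ C (λ Y → (Y ⊆ W × ((y : C) → Mem y Y → dec f y ≤ a)) × Rk Q Y (r + r) k' x'))
          (D⊎ (D∃ (D× (D× (D-⊆ (DFvar _) (DFcon _)) (D∀ (D→ (D-Mem (DFvar _) (DFvar _)) (D≤ (DFdec (DFcon _) (DFvar _)) (DFvar _))))) (D-Rk (DFvar _) (DFcon _) (DFcon _) (DFcon _)))) (D∃ (D× (D× (D-⊆ (DFvar _) (DFcon _)) (D∀ (D→ (D-Mem (DFvar _) (DFvar _)) (D≤ (DFdec (DFcon _) (DFvar _)) (DFvar _))))) (D-Rk (DFvar _) (DFcon _) (DFcon _) (DFcon _))))) (proj₁ bd) start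
        fin : Σ C (λ a → (Low V k x a ⊎ Low W k' x' a) × (∀ w → w < a → ¬ (Low V k x w ⊎ Low W k' x' w))) → Separated V k x W k' x'
        fin (a , inj₁ h , none) = core p q p' q' h (λ w l g → none w l (inj₂ g)) mW
        fin (a , inj₂ h , none) = let (W' , V' , (sW , sV) , (mW' , mV') , t) = core p' q' p q h (λ w l g → none w l (inj₁ g)) mV in
          V' , W' , (sV , sW) , (mV' , mW') , Tri-sym t

  -- Alignment: subtrees with full branching whose sibling cones are in a given relation.

  div-unique : ∀ {m i j i' j'} → j < m → j' < m → m * i + j ≡ m * i' + j' → (i ≡ i') × (j ≡ j')
  div-unique {m} {i} {j} {i'} {j'} p p' e = fin (tri i i')
    where
    lt : ∀ {i i' j j'} → j < m → i < i' → m * i + j < m * i' + j'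
    lt {i} {i'} {j} {j'} p q = ≤t (≤t (≡⇒≤ (sym (+s (m * i) j))) (+mono ≤r p)) (≤t (≡⇒≤ (sym (*s m i))) (≤t (*mono ≤r q) (≤+ j')))
    fin : i < i' ⊎ (i ≡ i' ⊎ i' < i) → (i ≡ i') × (j ≡ j')
    fin (inj₁ q) = ⊥-elim (<≢ (lt p q) e)
    fin (inj₂ (inj₂ q)) = ⊥-elim (<≢ (lt p' q) (sym e))
    fin (inj₂ (inj₁ refl)) = refl , +cancelˡ (m * i) e

  -- `Al` is a symmetric relation between sets that passes to subsets, and `exp2 eS` is the factor
  -- of rank that it costs to bring two sets into this relation while the ranks stay at least `r0`.
  -- It will be disjointness of the values of one function, and comparability of the values of each
  -- of many functions.
  module Align (ℓ b τ : C) (Q K r0 eS : C) (Al : C → C → Set) (dAl : Dfn 2 (λ ρ → Al (ρ zero) (ρ (suc zero))))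
    (Al-sub : ∀ {V W V' W'} → V' ⊆ V → W' ⊆ W → Al V W → Al V' W') (Al-sym : ∀ {V W} → Al V W → Al W V)
    (sep : ∀ R → r0 ≤ R → ∀ V k x W k' x' → x < b → k ≤ ℓ → x' < b → k' ≤ ℓ → Ramsey.Rk ℓ b τ Q V (exp2 eS * R) k x → Ramsey.Rk ℓ b τ Q W (exp2 eS * R) k' x' →
           Σ C (λ V' → Σ C (λ W' → (V' ⊆ V × W' ⊆ W) × ((Ramsey.Rk ℓ b τ Q V' R k x × Ramsey.Rk ℓ b τ Q W' R k' x') × Al V' W'))))
    (r0>0 : z < r0) (Q<K : ∀ n → Mem n Q → n < K) where
    open Ramsey ℓ b τ

    module Family (m κ W Yn R : C) (r0≤R : r0 ≤ R) (κ<ℓ : κ < ℓ) (Yn<b : ∀ j → j < m → dec Yn j < b) where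
      Fam : C → C → Set
      Fam q W' = (j : C) → j < m → (dec W' j ⊆ dec W j) × Rk Q (dec W' j) (exp2 (eS * q) * R) (s κ) (dec Yn j)

      Pairs : C → C → Set
      Pairs p W' = (i : C) → (j : C) → i < m → j < m → i ≢ j → m * i + j < p → Al (dec W' i) (dec W' j)

      expstep : ∀ q → exp2 (eS * s q) * R ≡ exp2 eS * (exp2 (eS * q) * R)
      expstep q = trans (cong (_* R) (trans (cong exp2 (*s eS q)) (exp+ (eS * q) eS))) (trans (cong (_* R) (*c _ _)) (*a _ _ _))

      R≤ : ∀ q → R ≤ exp2 (eS * q) * R
      R≤ q = ≤*' (exp2 (eS * q)) exp>0

      step : ∀ p q W₀ → s p + q ≡ m * m → Fam (s q) W₀ → Pairs p W₀ → Σ C (λ W' → Fam q W' × Pairs (s p) W')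
      step p q W₀ e fam prs = go (divmod m m>0 p)
        where
        p<mm : p < m * m
        p<mm = ≤t (≤+ q) (≡⇒≤ e)
        m>0 : z < m
        m>0 = ≢0⇒0< λ { refl → x≮0 (<≤t p<mm (≡⇒≤ (*0 z))) }
        R' = exp2 (eS * q) * R
        fam' : ∀ j → j < m → Rk Q (dec W₀ j) (exp2 eS * R') (s κ) (dec Yn j)
        fam' j l = subst (λ t → Rk Q (dec W₀ j) t (s κ) (dec Yn j)) (expstep q) (proj₂ (fam j l))
        fam'' : ∀ j → j < m → Rk Q (dec W₀ j) R' (s κ) (dec Yn j)
        fam'' j l = Rk-≤ (Yn<b j l) κ<ℓ (≤*' (exp2 eS) exp>0) (fam' j l)
        go : Σ C (λ i0 → Σ C (λ j0 → (p ≡ m * i0 + j0) × j0 < m)) → Σ C (λ W' → Fam q W' × Pairs (s p) W')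
        go (i0 , j0 , pe , j0<m) = cs (lem (i0 ≡ j0))
          where
          i0<m : i0 < m
          i0<m = *cancel< m (≤<t (≤t (≡⇒≤ (*c i0 m)) (≤t (≤+ j0) (≡⇒≤ (sym pe)))) p<mm)
          same? : ∀ i j → i < m → j < m → m * i + j < s p → m * i + j < p ⊎ ((i ≡ i0) × (j ≡ j0))
          same? i j li lj l with <s⇒ l
          ... | inj₁ h = inj₁ h
          ... | inj₂ h = inj₂ (div-unique lj j0<m (trans h pe))
          cs : (i0 ≡ j0) ⊎ ¬ (i0 ≡ j0) → Σ C (λ W' → Fam q W' × Pairs (s p) W')
          cs (inj₁ eq) = W₀ , (λ j l → proj₁ (fam j l) , fam'' j l) , λ i j li lj ne l → fin i j li lj ne (same? i j li lj l)
            where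
            fin : ∀ i j → i < m → j < m → i ≢ j → m * i + j < p ⊎ ((i ≡ i0) × (j ≡ j0)) → Al (dec W₀ i) (dec W₀ j)
            fin i j li lj ne (inj₁ h) = prs i j li lj ne h
            fin i j li lj ne (inj₂ (e1 , e2)) = ⊥-elim (ne (trans e1 (trans eq (sym e2))))
          cs (inj₂ neq) = build (sep R' (≤t r0≤R (R≤ q)) (dec W₀ i0) (s κ) (dec Yn i0) (dec W₀ j0) (s κ) (dec Yn j0) (Yn<b i0 i0<m) κ<ℓ (Yn<b j0 j0<m) κ<ℓ (fam' i0 i0<m) (fam' j0 j0<m))
            where
            build : Σ C (λ V' → Σ C (λ W' → (V' ⊆ dec W₀ i0 × W' ⊆ dec W₀ j0) × ((Rk Q V' R' (s κ) (dec Yn i0) × Rk Q W' R' (s κ) (dec Yn j0)) × Al V' W'))) → Σ C (λ W' → Fam q W' × Pairs (s p) W')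
            build (A , B , (sA , sB) , (mA , mB) , al) = proj₁ cd , (λ j l → view j (proj₂ cd j l)) , λ i j li lj ne l → fin i j li lj ne (same? i j li lj l)
              where
              cd : Σ C (λ W' → (t : C) → t < m → ((t ≡ i0) × (dec W' t ≡ A)) ⊎ (((t ≡ j0) × (dec W' t ≡ B)) ⊎ ((t ≢ i0) × ((t ≢ j0) × ((dec W' t ≡ dec W₀ t) × t < m)))))
              cd = code-rel m (λ t w → ((t ≡ i0) × (w ≡ A)) ⊎ (((t ≡ j0) × (w ≡ B)) ⊎ ((t ≢ i0) × ((t ≢ j0) × ((w ≡ dec W₀ t) × t < m))))) (D⊎ (D× (D≡ (DFvar _) (DFcon _)) (D≡ (DFvar _) (DFcon _))) (D⊎ (D× (D≡ (DFvar _) (DFcon _)) (D≡ (DFvar _) (DFcon _))) (D× (D≢ (DFvar _) (DFcon _)) (D× (D≢ (DFvar _) (DFcon _)) (D× (D≡ (DFvar _) (DFdec (DFcon _) (DFvar _))) (D< (DFvar _) (DFcon _)))))))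
                (λ t l → tot t l (lem (t ≡ i0)) (lem (t ≡ j0)))
                where
                tot : ∀ t → t < m → (t ≡ i0) ⊎ ¬ (t ≡ i0) → (t ≡ j0) ⊎ ¬ (t ≡ j0) → Σ C (λ w → ((t ≡ i0) × (w ≡ A)) ⊎ (((t ≡ j0) × (w ≡ B)) ⊎ ((t ≢ i0) × ((t ≢ j0) × ((w ≡ dec W₀ t) × t < m)))))
                tot t l (inj₁ h) _ = A , inj₁ (h , refl)
                tot t l (inj₂ _) (inj₁ h) = B , inj₂ (inj₁ (h , refl))
                tot t l (inj₂ h) (inj₂ h') = dec W₀ t , inj₂ (inj₂ (h , h' , refl , l))
              W' : C
              W' = proj₁ cd
              View : C → Set
              View t = ((t ≡ i0) × (dec W' t ≡ A)) ⊎ (((t ≡ j0) × (dec W' t ≡ B)) ⊎ ((t ≢ i0) × ((t ≢ j0) × ((dec W' t ≡ dec W₀ t) × t < m))))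
              sub0 : ∀ t → View t → dec W' t ⊆ dec W₀ t
              sub0 t (inj₁ (refl , h)) y my = sA y (subst (Mem y) h my)
              sub0 t (inj₂ (inj₁ (refl , h))) y my = sB y (subst (Mem y) h my)
              sub0 t (inj₂ (inj₂ (_ , _ , h , _))) y my = subst (Mem y) h my
              rk0 : ∀ t → View t → Rk Q (dec W' t) R' (s κ) (dec Yn t)
              rk0 t (inj₁ (refl , h)) = subst (λ w → Rk Q w R' (s κ) (dec Yn t)) (sym h) mA
              rk0 t (inj₂ (inj₁ (refl , h))) = subst (λ w → Rk Q w R' (s κ) (dec Yn t)) (sym h) mB
              rk0 t (inj₂ (inj₂ (_ , _ , h , l))) = subst (λ w → Rk Q w R' (s κ) (dec Yn t)) (sym h) (fam'' t l)
              lt-of : ∀ t → View t → t < m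
              lt-of t (inj₁ (refl , h)) = i0<m
              lt-of t (inj₂ (inj₁ (refl , h))) = j0<m
              lt-of t (inj₂ (inj₂ (_ , _ , _ , l))) = l
              view : ∀ t → View t → (dec W' t ⊆ dec W t) × Rk Q (dec W' t) R' (s κ) (dec Yn t)
              view t v = (λ y my → proj₁ (fam t (lt-of t v)) y (sub0 t v y my)) , rk0 t v
              atI : View i0 → dec W' i0 ≡ A
              atI (inj₁ (_ , h)) = h
              atI (inj₂ (inj₁ (h , _))) = ⊥-elim (neq h)
              atI (inj₂ (inj₂ (h , _))) = ⊥-elim (h refl)
              atJ : View j0 → dec W' j0 ≡ B
              atJ (inj₁ (h , _)) = ⊥-elim (neq (sym h))
              atJ (inj₂ (inj₁ (_ , h))) = h
              atJ (inj₂ (inj₂ (_ , h , _))) = ⊥-elim (h refl)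
              fin : ∀ i j → i < m → j < m → i ≢ j → m * i + j < p ⊎ ((i ≡ i0) × (j ≡ j0)) → Al (dec W' i) (dec W' j)
              fin i j li lj ne (inj₁ h) = Al-sub (sub0 i (proj₂ cd i li)) (sub0 j (proj₂ cd j lj)) (prs i j li lj ne h)
              fin i j li lj ne (inj₂ (e1 , e2)) = subst₂ (λ a c → Al (dec W' a) (dec W' c)) (sym e1) (sym e2)
                (subst₂ Al (sym (atI (proj₂ cd i0 i0<m))) (sym (atJ (proj₂ cd j0 j0<m))) al)

      opaque
        -- The pair of the children `i` and `j` has the number `m * i + j`, and the pairs are
        -- treated in this order. While `q` pairs are still to come, the sets keep the rank
        -- `exp2 (eS * q) * R`.
        separate-family : (∀ j → j < m → Rk Q (dec W j) (exp2 (eS * (m * m)) * R) (s κ) (dec Yn j)) →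
          Σ C (λ W' → ((j : C) → j < m → (dec W' j ⊆ dec W j) × Rk Q (dec W' j) R (s κ) (dec Yn j)) × ((i : C) → (j : C) → i < m → j < m → i ≢ j → Al (dec W' i) (dec W' j)))
        separate-family h = let (W' , fam , prs) = main (m * m) z (+0 _) in
          W' , (λ j l → proj₁ (fam j l) , subst (λ t → Rk Q (dec W' j) t (s κ) (dec Yn j)) (trans (cong (_* R) (trans (cong exp2 (*0 eS)) exp0)) (1* R)) (proj₂ (fam j l))) ,
          λ i j li lj ne → prs i j li lj ne (<≤t (≤t (≤t (≡⇒≤ (sym (+s (m * i) j))) (+mono ≤r lj)) (≡⇒≤ (sym (*s m i)))) (*mono ≤r li))
          where
          main : ∀ p q → p + q ≡ m * m → Σ C (λ W' → Fam q W' × Pairs p W')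
          main = ind (λ p → (q : C) → p + q ≡ m * m → Σ C (λ W' →
              ((j : C) → j < m → (dec W' j ⊆ dec W j) × Rk Q (dec W' j) (exp2 (eS * q) * R) (s κ) (dec Yn j)) ×
              ((i : C) → (j : C) → i < m → j < m → i ≢ j → m * i + j < p → Al (dec W' i) (dec W' j)))) (D∀ (D→ (D≡ (DF⊕ (DFvar _) (DFvar _)) (DFcon _)) (D∃ (D× (D∀ (D→ (D< (DFvar _) (DFcon _)) (D× (D-⊆ (DFdec (DFvar _) (DFvar _)) (DFdec (DFcon _) (DFvar _))) (D-Rk (DFdec (DFvar _) (DFvar _)) (DF⊗ (DFexp (DF⊗ (DFcon _) (DFvar _))) (DFcon _)) (DFcon _) (DFdec (DFcon _) (DFvar _)))))) (D∀ (D∀ (D→ (D< (DFvar _) (DFcon _)) (D→ (D< (DFvar _) (DFcon _)) (D→ (D≢ (DFvar _) (DFvar _)) (D→ (D< (DF⊕ (DF⊗ (DFcon _) (DFvar _)) (DFvar _)) (DFvar _)) (rel2 {R = Al} dAl (DFdec (DFvar _) (DFvar _)) (DFdec (DFvar _) (DFvar _)))))))))))))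
            (λ q e → W , (λ j l → (λ y my → my) , subst (λ t → Rk Q (dec W j) (exp2 (eS * t) * R) (s κ) (dec Yn j)) (trans (sym e) (0+ q)) (h j l)) ,
                     λ i j li lj ne l → ⊥-elim (x≮0 l))
            (λ p ih q e → let (W₀ , fam , prs) = ih (s q) (trans (+s p q) (trans (sym (s+ p q)) e)) in step p q W₀ e fam prs)

    -- `exp2 e` is the price of one node: at most `A3 * A3` pairs of children at the price
    -- `exp2 eS`, one doubling for the unit of rank that is lost in unfolding, and `A3` more bits to
    -- number the children in `InjB`.
    A3 e : C
    A3 = K + c3
    e = s (eS * (A3 * A3)) + A3

    Sub : C → C → C → C → Set
    Sub X' X k x = (y : C) → Mem y X' → Mem y X × agree k x y

    -- `κ` is the level at which `y` and `w` part. `V` and `W` stand for arbitrary parts of the two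
    -- cones below the children through which they pass.
    Fine : C → Set
    Fine X' = (y : C) → (w : C) → (κ : C) → Mem y X' → Mem w X' → κ < ℓ → agree κ y w → dec y κ ≢ dec w κ →
      (Mem (dec τ κ) Q × ((j : C) → j < dec τ κ + c3 → Σ C (λ v → Mem v X' × (agree κ y v × (dec v κ ≡ j))))) ×
      ((V : C) → (W : C) → ((v : C) → Mem v V → Mem v X' × agree (s κ) y v) → ((v : C) → Mem v W → Mem v X' × agree (s κ) w v) → Al V W)

    -- Codes are not unique, and two elements could describe the same branch. With this excluded,
    -- distinct elements part at some level below `ℓ`.
    NoDup : C → Set
    NoDup X' = (y : C) → (w : C) → Mem y X' → Mem w X' → agree ℓ y w → y ≡ w

    -- A bound on the size of `X'` as counted in M. In the ultrapower such an injection becomes an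
    -- element below `B` that is not in M.
    InjB : C → C → C → Set
    InjB h X' B = ((y : C) → Mem y X' → dec h y < B) × ((y : C) → (w : C) → Mem y X' → Mem w X' → dec h y ≡ dec h w → y ≡ w)

    HN : C → C → C → C → C → Set
    HN r X k x n = HasNode (Rk Q X r) k x n

    opaque
      D-Sub : ∀ {n} {f g h l : Env n → C} → DF n f → DF n g → DF n h → DF n l → Dfn n (λ ρ → Sub (f ρ) (g ρ) (h ρ) (l ρ))
      D-Sub = rel4 {R = Sub} (D∀ (D→ (D-Mem (DFvar _) (DFvar _)) (D× (D-Mem (DFvar _) (DFvar _)) (D-agree (DFvar _) (DFvar _) (DFvar _)))))

    opaque
      D-Fine : ∀ {n} {f : Env n → C} → DF n f → Dfn n (λ ρ → Fine (f ρ))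
      D-Fine = rel1 {R = Fine} (D∀ (D∀ (D∀ (D→ (D-Mem (DFvar _) (DFvar _)) (D→ (D-Mem (DFvar _) (DFvar _)) (D→ (D< (DFvar _) (DFcon _)) (D→ (D-agree (DFvar _) (DFvar _) (DFvar _)) (D→ (D≢ (DFdec (DFvar _) (DFvar _)) (DFdec (DFvar _) (DFvar _))) (D× (D× (D-Mem (DFdec (DFcon _) (DFvar _)) (DFcon _)) (D∀ (D→ (D< (DFvar _) (DF⊕ (DFdec (DFcon _) (DFvar _)) (DFcon _))) (D∃ (D× (D-Mem (DFvar _) (DFvar _)) (D× (D-agree (DFvar _) (DFvar _) (DFvar _)) (D≡ (DFdec (DFvar _) (DFvar _)) (DFvar _)))))))) (D∀ (D∀ (D→ (D∀ (D→ (D-Mem (DFvar _) (DFvar _)) (D× (D-Mem (DFvar _) (DFvar _)) (D-agree (DFs (DFvar _)) (DFvar _) (DFvar _))))) (D→ (D∀ (D→ (D-Mem (DFvar _) (DFvar _)) (D× (D-Mem (DFvar _) (DFvar _)) (D-agree (DFs (DFvar _)) (DFvar _) (DFvar _))))) (rel2 {R = Al} dAl (DFvar _) (DFvar _)))))))))))))))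

    opaque
      D-NoDup : ∀ {n} {f : Env n → C} → DF n f → Dfn n (λ ρ → NoDup (f ρ))
      D-NoDup = rel1 {R = NoDup} (D∀ (D∀ (D→ (D-Mem (DFvar _) (DFvar _)) (D→ (D-Mem (DFvar _) (DFvar _)) (D→ (D-agree (DFcon _) (DFvar _) (DFvar _)) (D≡ (DFvar _) (DFvar _)))))))

    opaque
      D-InjB : ∀ {n} {f g h : Env n → C} → DF n f → DF n g → DF n h → Dfn n (λ ρ → InjB (f ρ) (g ρ) (h ρ))
      D-InjB = rel3 {R = InjB} (D× (D∀ (D→ (D-Mem (DFvar _) (DFvar _)) (D< (DFdec (DFvar _) (DFvar _)) (DFvar _)))) (D∀ (D∀ (D→ (D-Mem (DFvar _) (DFvar _)) (D→ (D-Mem (DFvar _) (DFvar _)) (D→ (D≡ (DFdec (DFvar _) (DFvar _)) (DFdec (DFvar _) (DFvar _))) (D≡ (DFvar _) (DFvar _))))))))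

    opaque
      D-HN : ∀ {r n} {f g h l : Env n → C} → DF n f → DF n g → DF n h → DF n l → Dfn n (λ ρ → HN r (f ρ) (g ρ) (h ρ) (l ρ))
      D-HN {r} = rel4 {R = HN r} (D∃ (D∃ (D× (D< (DFvar _) (DFcon _)) (D× (D≤ (DFvar _) (DFvar _)) (D× (D< (DFvar _) (DFcon _)) (D× (D-agree (DFvar _) (DFvar _) (DFvar _)) (D× (D≡ (DFdec (DFcon _) (DFvar _)) (DFvar _)) (D∀ (D→ (D< (DFvar _) (DF⊕ (DFvar _) (DFcon _))) (D∃ (D× (D< (DFvar _) (DFcon _)) (D× (D-agree (DFvar _) (DFvar _) (DFvar _)) (D× (D≡ (DFdec (DFvar _) (DFvar _)) (DFvar _)) (D-Rk (DFvar _) (DFcon _) (DFs (DFvar _)) (DFvar _)))))))))))))))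

    -- A unit of rank is built type by type: `X'` has rank `r`, and for the types of `Q` below `i`
    -- it already has a node whose children all have rank `r`. The number `rK + i` counts the nodes
    -- stacked so far.
    Result : C → C → C → C → C → C → Set
    Result r rK i X k x = Σ C (λ X' → Σ C (λ h → Sub X' X k x × ((Fine X' × NoDup X') × (InjB h X' (exp2 (e * (rK + i))) × (Rk Q X' r k x × ((n : C) → Mem n Q → n < i → HN r X' k x n))))))

    Fine-empty : ∀ X' → (∀ y w → Mem y X' → Mem w X' → y ≡ w) → Fine X'
    Fine-empty X' h y w κ my mw l a ne = ⊥-elim (ne (cong (λ t → dec t κ) (h y w my mw)))

    -- A node of type `i` is put on top: the sets below its children are made pairwise `Al`, and the
    -- induction hypothesis then works below each child separately.
    module Branch (r rK i : C) (iQ : Mem i Q) (ih : (X : C) → (k : C) → (x : C) → x < b → k ≤ ℓ → Rk Q X (r0 * exp2 (e * (rK + i))) k x → Σ C (λ X' → Σ C (λ h → Sub X' X k x × ((Fine X' × NoDup X') × (InjB h X' (exp2 (e * (rK + i))) × (Rk Q X' r k x × ((n : C) → Mem n Q → n < i → HN r X' k x n))))))) (X k x : C) (x<b : x < b) (k≤ℓ : k ≤ ℓ)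
      (mX : Rk Q X (r0 * exp2 (e * (rK + s i))) k x) where
      B₀ R m : C
      B₀ = exp2 (e * (rK + i))
      R = r0 * B₀
      m = i + c3

      R>0 : z < R
      R>0 = <≤t r0>0 (≤* B₀ exp>0)

      r0≤R : r0 ≤ R
      r0≤R = ≤* B₀ exp>0

      m≤ : m ≤ A3
      m≤ = +mono (<⇒≤ (Q<K i iQ)) ≤r

      bump : s (exp2 (eS * (m * m)) * R) ≤ r0 * exp2 (e * (rK + s i))
      bump = ≤t (s≤s (*mono (exp-mono (*mono (≤r {eS}) (*mono m≤ m≤))) ≤r)) (≤t b1 (≤t b2 (≡⇒≤ (sym b3))))
        where
        F = exp2 (eS * (A3 * A3))
        b1 : s (F * R) ≤ (F + F) * R
        b1 = ≤t (≤t (≡⇒≤ (cong s (sym (+0 _)))) (≤t (≡⇒≤ (sym (+s (F * R) z))) (+mono (≤r {F * R}) (<≤t R>0 (≤*' F exp>0))))) (≡⇒≤ (sym (*d' R F F)))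
        b2 : (F + F) * R ≤ exp2 e * R
        b2 = *mono (≤t (≡⇒≤ (sym (exps (eS * (A3 * A3))))) (exp-mono (≤+ A3))) ≤r
        b3 : r0 * exp2 (e * (rK + s i)) ≡ exp2 e * R
        b3 = trans (cong (λ t → r0 * exp2 (e * t)) (+s rK i)) (trans (cong (λ t → r0 * exp2 t) (*s e (rK + i))) (trans (cong (r0 *_) (exp+ _ e)) (trans (sym (*a r0 B₀ (exp2 e))) (*c _ _))))

      nd : HasNode (Rk Q X (exp2 (eS * (m * m)) * R)) k x i
      nd = Rk-unfold (Rk-≤ x<b k≤ℓ bump mX) i iQ

      κ y₀ : C
      κ = proj₁ nd
      y₀ = proj₁ (proj₂ nd)
      k≤κ : k ≤ κ
      k≤κ = proj₁ (proj₂ (proj₂ (proj₂ nd)))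
      κ<ℓ : κ < ℓ
      κ<ℓ = proj₁ (proj₂ (proj₂ (proj₂ (proj₂ nd))))
      y₀<b : y₀ < b
      y₀<b = proj₁ (proj₂ (proj₂ nd))
      a₀ : agree k x y₀
      a₀ = proj₁ (proj₂ (proj₂ (proj₂ (proj₂ (proj₂ nd)))))
      tκ : dec τ κ ≡ i
      tκ = proj₁ (proj₂ (proj₂ (proj₂ (proj₂ (proj₂ (proj₂ nd))))))

      Kid : C → C → Set
      Kid j y = (y < b) × (agree κ y₀ y × ((dec y κ ≡ j) × Rk Q X (exp2 (eS * (m * m)) * R) (s κ) y))

      kids : Σ C (λ Yn → (j : C) → j < m → Kid j (dec Yn j))
      kids = code-rel m (λ j y → (y < b) × (agree κ y₀ y × ((dec y κ ≡ j) × Rk Q X (exp2 (eS * (m * m)) * R) (s κ) y))) (D× (D< (DFvar _) (DFcon _)) (D× (D-agree (DFcon _) (DFcon _) (DFvar _)) (D× (D≡ (DFdec (DFvar _) (DFcon _)) (DFvar _)) (D-Rk (DFcon _) (DFcon _) (DFcon _) (DFvar _)))))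
        (proj₂ (proj₂ (proj₂ (proj₂ (proj₂ (proj₂ (proj₂ nd)))))))

      Yn : C
      Yn = proj₁ kids

      Yn<b : ∀ j → j < m → dec Yn j < b
      Yn<b j l = proj₁ (proj₂ kids j l)

      W₀ : Σ C (λ W → (j : C) → j < m → dec W j ≡ X)
      W₀ = code m (λ _ → X) (DFcon X)

      fs : Σ C (λ W' → ((j : C) → j < m → (dec W' j ⊆ dec (proj₁ W₀) j) × Rk Q (dec W' j) R (s κ) (dec Yn j)) × ((i : C) → (j : C) → i < m → j < m → i ≢ j → Al (dec W' i) (dec W' j)))
      fs = Family.separate-family m κ (proj₁ W₀) Yn R r0≤R κ<ℓ Yn<b
        (λ j l → subst (λ w → Rk Q w (exp2 (eS * (m * m)) * R) (s κ) (dec Yn j)) (sym (proj₂ W₀ j l)) (proj₂ (proj₂ (proj₂ (proj₂ kids j l)))))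

      W' : C
      W' = proj₁ fs

      W'⊆ : ∀ j → j < m → dec W' j ⊆ X
      W'⊆ j l y my = subst (Mem y) (proj₂ W₀ j l) (proj₁ (proj₁ (proj₂ fs) j l) y my)

      Good' : C → C → C → Set
      Good' j X' h = Sub X' (dec W' j) (s κ) (dec Yn j) × ((Fine X' × NoDup X') × (InjB h X' B₀ × (Rk Q X' r (s κ) (dec Yn j) × ((n : C) → Mem n Q → n < i → HN r X' (s κ) (dec Yn j) n))))

      XF : Σ C (λ F → (j : C) → j < m → Σ C (λ h → Good' j (dec F j) h))
      XF = code-rel m (λ j X' → Σ C (λ h → Sub X' (dec W' j) (s κ) (dec Yn j) × ((Fine X' × NoDup X') × (InjB h X' B₀ × (Rk Q X' r (s κ) (dec Yn j) × ((n : C) → Mem n Q → n < i → HN r X' (s κ) (dec Yn j) n)))))) (D∃ (D× (D-Sub (DFvar _) (DFdec (DFcon _) (DFvar _)) (DFcon _) (DFdec (DFcon _) (DFvar _))) (D× (D× (D-Fine (DFvar _)) (D-NoDup (DFvar _))) (D× (D-InjB (DFvar _) (DFvar _) (DFcon _)) (D× (D-Rk (DFvar _) (DFcon _) (DFcon _) (DFdec (DFcon _) (DFvar _))) (D∀ (D→ (D-Mem (DFvar _) (DFcon _)) (D→ (D< (DFvar _) (DFcon _)) (D-HN (DFvar _) (DFcon _) (DFdec (DFcon _) (DFvar _)) (DFvar _))))))))))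
        (λ j l → ih (dec W' j) (s κ) (dec Yn j) (Yn<b j l) κ<ℓ (proj₂ (proj₁ (proj₂ fs) j l)))

      F : C
      F = proj₁ XF

      HF : Σ C (λ H → (j : C) → j < m → Good' j (dec F j) (dec H j))
      HF = code-rel m (λ j h → Sub (dec F j) (dec W' j) (s κ) (dec Yn j) × ((Fine (dec F j) × NoDup (dec F j)) × (InjB h (dec F j) B₀ × (Rk Q (dec F j) r (s κ) (dec Yn j) × ((n : C) → Mem n Q → n < i → HN r (dec F j) (s κ) (dec Yn j) n))))) (D× (D-Sub (DFdec (DFcon _) (DFvar _)) (DFdec (DFcon _) (DFvar _)) (DFcon _) (DFdec (DFcon _) (DFvar _))) (D× (D× (D-Fine (DFdec (DFcon _) (DFvar _))) (D-NoDup (DFdec (DFcon _) (DFvar _)))) (D× (D-InjB (DFvar _) (DFdec (DFcon _) (DFvar _)) (DFcon _)) (D× (D-Rk (DFdec (DFcon _) (DFvar _)) (DFcon _) (DFcon _) (DFdec (DFcon _) (DFvar _))) (D∀ (D→ (D-Mem (DFvar _) (DFcon _)) (D→ (D< (DFvar _) (DFcon _)) (D-HN (DFdec (DFcon _) (DFvar _)) (DFcon _) (DFdec (DFcon _) (DFvar _)) (DFvar _)))))))))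
        (proj₂ XF)

      H : C
      H = proj₁ HF

      good : ∀ j → j < m → Good' j (dec F j) (dec H j)
      good = proj₂ HF

      U : Σ C (λ X' → (y : C) → (Mem y X' → y < X × Σ C (λ j → j < m × Mem y (dec F j))) × (y < X × Σ C (λ j → j < m × Mem y (dec F j)) → Mem y X'))
      U = comp X (λ y → Σ C (λ j → j < m × Mem y (dec F j))) (D∃ (D× (D< (DFvar _) (DFcon _)) (D-Mem (DFvar _) (DFdec (DFcon _) (DFvar _)))))

      X' : C
      X' = proj₁ U

      inX : ∀ j → j < m → ∀ y → Mem y (dec F j) → Mem y X
      inX j l y my = W'⊆ j l y (proj₁ (proj₁ (good j l) y my))

      into : ∀ j → j < m → dec F j ⊆ X'
      into j l y my = proj₂ (proj₂ U y) (Mem-bound (inX j l y my) , j , l , my)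

      out : ∀ y → Mem y X' → Σ C (λ j → j < m × Mem y (dec F j))
      out y my = proj₂ (proj₁ (proj₂ U y) my)

      ag : ∀ j → j < m → ∀ y → Mem y (dec F j) → agree (s κ) (dec Yn j) y
      ag j l y my = proj₂ (proj₁ (good j l) y my)

      digit : ∀ j → j < m → ∀ y → Mem y (dec F j) → dec y κ ≡ j
      digit j l y my = trans (sym (ag j l y my κ <s)) (proj₁ (proj₂ (proj₂ (proj₂ kids j l))))

      ag₀ : ∀ j → j < m → ∀ y → Mem y (dec F j) → agree κ y₀ y
      ag₀ j l y my = agree-trans (proj₁ (proj₂ (proj₂ kids j l))) (agree-≤ ≤s (ag j l y my))

      sub' : Sub X' X k x
      sub' y my = let (j , l , mj) = out y my in inX j l y mj , agree-trans a₀ (agree-≤ k≤κ (ag₀ j l y mj))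

      m>0 : z < m
      m>0 = <≤t (0<s {s (s z)}) (≤+' i)

      rank : Rk Q X' r k x
      rank = Rk-lift x<b k≤ℓ (≤t k≤κ ≤s) (agree-trans a₀ (agree-≤ k≤κ (proj₁ (proj₂ (proj₂ kids z m>0)))))
        (Rk-sub (Yn<b z m>0) κ<ℓ (into z m>0) (proj₁ (proj₂ (proj₂ (proj₂ (good z m>0))))))

      nodes : ∀ n → Mem n Q → n < s i → HN r X' k x n
      nodes n mn l = fin (<s⇒ l)
        where
        fin : n < i ⊎ n ≡ i → HN r X' k x n
        -- Nodes of smaller type are taken from below the child 0; any child would do.
        fin (inj₁ l') = let (k'' , v , q1 , q2 , q3 , q4 , q5 , hh) = proj₂ (proj₂ (proj₂ (proj₂ (good z m>0)))) n mn l' in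
          k'' , v , q1 , ≤t (≤t k≤κ ≤s) q2 , q3 , agree-trans a₀ (agree-trans (agree-≤ k≤κ (proj₁ (proj₂ (proj₂ kids z m>0)))) (agree-≤ (≤t k≤κ ≤s) q4)) , q5 ,
          λ j lj → let (y' , u1 , u2 , u3 , u4) = hh j lj in y' , u1 , u2 , u3 , Rk-sub u1 q3 (into z m>0) u4
        fin (inj₂ refl) = κ , y₀ , y₀<b , k≤κ , κ<ℓ , a₀ , tκ , λ j lj →
          dec Yn j , Yn<b j lj , proj₁ (proj₂ (proj₂ kids j lj)) , proj₁ (proj₂ (proj₂ (proj₂ kids j lj))) ,
          Rk-sub (Yn<b j lj) κ<ℓ (into j lj) (proj₁ (proj₂ (proj₂ (proj₂ (good j lj)))))

      nodup : NoDup X'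
      nodup y w my mw a = fin (out y my) (out w mw)
        where
        fin : Σ C (λ j → j < m × Mem y (dec F j)) → Σ C (λ j → j < m × Mem w (dec F j)) → y ≡ w
        fin (j , l , mj) (j' , l' , mj') = proj₂ (proj₁ (proj₂ (good j l))) y w mj (subst (λ t → Mem w (dec F t)) (sym e1) mj') a
          where
          e1 : j ≡ j'
          e1 = trans (sym (digit j l y mj)) (trans (a κ κ<ℓ) (digit j' l' w mj'))

      -- Points below the same child part strictly below `κ`, so their cones stay inside the set of
      -- that child and the induction hypothesis applies. Points below different children part
      -- exactly at `κ`, where the family has been separated.
      fine : Fine X'
      fine y w λ' my mw λ<ℓ a ne = fin (out y my) (out w mw)
        where
        Goal : Set
        Goal = (Mem (dec τ λ') Q × ((j : C) → j < dec τ λ' + c3 → Σ C (λ v → Mem v X' × (agree λ' y v × (dec v λ' ≡ j))))) ×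
          ((V : C) → (W : C) → ((v : C) → Mem v V → Mem v X' × agree (s λ') y v) → ((v : C) → Mem v W → Mem v X' × agree (s λ') w v) → Al V W)
        fin : Σ C (λ j → j < m × Mem y (dec F j)) → Σ C (λ j → j < m × Mem w (dec F j)) → Goal
        fin (j , l , mj) (j' , l' , mj') = cs (lem (j ≡ j'))
          where
          cs : (j ≡ j') ⊎ ¬ (j ≡ j') → Goal
          cs (inj₁ refl) = (proj₁ (proj₁ g) , λ j2 l2 → let (v , mv , q) = proj₂ (proj₁ g) j2 l2 in v , into j l v mv , q) ,
                           λ V W hV hW → proj₂ g V W (λ v mv → back y mj v (hV v mv)) (λ v mv → back w mj' v (hW v mv))
            where
            g = proj₁ (proj₁ (proj₂ (good j l))) y w λ' mj mj' λ<ℓ a ne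
            κ<λ : κ < λ'
            κ<λ = ≰⇒> (λ λ≤κ → ne (trans (sym (ag j l y mj λ' (s≤s λ≤κ))) (ag j l w mj' λ' (s≤s λ≤κ))))
            back : ∀ u → Mem u (dec F j) → ∀ v → Mem v X' × agree (s λ') u v → Mem v (dec F j) × agree (s λ') u v
            back u mu v (mv , av) = fb (out v mv) , av
              where
              fb : Σ C (λ j1 → j1 < m × Mem v (dec F j1)) → Mem v (dec F j)
              fb (j1 , l1 , mj1) = subst (λ t → Mem v (dec F t)) (trans (sym (digit j1 l1 v mj1)) (trans (sym (av κ (<t κ<λ <s))) (digit j l u mu))) mj1
          cs (inj₂ nj) = full (at λ')
            where
            at : ∀ t → (t < κ ⊎ (t ≡ κ ⊎ κ < t))
            at t = tri t κ
            full : λ' < κ ⊎ (λ' ≡ κ ⊎ κ < λ') → Goal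
            full (inj₁ lt) = ⊥-elim (ne (trans (sym (ag₀ j l y mj λ' lt)) (ag₀ j' l' w mj' λ' lt)))
            full (inj₂ (inj₂ gt)) = ⊥-elim (nj (trans (sym (digit j l y mj)) (trans (a κ gt) (digit j' l' w mj'))))
            full (inj₂ (inj₁ refl)) = (subst (λ t → Mem t Q) (sym tκ) iQ , λ j2 l2 → kid j2 (subst (λ t → j2 < t + c3) tκ l2)) ,
              λ V W hV hW → Al-sub (λ v mv → proj₁ (proj₁ (good j l) v (back j l y mj v (hV v mv)))) (λ v mv → proj₁ (proj₁ (good j' l') v (back j' l' w mj' v (hW v mv))))
                (proj₂ (proj₂ fs) j j' l l' nj)
              where
              kid : ∀ j2 → j2 < m → Σ C (λ v → Mem v X' × (agree κ y v × (dec v κ ≡ j2)))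
              kid j2 l2 = let (v , mv , _) = Rk-leaf (proj₁ (proj₂ (proj₂ (proj₂ (good j2 l2))))) in
                v , into j2 l2 v mv , agree-trans (agree-sym (ag₀ j l y mj)) (ag₀ j2 l2 v mv) , digit j2 l2 v mv
              back : ∀ j → j < m → ∀ u → Mem u (dec F j) → ∀ v → Mem v X' × agree (s κ) u v → Mem v (dec F j)
              back j l u mu v (mv , av) = fb (out v mv)
                where
                fb : Σ C (λ j1 → j1 < m × Mem v (dec F j1)) → Mem v (dec F j)
                fb (j1 , l1 , mj1) = subst (λ t → Mem v (dec F t)) (trans (sym (digit j1 l1 v mj1)) (trans (sym (av κ <s)) (digit j l u mu))) mj1

      -- Numbering in base `B₀`: the digit at `κ` leads, the number given by the child's own
      -- injection follows.
      hcode : Σ C (λ h → (y : C) → y < X → dec h y ≡ B₀ * dec y κ + dec (dec H (dec y κ)) y)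
      hcode = code X (λ y → B₀ * dec y κ + dec (dec H (dec y κ)) y) (DF⊕ (DF⊗ (DFcon _) (DFdec (DFvar _) (DFcon _))) (DFdec (DFdec (DFcon _) (DFdec (DFvar _) (DFcon _))) (DFvar _)))

      h : C
      h = proj₁ hcode

      h-eq : ∀ j → j < m → ∀ y → Mem y (dec F j) → dec h y ≡ B₀ * j + dec (dec H j) y
      h-eq j l y my = trans (proj₂ hcode y (Mem-bound (inX j l y my))) (cong (λ t → B₀ * t + dec (dec H t) y) (digit j l y my))

      hb : ∀ j → j < m → ∀ y → Mem y (dec F j) → dec (dec H j) y < B₀
      hb j l = proj₁ (proj₁ (proj₂ (proj₂ (good j l))))

      bound : B₀ * m ≤ exp2 (e * (rK + s i))
      bound = ≤t (*mono (≤r {B₀}) (≤t m≤ (≤t (<⇒≤ (x<exp A3)) (exp-mono (≤+' (s (eS * (A3 * A3)))))))) (≡⇒≤ (sym (trans (cong (λ t → exp2 (e * t)) (+s rK i)) (trans (cong exp2 (*s e (rK + i))) (exp+ _ e)))))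

      injb : InjB h X' (exp2 (e * (rK + s i)))
      injb = (λ y my → lt y (out y my)) , λ y w my mw eq → inj y w (out y my) (out w mw) eq
        where
        lt : ∀ y → Σ C (λ j → j < m × Mem y (dec F j)) → dec h y < exp2 (e * (rK + s i))
        lt y (j , l , mj) = <≤t (≤t (≡⇒≤ (trans (cong s (h-eq j l y mj)) (sym (+s _ _)))) (≤t (+mono (≤r {B₀ * j}) (hb j l y mj)) (≤t (≡⇒≤ (sym (*s B₀ j))) (*mono (≤r {B₀}) l)))) bound
        inj : ∀ y w → Σ C (λ j → j < m × Mem y (dec F j)) → Σ C (λ j → j < m × Mem w (dec F j)) → dec h y ≡ dec h w → y ≡ w
        inj y w (j , l , mj) (j' , l' , mj') eq = fin (div-unique (hb j l y mj) (hb j' l' w mj') (trans (sym (h-eq j l y mj)) (trans eq (h-eq j' l' w mj'))))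
          where
          fin : (j ≡ j') × (dec (dec H j) y ≡ dec (dec H j') w) → y ≡ w
          fin (e1 , e2) = proj₂ (proj₁ (proj₂ (proj₂ (good j l)))) y w mj (subst (λ t → Mem w (dec F t)) (sym e1) mj') (trans e2 (cong (λ t → dec (dec H t) w) (sym e1)))

      result : Result r rK (s i) X k x
      result = X' , h , sub' , (fine , nodup) , injb , rank , nodes

    opaque
      inner : ∀ r rK → ((X : C) → (k : C) → (x : C) → x < b → k ≤ ℓ → Rk Q X (r0 * exp2 (e * (rK + z))) k x → Σ C (λ X' → Σ C (λ h → Sub X' X k x × ((Fine X' × NoDup X') × (InjB h X' (exp2 (e * (rK + z))) × (Rk Q X' r k x × ((n : C) → Mem n Q → n < z → HN r X' k x n))))))) → ∀ i → i ≤ K → (X : C) → (k : C) → (x : C) → x < b → k ≤ ℓ → Rk Q X (r0 * exp2 (e * (rK + i))) k x → Σ C (λ X' → Σ C (λ h → Sub X' X k x × ((Fine X' × NoDup X') × (InjB h X' (exp2 (e * (rK + i))) × (Rk Q X' r k x × ((n : C) → Mem n Q → n < i → HN r X' k x n))))))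
      inner r rK start = ind (λ i → i ≤ K → (X : C) → (k : C) → (x : C) → x < b → k ≤ ℓ → Rk Q X (r0 * exp2 (e * (rK + i))) k x → Σ C (λ X' → Σ C (λ h → Sub X' X k x × ((Fine X' × NoDup X') × (InjB h X' (exp2 (e * (rK + i))) × (Rk Q X' r k x × ((n : C) → Mem n Q → n < i → HN r X' k x n))))))) (D→ (D≤ (DFvar _) (DFcon _)) (D∀ (D∀ (D∀ (D→ (D< (DFvar _) (DFcon _)) (D→ (D≤ (DFvar _) (DFcon _)) (D→ (D-Rk (DFvar _) (DF⊗ (DFcon _) (DFexp (DF⊗ (DFcon _) (DF⊕ (DFcon _) (DFvar _))))) (DFvar _) (DFvar _)) (D∃ (D∃ (D× (D-Sub (DFvar _) (DFvar _) (DFvar _) (DFvar _)) (D× (D× (D-Fine (DFvar _)) (D-NoDup (DFvar _))) (D× (D-InjB (DFvar _) (DFvar _) (DFexp (DF⊗ (DFcon _) (DF⊕ (DFcon _) (DFvar _))))) (D× (D-Rk (DFvar _) (DFcon _) (DFvar _) (DFvar _)) (D∀ (D→ (D-Mem (DFvar _) (DFcon _)) (D→ (D< (DFvar _) (DFvar _)) (D-HN (DFvar _) (DFvar _) (DFvar _) (DFvar _)))))))))))))))))) (λ _ → start) step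
        where
        step : ∀ i → (i ≤ K → (X : C) → (k : C) → (x : C) → x < b → k ≤ ℓ → Rk Q X (r0 * exp2 (e * (rK + i))) k x → Σ C (λ X' → Σ C (λ h → Sub X' X k x × ((Fine X' × NoDup X') × (InjB h X' (exp2 (e * (rK + i))) × (Rk Q X' r k x × ((n : C) → Mem n Q → n < i → HN r X' k x n))))))) → s i ≤ K → (X : C) → (k : C) → (x : C) → x < b → k ≤ ℓ → Rk Q X (r0 * exp2 (e * (rK + s i))) k x → Σ C (λ X' → Σ C (λ h → Sub X' X k x × ((Fine X' × NoDup X') × (InjB h X' (exp2 (e * (rK + s i))) × (Rk Q X' r k x × ((n : C) → Mem n Q → n < s i → HN r X' k x n))))))
        step i ih l X k x p q mX = cs (lem (Mem i Q))
          where
          ih' : (X : C) → (k : C) → (x : C) → x < b → k ≤ ℓ → Rk Q X (r0 * exp2 (e * (rK + i))) k x → Σ C (λ X' → Σ C (λ h → Sub X' X k x × ((Fine X' × NoDup X') × (InjB h X' (exp2 (e * (rK + i))) × (Rk Q X' r k x × ((n : C) → Mem n Q → n < i → HN r X' k x n))))))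
          ih' = ih (<⇒≤ l)
          ei : exp2 (e * (rK + i)) ≤ exp2 (e * (rK + s i))
          ei = exp-mono (*mono (≤r {e}) (+mono (≤r {rK}) (≤s {i})))
          cs : Mem i Q ⊎ ¬ Mem i Q → Result r rK (s i) X k x
          cs (inj₁ iQ) = Branch.result r rK i iQ ih' X k x p q mX
          -- A type outside `Q` needs no node; only the bounds are relaxed.
          cs (inj₂ niQ) = let (X' , h , sub , fn , (b1 , b2) , rk , nds) = ih' X k x p q (Rk-≤ p q (*mono (≤r {r0}) ei) mX) in
            X' , h , sub , fn , ((λ y my → <≤t (b1 y my) ei) , b2) , rk , λ n mn l' → fin n mn (<s⇒ l') nds
            where
            fin : ∀ {X'} n → Mem n Q → n < i ⊎ n ≡ i → (∀ n → Mem n Q → n < i → HN r X' k x n) → HN r X' k x n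
            fin n mn (inj₁ l') nds = nds n mn l'
            fin n mn (inj₂ refl) nds = ⊥-elim (niQ mn)

    Aligned : C → C → C → C → C → Set
    Aligned r X k x X' = Sub X' X k x × ((Fine X' × NoDup X') × (Σ C (λ h → InjB h X' (exp2 (e * (r * K)))) × Rk Q X' r k x))

    opaque
      -- Each unit of rank is one run of `inner` through the types below `K`. So `r * K` nodes are
      -- stacked, each at the price `exp2 e`.
      align : ∀ r X k x → x < b → k ≤ ℓ → Rk Q X (r0 * exp2 (e * (r * K))) k x → Σ C (Aligned r X k x)
      align r X k x p q mX = let (X' , h , sub , fn , ib , rk) = main r X k x p q mX in X' , sub , fn , (h , ib) , rk
        where
        main : ∀ r X k x → x < b → k ≤ ℓ → Rk Q X (r0 * exp2 (e * (r * K))) k x → Σ C (λ X' → Σ C (λ h → Sub X' X k x × ((Fine X' × NoDup X') × (InjB h X' (exp2 (e * (r * K))) × Rk Q X' r k x))))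
        main = ind (λ r → (X : C) → (k : C) → (x : C) → x < b → k ≤ ℓ → Rk Q X (r0 * exp2 (e * (r * K))) k x → Σ C (λ X' → Σ C (λ h → Sub X' X k x × ((Fine X' × NoDup X') × (InjB h X' (exp2 (e * (r * K))) × Rk Q X' r k x)))))
          (D∀ (D∀ (D∀ (D→ (D< (DFvar _) (DFcon _)) (D→ (D≤ (DFvar _) (DFcon _)) (D→ (D-Rk (DFvar _) (DF⊗ (DFcon _) (DFexp (DF⊗ (DFcon _) (DF⊗ (DFvar _) (DFcon _))))) (DFvar _) (DFvar _)) (D∃ (D∃ (D× (D-Sub (DFvar _) (DFvar _) (DFvar _) (DFvar _)) (D× (D× (D-Fine (DFvar _)) (D-NoDup (DFvar _))) (D× (D-InjB (DFvar _) (DFvar _) (DFexp (DF⊗ (DFcon _) (DF⊗ (DFvar _) (DFcon _))))) (D-Rk (DFvar _) (DFvar _) (DFvar _) (DFvar _))))))))))))) base step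
          where
          base : ∀ X k x → x < b → k ≤ ℓ → Rk Q X (r0 * exp2 (e * (z * K))) k x → Σ C (λ X' → Σ C (λ h → Sub X' X k x × ((Fine X' × NoDup X') × (InjB h X' (exp2 (e * (z * K))) × Rk Q X' z k x))))
          -- Rank 0 asks for one leaf, and a singleton has no branching to be aligned.
          base X k x p q m = X' , hc , (λ y my → subst (λ t → Mem t X) (sym (is y my)) my0 , subst (agree k x) (sym (is y my)) ay0) ,
              (Fine-empty X' one , λ y w my mw _ → one y w my mw) , ((λ y my → ≤<t (≡⇒≤ (hz y my)) exp>0) , λ y w my mw _ → one y w my mw) , Rk-zero (y0 , proj₂ (proj₂ sg y0) (<s , refl) , ay0)
            where
            y0 : C
            y0 = proj₁ (Rk-leaf m)
            my0 : Mem y0 X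
            my0 = proj₁ (proj₂ (Rk-leaf m))
            ay0 : agree k x y0
            ay0 = proj₂ (proj₂ (Rk-leaf m))
            sg : Σ C (λ X' → (y : C) → (Mem y X' → y < s y0 × (y ≡ y0)) × (y < s y0 × (y ≡ y0) → Mem y X'))
            sg = comp (s y0) (λ y → y ≡ y0) (D≡ (DFvar _) (DFcon _))
            X' : C
            X' = proj₁ sg
            is : ∀ y → Mem y X' → y ≡ y0
            is y my = proj₂ (proj₁ (proj₂ sg y) my)
            one : ∀ y w → Mem y X' → Mem w X' → y ≡ w
            one y w my mw = trans (is y my) (sym (is w mw))
            hcode : Σ C (λ h → (y : C) → y < s y0 → dec h y ≡ z)
            hcode = code (s y0) (λ _ → z) DFz
            hc : C
            hc = proj₁ hcode
            hz : ∀ y → Mem y X' → dec hc y ≡ z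
            hz y my = proj₂ hcode y (proj₁ (proj₁ (proj₂ sg y) my))
          step : ∀ r → ((X : C) → (k : C) → (x : C) → x < b → k ≤ ℓ → Rk Q X (r0 * exp2 (e * (r * K))) k x → Σ C (λ X' → Σ C (λ h → Sub X' X k x × ((Fine X' × NoDup X') × (InjB h X' (exp2 (e * (r * K))) × Rk Q X' r k x))))) →
                 (X : C) → (k : C) → (x : C) → x < b → k ≤ ℓ → Rk Q X (r0 * exp2 (e * (s r * K))) k x → Σ C (λ X' → Σ C (λ h → Sub X' X k x × ((Fine X' × NoDup X') × (InjB h X' (exp2 (e * (s r * K))) × Rk Q X' (s r) k x))))
          step r ih X k x p q m =
            let (X' , h , sub , fn , ib , rk , nds) = inner r (r * K) start K ≤r X k x p q (subst (λ t → Rk Q X (r0 * exp2 (e * t)) k x) (s* r K) m) in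
            X' , h , sub , fn , subst (λ t → InjB h X' (exp2 (e * t))) (sym (s* r K)) ib , Rk-fold p q (Rk-leaf rk) (λ n mn → nds n mn (Q<K n mn))
            where
            start : (X : C) → (k : C) → (x : C) → x < b → k ≤ ℓ → Rk Q X (r0 * exp2 (e * ((r * K) + z))) k x → Σ C (λ X' → Σ C (λ h → Sub X' X k x × ((Fine X' × NoDup X') × (InjB h X' (exp2 (e * ((r * K) + z))) × (Rk Q X' r k x × ((n : C) → Mem n Q → n < z → HN r X' k x n))))))
            start X k x p q m = let (X' , h , sub , fn , ib , rk) = ih X k x p q (subst (λ t → Rk Q X (r0 * exp2 (e * t)) k x) (+0 (r * K)) m) in
              X' , h , sub , fn , subst (λ t → InjB h X' (exp2 (e * t))) (sym (+0 (r * K))) ib , rk , λ n mn l → ⊥-elim (x≮0 l)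

  -- Closure properties of the cut, overspill, and the ambient tree.

  module Cut (J : C → Set) (cut : IsCut M J) (expc : ExpClosed M J) where
    J0 : J z
    J0 = IsCut.zero∈ cut

    J≤ : ∀ {x y} → x ≤ y → J y → J x
    J≤ {x} l j with cases x
    ... | inj₁ refl = J0
    ... | inj₂ (x' , refl) = IsCut.closed cut x' _ (<⇒≤ l) j

    Js : ∀ {x} → J x → J (s x)
    Js j = IsCut.closed cut _ _ ≤r j

    J<∉ : ∀ {x y} → J x → ¬ J y → x < y
    J<∉ j n = ≰⇒> (λ l → n (J≤ l j))

    -- The relation is definable, so induction in M shows that it contains `u` with `exp2 u` for all
    -- `u` up to `a`; at `a` it is single-valued.
    pow-exp : ∀ a x → IsPow2 M a x → x ≡ exp2 a
    pow-exp a x (n , ψ , ρ , R0 , Rs , uniq , Ra) = uniq a x (exp2 a) ≤r Ra (all' a ≤r)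
      where
      Rel : C → C → Set
      Rel u v = SatL M ψ (u ∷ (v ∷ ρ))
      dR : Dfn 2 (λ σ → Rel (σ zero) (σ (suc zero)))
      dR = dfn n ψ ρ (λ σ → (λ p → p) , (λ p → p))
      dR' : Dfn 1 (λ σ → σ zero ≤ a → Rel (σ zero) (exp2 (σ zero)))
      dR' = D→ (D≤ (DFvar zero) (DFcon a)) (rel2 {R = Rel} dR (DFvar zero) (DFexp (DFvar zero)))
      all' : ∀ u → u ≤ a → Rel u (exp2 u)
      all' = ind (λ u → u ≤ a → Rel u (exp2 u)) dR' (λ _ → subst (Rel z) (sym exp0) R0)
        (λ u ih l → subst (Rel (s u)) (sym (exps u)) (Rs u (exp2 u) (<⇒≤ l , <≢ l) (ih (<⇒≤ l))))

    Jexp : ∀ {x} → J x → J (exp2 x)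
    Jexp {x} j = let (y , p , jy) = expc x j in subst J (pow-exp x y p) jy

    dbl : ∀ x → x + x ≤ exp2 (s x)
    dbl x = ≤t (+mono (<⇒≤ (x<exp x)) (<⇒≤ (x<exp x))) (≡⇒≤ (sym (exps x)))

    J+ : ∀ {x y} → J x → J y → J (x + y)
    J+ {x} {y} jx jy with ≤⊎< x y
    ... | inj₁ l = J≤ (≤t (+mono l ≤r) (dbl y)) (Jexp (Js jy))
    ... | inj₂ l = J≤ (≤t (+mono ≤r (<⇒≤ l)) (dbl x)) (Jexp (Js jx))

    J* : ∀ {x y} → J x → J y → J (x * y)
    J* {x} {y} jx jy = J≤ (≤t (*mono (<⇒≤ (x<exp x)) (<⇒≤ (x<exp y))) (≡⇒≤ (sym (exp+ x y)))) (Jexp (J+ jx jy))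

    J1 : J (s z)
    J1 = Js J0

    J3 : J c3
    J3 = Js (Js (Js J0))

    opaque
      -- Overspill for a cut that has no definition. The witness is the predecessor of the least `l`
      -- with `r < G l`: if it were in J, then so would be `l`, hence `G l` and `r`. If there is no
      -- such `l`, then `r` itself will do.
      shrink : (G : C → C) → DF 1 (λ ρ → G (ρ zero)) → (∀ x → J x → J (G x)) → ∀ r → ¬ J r → Σ C (λ l → ¬ J l × G l ≤ r)
      shrink G d cl r nr = cs (lem (Σ C (λ l → r < G l)))
        where
        cs : Σ C (λ l → r < G l) ⊎ ¬ Σ C (λ l → r < G l) → Σ C (λ l → ¬ J l × G l ≤ r)
        cs (inj₂ n) = r , nr , ≮⇒≥ (λ l → n (r , l))
        cs (inj₁ (l , h)) = fin (lnp (λ l → r < G l) (D< (DFcon r) (fun1 {F = G} (DF.graph d) (DFvar zero))) l h)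
          where
          fin : Σ C (Least (λ l → r < G l)) → Σ C (λ l → ¬ J l × G l ≤ r)
          fin (m , p , least) = pr (cases m)
            where
            pr : (m ≡ z) ⊎ Σ C (λ m' → m ≡ s m') → Σ C (λ l → ¬ J l × G l ≤ r)
            pr (inj₁ refl) = ⊥-elim (nr (J≤ (<⇒≤ p) (cl z J0)))
            pr (inj₂ (m' , refl)) = m' , (λ j → nr (J≤ (<⇒≤ p) (cl (s m') (Js j)))) , ≮⇒≥ (least m' <s)

  -- The full tree with r levels of each of the types below K.
  module Ambient (r₀ K : C) (K>0 : z < K) where
    ℓ : C
    ℓ = r₀ * K

    opaque
      τcode : Σ C (λ τ → (k : C) → k < ℓ → dec τ k < K × Σ C (λ q → k ≡ K * q + dec τ k))
      τcode = code-rel ℓ (λ k n → n < K × Σ C (λ q → k ≡ K * q + n)) (D× (D< (DFvar _) (DFcon _)) (D∃ (D≡ (DFvar _) (DF⊕ (DF⊗ (DFcon _) (DFvar _)) (DFvar _)))))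
        (λ k _ → let (q , n , e , l) = divmod K K>0 k in n , l , q , e)

    τ : C
    τ = proj₁ τcode

    τ-spec : ∀ {k q n} → k < ℓ → n < K → k ≡ K * q + n → dec τ k ≡ n
    τ-spec {k} {q} {n} l ln e = let (l' , q' , e') = proj₂ τcode k l in proj₂ (div-unique l' ln (trans (sym e') e))

    Legit : C → Set
    Legit x = (k : C) → k < ℓ → dec x k < dec τ k + c3

    opaque
      change : ∀ x i j → Σ C (λ y → ((t : C) → t < ℓ → t ≢ i → dec y t ≡ dec x t) × (i < ℓ → dec y i ≡ j))
      change x i j = let (y , h) = cd in y , (λ t l ne → away y t ne (h t l)) , λ l → here y (h i l)
        where
        cd : Σ C (λ y → (t : C) → t < ℓ → ((t ≡ i) × (dec y t ≡ j)) ⊎ ((t ≢ i) × (dec y t ≡ dec x t)))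
        cd = code-rel ℓ (λ t v → ((t ≡ i) × (v ≡ j)) ⊎ ((t ≢ i) × (v ≡ dec x t))) (D⊎ (D× (D≡ (DFvar _) (DFcon _)) (D≡ (DFvar _) (DFcon _))) (D× (D≢ (DFvar _) (DFcon _)) (D≡ (DFvar _) (DFdec (DFcon _) (DFvar _))))) (λ t _ → tot t (lem (t ≡ i)))
          where
          tot : ∀ t → (t ≡ i) ⊎ ¬ (t ≡ i) → Σ C (λ v → ((t ≡ i) × (v ≡ j)) ⊎ ((t ≢ i) × (v ≡ dec x t)))
          tot t (inj₁ p) = j , inj₁ (p , refl)
          tot t (inj₂ p) = dec x t , inj₂ (p , refl)
        away : ∀ y t → t ≢ i → ((t ≡ i) × (dec y t ≡ j)) ⊎ ((t ≢ i) × (dec y t ≡ dec x t)) → dec y t ≡ dec x t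
        away y t ne (inj₁ (p , _)) = ⊥-elim (ne p)
        away y t ne (inj₂ (_ , q)) = q
        here : ∀ y → ((i ≡ i) × (dec y i ≡ j)) ⊎ ((i ≢ i) × (dec y i ≡ dec x i)) → dec y i ≡ j
        here y (inj₁ (_ , q)) = q
        here y (inj₂ (p , _)) = ⊥-elim (p refl)

    opaque
      -- The definition of `dec` gives no bound on a code in terms of its digits. Collection gives
      -- one, level by level: it ranges over the pairs of a code for the earlier digits, below the
      -- previous bound, and a next digit.
      bounded-codes : Σ C (λ B → (x : C) → Legit x → Σ C (λ y → y < B × agree ℓ x y))
      bounded-codes = ind (λ i → i ≤ ℓ → Σ C (λ B → (x : C) → ((k : C) → k < ℓ → dec x k < dec τ k + c3) → Σ C (λ y → y < B × agree i x y))) (D→ (D≤ (DFvar _) (DFcon _)) (D∃ (D∀ (D→ (D∀ (D→ (D< (DFvar _) (DFcon _)) (D< (DFdec (DFvar _) (DFvar _)) (DF⊕ (DFdec (DFcon _) (DFvar _)) (DFcon _))))) (D∃ (D× (D< (DFvar _) (DFvar _)) (D-agree (DFvar _) (DFvar _) (DFvar _))))))))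
          (λ _ → s z , λ x _ → z , <s , λ i p → ⊥-elim (x≮0 p)) step ℓ ≤r
        where
        step : ∀ i → (i ≤ ℓ → Σ C (λ B → (x : C) → Legit x → Σ C (λ y → y < B × agree i x y))) → s i ≤ ℓ → Σ C (λ B → (x : C) → Legit x → Σ C (λ y → y < B × agree (s i) x y))
        step i ih l = fin (ih (<⇒≤ l))
          where
          fin : Σ C (λ B → (x : C) → Legit x → Σ C (λ y → y < B × agree i x y)) → Σ C (λ B → (x : C) → Legit x → Σ C (λ y → y < B × agree (s i) x y))
          fin (B , h) = proj₁ cl , go
            where
            D : C
            D = K + c3
            cl : Σ C (λ B' → (w : C) → w < s (pair B D) → Σ C (λ y' → y' < B' × ((y : C) → (j : C) → w ≡ pair y j → agree i y y' × (dec y' i ≡ j))))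
            cl = coll (s (pair B D)) (λ w y' → (y : C) → (j : C) → w ≡ pair y j → agree i y y' × (dec y' i ≡ j)) (D∀ (D∀ (D→ (D≡ (DFvar _) (DFpair (DFvar _) (DFvar _))) (D× (D-agree (DFcon _) (DFvar _) (DFvar _)) (D≡ (DFdec (DFvar _) (DFcon _)) (DFvar _)))))) (λ w _ → tot w (lem _))
              where
              tot : ∀ w → Σ C (λ y → Σ C (λ j → w ≡ pair y j)) ⊎ ¬ Σ C (λ y → Σ C (λ j → w ≡ pair y j)) → Σ C (λ y' → (y : C) → (j : C) → w ≡ pair y j → agree i y y' × (dec y' i ≡ j))
              tot w (inj₂ n) = z , λ y j e → ⊥-elim (n (y , j , e))
              tot w (inj₁ (y , j , e)) = let (y' , p , q) = change y i j in y' , λ y₁ j₁ e₁ →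
                let (a , c) = pair-inj (trans (sym e₁) e) in
                (λ t lt → trans (cong (λ v → dec v t) a) (sym (p t (<t lt l) (<≢ lt)))) , trans (q l) (sym c)
            go : ∀ x → Legit x → Σ C (λ y → y < proj₁ cl × agree (s i) x y)
            go x lx = let (y , ly , ay) = h x lx
                          small = s≤s (+mono (*mono (+mono (<⇒≤ ly) (dlt x lx)) (+mono (<⇒≤ ly) (dlt x lx))) (<⇒≤ ly))
                          (y' , ly' , sp) = proj₂ cl (pair y (dec x i)) small
                          (a , d) = sp y (dec x i) refl
                      in y' , ly' , agree-s (agree-trans ay a) (sym d)
              where
              dlt : ∀ x → Legit x → dec x i ≤ D
              dlt x lx = <⇒≤ (<≤t (lx i l) (+mono (<⇒≤ (proj₁ (proj₂ τcode i l))) ≤r))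

    b : C
    b = proj₁ bounded-codes

    opaque
      Acode : Σ C (λ A → (y : C) → (Mem y A → y < b × Legit y) × (y < b × Legit y → Mem y A))
      Acode = comp b (λ y → (k : C) → k < ℓ → dec y k < dec τ k + c3) (D∀ (D→ (D< (DFvar _) (DFcon _)) (D< (DFdec (DFvar _) (DFvar _)) (DF⊕ (DFdec (DFcon _) (DFvar _)) (DFcon _)))))

    A : C
    A = proj₁ Acode

    opaque
      Qcode : Σ C (λ Q → (n : C) → (Mem n Q → n < K × (n ≡ n)) × (n < K × (n ≡ n) → Mem n Q))
      Qcode = comp K (λ n → n ≡ n) (D≡ (DFvar _) (DFvar _))

    Q₀ : C
    Q₀ = proj₁ Qcode

    inQ : ∀ {n} → n < K → Mem n Q₀
    inQ l = proj₂ (proj₂ Qcode _) (l , refl)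

    canon : ∀ x → Legit x → Σ C (λ y → Mem y A × agree ℓ x y)
    canon x lx = let (y , l , a) = proj₂ bounded-codes x lx in
      y , proj₂ (proj₂ Acode y) (l , λ k lk → subst (_< dec τ k + c3) (a k lk) (lx k lk)) , a

    open Tree ℓ b τ

    A<b : ∀ {y} → Mem y A → y < b
    A<b m = proj₁ (proj₁ (proj₂ Acode _) m)

    opaque
      -- The types repeat with period `K`, so the next `K` levels contain every type below `K`, and
      -- each unit of rank uses up `K` levels.
      full-rank : ∀ r k x → Mem x A → k + r * K ≤ ℓ → Rk Q₀ A r k x
      full-rank = ind (λ r → (k : C) → (x : C) → Mem x A → k + r * K ≤ ℓ → Rk Q₀ A r k x) (D∀ (D∀ (D→ (D-Mem (DFvar _) (DFcon _)) (D→ (D≤ (DF⊕ (DFvar _) (DF⊗ (DFvar _) (DFcon _))) (DFcon _)) (D-Rk (DFcon _) (DFvar _) (DFvar _) (DFvar _))))))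
          (λ k x mx _ → Rk-zero (x , mx , agree-refl)) step
        where
        step : ∀ r → ((k : C) → (x : C) → Mem x A → k + r * K ≤ ℓ → Rk Q₀ A r k x) → (k : C) → (x : C) → Mem x A → k + s r * K ≤ ℓ → Rk Q₀ A (s r) k x
        step r ih k x mx l = Rk-fold (A<b mx) (≤t (≤+ _) l) (x , mx , agree-refl) λ n mn → node n (proj₁ (proj₁ (proj₂ Qcode n) mn))
          where
          find : ∀ n → n < K → Σ C (λ k' → (k ≤ k' × k' < k + K) × Σ C (λ q → k' ≡ K * q + n))
          find n ln = fin (divmod K K>0 k)
            where
            fin : Σ C (λ q → Σ C (λ m → (k ≡ K * q + m) × m < K)) → Σ C (λ k' → (k ≤ k' × k' < k + K) × Σ C (λ q → k' ≡ K * q + n))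
            fin (q , m , e , lm) = cs (≤⊎< m n)
              where
              cs : m ≤ n ⊎ n < m → Σ C (λ k' → (k ≤ k' × k' < k + K) × Σ C (λ q → k' ≡ K * q + n))
              cs (inj₁ h) = K * q + n , (≤t (≡⇒≤ e) (+mono (≤r {K * q}) h) ,
                ≤t (≡⇒≤ (sym (+s (K * q) n))) (+mono (≤t (≤+ m) (≡⇒≤ (sym e))) ln)) , q , refl
              cs (inj₂ h) = K * s q + n , (≤t (≡⇒≤ e) (≤t (+mono (≤r {K * q}) (<⇒≤ lm)) (≤t (≡⇒≤ (sym (*s K q))) (≤+ n))) ,
                ≤t (≡⇒≤ (trans (sym (+s (K * s q) n)) (trans (cong (_+ s n) (*s K q)) (trans (+a (K * q) K (s n)) (trans (cong (K * q +_) (+c K (s n))) (sym (+a (K * q) (s n) K)))))))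
                  (+mono (≤t (+mono (≤r {K * q}) h) (≡⇒≤ (sym e))) ≤r)) , s q , refl
          node : ∀ n → n < K → HasNode (Rk Q₀ A r) k x n
          node n ln = fin (find n ln)
            where
            fin : Σ C (λ k' → (k ≤ k' × k' < k + K) × Σ C (λ q → k' ≡ K * q + n)) → HasNode (Rk Q₀ A r) k x n
            fin (k' , (k≤k' , k'<) , q , e) = k' , x , A<b mx , k≤k' , k'<ℓ , agree-refl , tk , kid
              where
              kK : k + K + r * K ≤ ℓ
              kK = ≤t (≡⇒≤ (trans (+a k K (r * K)) (cong (k +_) (trans (+c K (r * K)) (sym (s* r K)))))) l
              k'<ℓ : k' < ℓ
              k'<ℓ = <≤t k'< (≤t (≤+ (r * K)) kK)
              tk : dec τ k' ≡ n
              tk = τ-spec k'<ℓ ln e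
              kid : ∀ j → j < n + c3 → Σ C (λ y' → (y' < b) × (agree k' x y' × ((dec y' k' ≡ j) × Rk Q₀ A r (s k') y')))
              kid j lj = let (u , p , q') = change x k' j
                             lu : Legit u
                             lu t lt = cs u p q' t lt (lem (t ≡ k'))
                             (y' , my' , ay') = canon u lu
                         in y' , A<b my' , (λ t lt → trans (sym (p t (<t lt k'<ℓ) (<≢ lt))) (ay' t (<t lt k'<ℓ))) ,
                            trans (sym (ay' k' k'<ℓ)) (q' k'<ℓ) , ih (s k') y' my' (≤t (+mono k'< (≤r {r * K})) kK)
                where
                cs : ∀ u → ((t : C) → t < ℓ → t ≢ k' → dec u t ≡ dec x t) → (k' < ℓ → dec u k' ≡ j) → ∀ t → t < ℓ → (t ≡ k') ⊎ ¬ (t ≡ k') → dec u t < dec τ t + c3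
                cs u p q' t lt (inj₁ refl) = ≤t (≡⇒≤ (cong s (q' lt))) (≤t lj (≡⇒≤ (cong (_+ c3) (sym tk))))
                cs u p q' t lt (inj₂ ne) = ≤t (≡⇒≤ (cong s (p t lt ne))) (proj₂ (proj₁ (proj₂ Acode x) mx) t lt)

    opaque
      root : Σ C (λ x → Mem x A)
      root = let (u , h) = code ℓ (λ _ → z) DFz
                 (y , m , _) = canon u (λ k l → ≤t (≡⇒≤ (cong s (h k l))) (≤t (s≤s 0≤) (≤+' (dec τ k))))
             in y , m

    start : Rk Q₀ A r₀ z (proj₁ root)
    start = full-rank r₀ z (proj₁ root) (proj₂ root) (≡⇒≤ (0+ ℓ))

  -- Forcing conditions and the steps that strengthen them.

  module Forcing (J : C → Set) (cut : IsCut M J) (expc : ExpClosed M J) (I : ℕ → Set) where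
    open Cut J cut expc public

    w₀ : C
    w₀ = proj₁ (IsCut.proper cut)
    w₀∉ : ¬ J w₀
    w₀∉ = proj₂ (IsCut.proper cut)

    >0 : ∀ {x} → ¬ J x → z < x
    >0 n = ≢0⇒0< (λ { refl → n J0 })

    -- One element above J serves twice: as the rank of the full tree, which makes it a condition,
    -- and as the number of types, which leaves room for all types coming from I.
    open Ambient w₀ w₀ (>0 w₀∉) public
    open Ramsey ℓ b τ public

    Jnum : ∀ k → J (num M k)
    Jnum zero = J0
    Jnum (suc k) = Js (Jnum k)

    -- Type 0 keeps conditions nontrivial; the element k of I is coded by the type k + 1.
    InI : C → Set
    InI t = (t ≡ z) ⊎ Σ ℕ (λ k → I k × (t ≡ num M (suc k)))

    InI-J : ∀ {t} → InI t → J t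
    InI-J (inj₁ refl) = J0
    InI-J (inj₂ (k , _ , refl)) = Jnum (suc k)

    x₀ : C
    x₀ = proj₁ root
    x₀<b : x₀ < b
    x₀<b = A<b (proj₂ root)

    -- The types coming from I need not form a coded set; `Q` is a coded set around them that
    -- shrinks as conditions get stronger. At level `z` every leaf names the root, so the choice of
    -- `x₀` does not matter.
    record Cond : Set where
      constructor cond
      field
        X Q r : C
        X⊆A   : X ⊆ A
        rk    : Rk Q X r z x₀
        r∉    : ¬ J r
        I⊆Q   : ∀ t → InI t → Mem t Q
    open Cond public

    infix 4 _⊑_
    _⊑_ : Cond → Cond → Set
    c' ⊑ c = (X c' ⊆ X c) × (Q c' ⊆ Q c)

    ⊑-refl : ∀ {c} → c ⊑ c
    ⊑-refl = (λ y m → m) , (λ y m → m)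

    ⊑-trans : ∀ {a c d} → a ⊑ c → c ⊑ d → a ⊑ d
    ⊑-trans (p , q) (p' , q') = (λ y m → p' y (p y m)) , (λ y m → q' y (q y m))

    mk : ∀ c {Y l} → Y ⊆ X c → Rk (Q c) Y l z x₀ → ¬ J l → Cond
    mk c {Y} {l} sub m n = cond Y (Q c) l (λ y my → X⊆A c y (sub y my)) m n (I⊆Q c)

    mk-⊑ : ∀ c {Y l} (sub : Y ⊆ X c) (m : Rk (Q c) Y l z x₀) (n : ¬ J l) → mk c sub m n ⊑ c
    mk-⊑ c sub m n = sub , (λ y my → my)

    c₀ : Cond
    c₀ = cond A Q₀ w₀ (λ y m → m) start w₀∉ (λ t i → inQ (J<∉ (InI-J i) w₀∉))

    Decides : C → C → Set
    Decides w Y = (∀ y → Mem y Y → Mem y w) ⊎ (∀ y → Mem y Y → ¬ Mem y w)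

    Injective : C → C → Set
    Injective f Y = ∀ y v → Mem y Y → Mem v Y → dec f y ≡ dec f v → y ≡ v

    ConstOn : C → C → Set
    ConstOn f Y = Σ C (Const f Y)

    LargeOn : C → C → Set
    LargeOn f Y = Σ C (λ l → ¬ J l × (∀ y → Mem y Y → l ≤ dec f y))

    step-decide : ∀ c w → Σ Cond (λ c' → c' ⊑ c × Decides w (X c'))
    step-decide c w = fin (shrink (λ x → x + x) (DF⊕ (DFvar _) (DFvar _)) (λ x j → J+ j j) (r c) (r∉ c))
      where
      fin : Σ C (λ l → ¬ J l × l + l ≤ r c) → Σ Cond (λ c' → c' ⊑ c × Decides w (X c'))
      fin (l , nl , le') = go (splitP {r₁ = l} {r₂ = l} (λ y → Mem y w) (D-Mem (DFvar _) (DFcon _)) x₀<b 0≤ (Rk-≤ x₀<b 0≤ le' (rk c)))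
        where
        go : Piece (Q c) (X c) (λ y → Mem y w) l z x₀ ⊎ Piece (Q c) (X c) (λ y → ¬ Mem y w) l z x₀ → Σ Cond (λ c' → c' ⊑ c × Decides w (X c'))
        go (inj₁ (Y , (sub , h) , m)) = mk c sub m nl , mk-⊑ c sub m nl , inj₁ h
        go (inj₂ (Y , (sub , h) , m)) = mk c sub m nl , mk-⊑ c sub m nl , inj₂ h

    step-large : ∀ c f → Σ Cond (λ c' → c' ⊑ c × (ConstOn f (X c') ⊎ LargeOn f (X c')))
    step-large c f = fin (shrink (λ x → x * x + x) (DF⊕ (DF⊗ (DFvar _) (DFvar _)) (DFvar _)) (λ x j → J+ (J* j j) j) (r c) (r∉ c))
      where
      fin : Σ C (λ l → ¬ J l × l * l + l ≤ r c) → Σ Cond (λ c' → c' ⊑ c × (ConstOn f (X c') ⊎ LargeOn f (X c')))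
      fin (l , nl , le') = go (const-or-large {f = f} {c = l} x₀<b 0≤ (Rk-≤ x₀<b 0≤ le' (rk c)))
        where
        go : Monochrome (Q c) (X c) f l z x₀ ⊎ Piece (Q c) (X c) (λ y → l ≤ dec f y) l z x₀ → Σ Cond (λ c' → c' ⊑ c × (ConstOn f (X c') ⊎ LargeOn f (X c')))
        go (inj₁ (a , Y , (sub , h) , m)) = mk c sub m nl , mk-⊑ c sub m nl , inj₁ (a , h)
        go (inj₂ (Y , (sub , h) , m)) = mk c sub m nl , mk-⊑ c sub m nl , inj₂ (l , nl , h)

    -- Deciding all sections with index below some `k` outside J takes care of every index in J
    -- without mentioning J in M.
    CodOn : C → C → Set
    CodOn g Y = Σ C (λ k → ¬ J k × (∀ a → a < k → Decided g Y a))

    step-cod : ∀ c g → Σ Cond (λ c' → c' ⊑ c × CodOn g (X c'))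
    step-cod c g = fin (shrink (λ x → x * exp2 x) (DF⊗ (DFvar _) (DFexp (DFvar _))) (λ x j → J* j (Jexp j)) (r c) (r∉ c))
      where
      fin : Σ C (λ l → ¬ J l × l * exp2 l ≤ r c) → Σ Cond (λ c' → c' ⊑ c × CodOn g (X c'))
      fin (l , nl , le') = let (Y , (sub , h) , m) = decide-many {g = g} x₀<b 0≤ l (X c) (Rk-≤ x₀<b 0≤ le' (rk c))
                           in mk c sub m nl , mk-⊑ c sub m nl , l , nl , h

    opaque
      below : ∀ Q l → Σ C (λ Q' → (n : C) → (Mem n Q' → Mem n Q × n < l) × (Mem n Q × n < l → Mem n Q'))
      below Q l = filt Q (λ n → n < l) (D< (DFvar _) (DFcon _))

    module Injectivity (Q₁ X₁ f l : C) (l>0 : z < l) (Q<l : ∀ n → Mem n Q₁ → n < l)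
      (noConst : ¬ Σ C (λ Y → Σ C (λ a → (Y ⊆ X₁ × Const f Y a) × Rk Q₁ Y l z x₀))) where
      -- The restriction to `X₁` is there because `noConst` speaks of subsets of `X₁` only, whereas
      -- the relation must be attainable for arbitrary sets of large rank.
      Al : C → C → Set
      Al V W = (x : C) → (y : C) → Mem x V → Mem y W → Mem x X₁ → Mem y X₁ → dec f x ≢ dec f y

      dAl : Dfn 2 (λ ρ → Al (ρ zero) (ρ (suc zero)))
      dAl = D∀ (D∀ (D→ (D-Mem (DFvar _) (DFvar _)) (D→ (D-Mem (DFvar _) (DFvar _)) (D→ (D-Mem (DFvar _) (DFcon _)) (D→ (D-Mem (DFvar _) (DFcon _)) (D≢ (DFdec (DFcon _) (DFvar _)) (DFdec (DFcon _) (DFvar _))))))))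

      eight : ∀ R → exp2 c3 * R ≡ (((R + R) + (R + R)) + ((R + R) + (R + R)))
      eight R = trans (cong (_* R) (trans (exps _) (trans (cong₂ _+_ e2 e2) refl))) (solve 1 (λ R → (((con 1 :+ con 1) :+ (con 1 :+ con 1)) :+ ((con 1 :+ con 1) :+ (con 1 :+ con 1))) :* R := ((R :+ R) :+ (R :+ R)) :+ ((R :+ R) :+ (R :+ R))) refl R)
        where
        e1 : exp2 (s z) ≡ o + o
        e1 = trans (exps z) (cong₂ _+_ exp0 exp0)
        e2 : exp2 (s (s z)) ≡ (o + o) + (o + o)
        e2 = trans (exps (s z)) (cong₂ _+_ e1 e1)

      Res : C → C → C → C → C → C → C → Set
      Res R V k x W k' x' = Σ C (λ V' → Σ C (λ W' → (V' ⊆ V × W' ⊆ W) × ((Rk Q₁ V' R k x × Rk Q₁ W' R k' x') × Al V' W')))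

      to0 : ∀ {Y R k x} → l ≤ R → x < b → k ≤ ℓ → Rk Q₁ Y R k x → Rk Q₁ Y l z x₀
      to0 lR p q m = Rk-lift x₀<b 0≤ 0≤ (λ i h → ⊥-elim (x≮0 h)) (Rk-≤ p q lR m)

      -- A factor 2 pays for cutting both sets along `X₁`, a factor 4 for `separate`. Pieces outside
      -- `X₁` are related vacuously. If `separate` leaves only equal values, then a piece of rank at
      -- least `l` is monochromatic, against `noConst`; hence `r0` has to be `l`.
      sepA : ∀ R → l ≤ R → ∀ V k x W k' x' → x < b → k ≤ ℓ → x' < b → k' ≤ ℓ → Rk Q₁ V (exp2 c3 * R) k x → Rk Q₁ W (exp2 c3 * R) k' x' → Res R V k x W k' x'
      sepA R lR V k x W k' x' p q p' q' mV mW = go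
          (splitP {r₁ = four} {r₂ = four} (λ y → Mem y X₁) (D-Mem (DFvar _) (DFcon _)) p q (subst (λ t → Rk Q₁ V t k x) (eight R) mV))
          (splitP {r₁ = four} {r₂ = four} (λ y → Mem y X₁) (D-Mem (DFvar _) (DFcon _)) p' q' (subst (λ t → Rk Q₁ W t k' x') (eight R) mW))
        where
        four : C
        four = (R + R) + (R + R)
        R≤4 : R ≤ four
        R≤4 = ≤t (≤+ R) (≤+ (R + R))
        go : Piece Q₁ V (λ y → Mem y X₁) four k x ⊎ Piece Q₁ V (λ y → ¬ Mem y X₁) four k x →
             Piece Q₁ W (λ y → Mem y X₁) four k' x' ⊎ Piece Q₁ W (λ y → ¬ Mem y X₁) four k' x' → Res R V k x W k' x'
        go (inj₂ (V' , (sV , hV) , mV')) _ = V' , W , (sV , (λ y my → my)) ,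
          (Rk-≤ p q R≤4 mV' , Rk-≤ p' q' (≤*' (exp2 c3) exp>0) mW) , λ u v mu mv mx _ _ → hV u mu mx
        go (inj₁ _) (inj₂ (W' , (sW , hW) , mW')) = V , W' , ((λ y my → my) , sW) ,
          (Rk-≤ p q (≤*' (exp2 c3) exp>0) mV , Rk-≤ p' q' R≤4 mW') , λ u v mu mv _ my _ → hW v mv my
        go (inj₁ (V' , (sV , hV) , mV')) (inj₁ (W' , (sW , hW) , mW')) = fin (separate {r = R} {f = f} p q p' q' mV' mW')
          where
          fin : Separated {Q₁} {R} {f} V' k x W' k' x' → Res R V k x W k' x'
          fin (V'' , W'' , (sV' , sW') , (mV'' , mW'') , t) = V'' , W'' , ((λ y my → sV y (sV' y my)) , (λ y my → sW y (sW' y my))) , (mV'' , mW'') , al t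
            where
            al : Tri f V'' W'' → Al V'' W''
            al (inj₁ h) u v mu mv _ _ e = <≢ (h u v mu mv) e
            al (inj₂ (inj₁ h)) u v mu mv _ _ e = <≢ (h u v mu mv) (sym e)
            al (inj₂ (inj₂ h)) = let (w , mw , _) = Rk-leaf mW'' in
              ⊥-elim (noConst (V'' , dec f w , ((λ y my → hV y (sV' y my)) , λ y my → h y w my mw) , to0 lR p q mV''))

      module AL = Align ℓ b τ Q₁ l l c3 Al dAl (λ p q h x y mx my → h x y (p x mx) (q y my)) (λ h x y mx my ix iy e → h y x my mx iy ix (sym e)) sepA l>0 Q<l

      injective : Rk Q₁ X₁ (l * exp2 (AL.e * (l * l))) z x₀ → Σ C (λ Y → (Y ⊆ X₁ × Injective f Y) × Rk Q₁ Y l z x₀)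
      injective m = fin (AL.align l X₁ z x₀ x₀<b 0≤ m)
        where
        fin : Σ C (AL.Aligned l X₁ z x₀) → Σ C (λ Y → (Y ⊆ X₁ × Injective f Y) × Rk Q₁ Y l z x₀)
        fin (Y , sub , (fine , nodup) , _ , rk') = Y , ((λ y my → proj₁ (sub y my)) , inj) , rk'
          where
          inj : Injective f Y
          inj y v my mv e = dne λ ne → contra (¬∀⇒∃ (λ h → ne (nodup y v my mv h)))  ne
            where
            contra : Σ C (λ i → ¬ (i < ℓ → dec y i ≡ dec v i)) → y ≢ v → ⊥
            contra (i , ni) ne = k (lnp (λ i → i < ℓ × (dec y i ≢ dec v i)) (D× (D< (DFvar _) (DFcon _)) (D≢ (DFdec (DFcon _) (DFvar _)) (DFdec (DFcon _) (DFvar _)))) i (dne (λ h → ni (λ l' → dne (λ d → h (l' , d))))))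
              where
              k : Σ C (Least (λ i → i < ℓ × (dec y i ≢ dec v i))) → ⊥
              k (κ , (κ<ℓ , d) , least) =
                let (V , hV) = filt Y (λ u → agree (s κ) y u) (D-agree (DFcon _) (DFcon _) (DFvar _))
                    (W , hW) = filt Y (λ u → agree (s κ) v u) (D-agree (DFcon _) (DFcon _) (DFvar _))
                    ag = λ t lt → dne (λ h → least t lt (<t lt κ<ℓ , h))
                in proj₂ (fine y v κ my mv κ<ℓ ag d) V W (λ u mu → proj₁ (hV u) mu) (λ u mu → proj₁ (hW u) mu)
                     y v (proj₂ (hV y) (my , agree-refl)) (proj₂ (hW v) (mv , agree-refl)) (proj₁ (sub y my)) (proj₁ (sub v mv)) e

    -- The price of alignment grows with the types. Those that must stay lie in J, so `Q` can be cut
    -- off at any `l` outside J.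
    withTypes : ∀ c l → ¬ J l → Cond
    withTypes c l nl = cond (X c) (proj₁ (below (Q c) l)) (r c) (X⊆A c) (Rk-types x₀<b 0≤ (λ n m → proj₁ (proj₁ (proj₂ (below (Q c) l) n) m)) (rk c)) (r∉ c)
      (λ t i → proj₂ (proj₂ (below (Q c) l) t) (I⊆Q c t i , J<∉ (InI-J i) nl))

    withTypes-⊑ : ∀ c l nl → withTypes c l nl ⊑ c
    withTypes-⊑ c l nl = (λ y m → m) , λ n m → proj₁ (proj₁ (proj₂ (below (Q c) l) n) m)

    step-inj : ∀ c f → Σ Cond (λ c' → c' ⊑ c × (ConstOn f (X c') ⊎ Injective f (X c')))
    -- This is the rank that `align` asks for when `r0`, `K` and `r` are all `x` and `eS` is 3.
    step-inj c f = fin (shrink (λ x → x * exp2 ((s (c3 * ((x + c3) * (x + c3))) + (x + c3)) * (x * x))) (DF⊗ (DFvar _) (DFexp (DF⊗ (DF⊕ (DFs (DF⊗ (DFcon _) (DF⊗ (DF⊕ (DFvar _) (DFcon _)) (DF⊕ (DFvar _) (DFcon _))))) (DF⊕ (DFvar _) (DFcon _))) (DF⊗ (DFvar _) (DFvar _)))))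
        (λ x j → J* j (Jexp (J* (J+ (Js (J* J3 (J* (J+ j J3) (J+ j J3)))) (J+ j J3)) (J* j j)))) (r c) (r∉ c))
      where
      fin : Σ C (λ l → ¬ J l × l * exp2 ((s (c3 * ((l + c3) * (l + c3))) + (l + c3)) * (l * l)) ≤ r c) → Σ Cond (λ c' → c' ⊑ c × (ConstOn f (X c') ⊎ Injective f (X c')))
      fin (l , nl , le') = cs (lem _)
        where
        c1 : Cond
        c1 = withTypes c l nl
        NC : Set
        NC = Σ C (λ Y → Σ C (λ a → (Y ⊆ X c1 × Const f Y a) × Rk (Q c1) Y l z x₀))
        cs : NC ⊎ ¬ NC → Σ Cond (λ c' → c' ⊑ c × (ConstOn f (X c') ⊎ Injective f (X c')))
        cs (inj₁ (Y , a , (sub , h) , m)) = mk c1 sub m nl , ⊑-trans {mk c1 sub m nl} {c1} {c} (mk-⊑ c1 sub m nl) (withTypes-⊑ c l nl) , inj₁ (a , h)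
        cs (inj₂ n) = let (Y , (sub , h) , m) = Injectivity.injective (Q c1) (X c1) f l (>0 nl) (λ t mt → proj₂ (proj₁ (proj₂ (below (Q c) l) t) mt)) n
                                                  (Rk-≤ x₀<b 0≤ le' (rk c1))
                      in mk c1 sub m nl , ⊑-trans {mk c1 sub m nl} {c1} {c} (mk-⊑ c1 sub m nl) (withTypes-⊑ c l nl) , inj₂ h

    Full : C → C → Set
    Full X Q = ∀ y w κ → Mem y X → Mem w X → κ < ℓ → agree κ y w → dec y κ ≢ dec w κ →
      Mem (dec τ κ) Q × (∀ j → j < dec τ κ + c3 → Σ C (λ v → Mem v X × (agree κ y v × (dec v κ ≡ j))))

    Unique : C → Set
    Unique X = ∀ y w → Mem y X → Mem w X → agree ℓ y w → y ≡ w

    SmallIn : C → C → Set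
    SmallIn X B = Σ C (λ h → (∀ y → Mem y X → dec h y < B) × Injective h X)

    -- The order type of the functions dec (dec G u) between siblings depends only on the siblings.
    Stable : C → C → C → Set
    Stable G n X = ∀ u y w κ y' w' → u < n → Mem y X → Mem w X → κ < ℓ → agree κ y w → dec y κ ≢ dec w κ →
      Mem y' X → Mem w' X → agree (s κ) y y' → agree (s κ) w w' → dec (dec G u) y < dec (dec G u) w → dec (dec G u) y' < dec (dec G u) w'

    module Final (Q₁ G n l : C) (l>0 : z < l) (Q<l : ∀ t → Mem t Q₁ → t < l) where
      Al : C → C → Set
      Al V W = (t : C) → t < n → Tri (dec G t) V W

      dAl : Dfn 2 (λ ρ → Al (ρ zero) (ρ (suc zero)))
      dAl = D∀ (D→ (D< (DFvar _) (DFcon _)) (D-Tri (DFdec (DFcon _) (DFvar _)) (DFvar _) (DFvar _)))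

      -- One call of `separate` for each of the `n` functions, each at the factor 4.
      sepF : ∀ R → s z ≤ R → ∀ V k x W k' x' → x < b → k ≤ ℓ → x' < b → k' ≤ ℓ → Rk Q₁ V (exp2 (n + n) * R) k x → Rk Q₁ W (exp2 (n + n) * R) k' x' →
             Σ C (λ V' → Σ C (λ W' → (V' ⊆ V × W' ⊆ W) × ((Rk Q₁ V' R k x × Rk Q₁ W' R k' x') × Al V' W')))
      sepF R _ V₀ k x W₀ k' x' p q p' q' = main n V₀ W₀
        where
        T : C → C → C → Set
        T n V W = Σ C (λ V' → Σ C (λ W' → (V' ⊆ V × W' ⊆ W) × ((Rk Q₁ V' R k x × Rk Q₁ W' R k' x') × ((t : C) → t < n → Tri (dec G t) V' W'))))
        opaque
          main : ∀ n V W → Rk Q₁ V (exp2 (n + n) * R) k x → Rk Q₁ W (exp2 (n + n) * R) k' x' → T n V W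
          main = ind (λ n → (V : C) → (W : C) → Rk Q₁ V (exp2 (n + n) * R) k x → Rk Q₁ W (exp2 (n + n) * R) k' x' →
              Σ C (λ V' → Σ C (λ W' → (V' ⊆ V × W' ⊆ W) × ((Rk Q₁ V' R k x × Rk Q₁ W' R k' x') × ((t : C) → t < n → Tri (dec G t) V' W'))))) (D∀ (D∀ (D→ (D-Rk (DFvar _) (DF⊗ (DFexp (DF⊕ (DFvar _) (DFvar _))) (DFcon _)) (DFcon _) (DFcon _)) (D→ (D-Rk (DFvar _) (DF⊗ (DFexp (DF⊕ (DFvar _) (DFvar _))) (DFcon _)) (DFcon _) (DFcon _)) (D∃ (D∃ (D× (D× (D-⊆ (DFvar _) (DFvar _)) (D-⊆ (DFvar _) (DFvar _))) (D× (D× (D-Rk (DFvar _) (DFcon _) (DFcon _) (DFcon _)) (D-Rk (DFvar _) (DFcon _) (DFcon _) (DFcon _))) (D∀ (D→ (D< (DFvar _) (DFvar _)) (D-Tri (DFdec (DFcon _) (DFvar _)) (DFvar _) (DFvar _)))))))))))) base step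
            where
            e0 : exp2 (z + z) * R ≡ R
            e0 = trans (cong (_* R) (trans (cong exp2 (+0 z)) exp0)) (1* R)
            base : ∀ V W → Rk Q₁ V (exp2 (z + z) * R) k x → Rk Q₁ W (exp2 (z + z) * R) k' x' → T z V W
            base V W mV mW = V , W , ((λ y m → m) , (λ y m → m)) , (subst (λ t → Rk Q₁ V t k x) e0 mV , subst (λ t → Rk Q₁ W t k' x') e0 mW) , λ t lt → ⊥-elim (x≮0 lt)
            step : ∀ n → (∀ V W → Rk Q₁ V (exp2 (n + n) * R) k x → Rk Q₁ W (exp2 (n + n) * R) k' x' → T n V W) →
                   ∀ V W → Rk Q₁ V (exp2 (s n + s n) * R) k x → Rk Q₁ W (exp2 (s n + s n) * R) k' x' → T (s n) V W
            step n ih V W mV mW = fin (separate {r = R'} {f = dec G n} p q p' q' (subst (λ t → Rk Q₁ V t k x) e4 mV) (subst (λ t → Rk Q₁ W t k' x') e4 mW))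
              where
              R' : C
              R' = exp2 (n + n) * R
              e4 : exp2 (s n + s n) * R ≡ (R' + R') + (R' + R')
              e4 = trans (cong (_* R) (trans (cong exp2 (trans (+s (s n) n) (cong s (s+ n n)))) (trans (exps _) (cong₂ _+_ (exps (n + n)) (exps (n + n))))))
                    (trans (*d' R _ _) (cong₂ _+_ (*d' R _ _) (*d' R _ _)))
              fin : Separated {Q₁} {R'} {dec G n} V k x W k' x' → T (s n) V W
              fin (V1 , W1 , (sV , sW) , (mV1 , mW1) , tr) = fin2 (ih V1 W1 mV1 mW1)
                where
                fin2 : T n V1 W1 → T (s n) V W
                fin2 (V2 , W2 , (sV2 , sW2) , ms , tr2) = V2 , W2 , ((λ y m → sV y (sV2 y m)) , (λ y m → sW y (sW2 y m))) , ms , λ t lt → cs t (<s⇒ lt)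
                  where
                  cs : ∀ t → t < n ⊎ t ≡ n → Tri (dec G t) V2 W2
                  cs t (inj₁ lt) = tr2 t lt
                  cs t (inj₂ refl) = Tri-sub {dec G t} sV2 sW2 tr

      module AL = Align ℓ b τ Q₁ l (s z) (n + n) Al dAl (λ p q h t lt → Tri-sub {dec G t} p q (h t lt)) (λ h t lt → Tri-sym {dec G t} (h t lt)) sepF <s Q<l

      final : ∀ X₁ → Rk Q₁ X₁ (s z * exp2 (AL.e * (l * l))) z x₀ →
              Σ C (λ Y → (Y ⊆ X₁ × (Full Y Q₁ × (Unique Y × (SmallIn Y (exp2 (AL.e * (l * l))) × Stable G n Y)))) × Rk Q₁ Y l z x₀)
      final X₁ m = fin (AL.align l X₁ z x₀ x₀<b 0≤ m)
        where
        fin : Σ C (AL.Aligned l X₁ z x₀) → Σ C (λ Y → (Y ⊆ X₁ × (Full Y Q₁ × (Unique Y × (SmallIn Y (exp2 (AL.e * (l * l))) × Stable G n Y)))) × Rk Q₁ Y l z x₀)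
        fin (Y , sub , (fine , nodup) , (h , b1 , b2) , rk') = Y , ((λ y my → proj₁ (sub y my)) , (λ y w κ my mw lκ a d → proj₁ (fine y w κ my mw lκ a d)) , nodup , (h , b1 , b2) , st) , rk'
          where
          st : Stable G n Y
          st u y w κ y' w' lu my mw lκ a d my' mw' ay aw lt =
            let (V , hV) = filt Y (λ v → agree (s κ) y v) (D-agree (DFcon _) (DFcon _) (DFvar _))
                (W , hW) = filt Y (λ v → agree (s κ) w v) (D-agree (DFcon _) (DFcon _) (DFvar _))
                tr = proj₂ (fine y w κ my mw lκ a d) V W (λ v mv → proj₁ (hV v) mv) (λ v mv → proj₁ (hW v) mv) u lu
            in use tr (proj₂ (hV y) (my , agree-refl)) (proj₂ (hW w) (mw , agree-refl)) (proj₂ (hV y') (my' , ay)) (proj₂ (hW w') (mw' , aw))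
            where
            use : ∀ {V W} → Tri (dec G u) V W → Mem y V → Mem w W → Mem y' V → Mem w' W → dec (dec G u) y' < dec (dec G u) w'
            use (inj₁ h) m1 m2 m3 m4 = h y' w' m3 m4
            use (inj₂ (inj₁ h)) m1 m2 m3 m4 = ⊥-elim (<irr (<t lt (h y w m1 m2)))
            use (inj₂ (inj₂ h)) m1 m2 m3 m4 = ⊥-elim (<≢ lt (h y w m1 m2))

    step-final : ∀ c G n B → J n → ¬ J B → Σ Cond (λ c' → c' ⊑ c × (Full (X c') (Q c') × (Unique (X c') × (SmallIn (X c') B × Stable G n (X c')))))
    step-final c G n B Jn nB = fin (shrink (λ x → s z * exp2 ((s ((n + n) * ((x + c3) * (x + c3))) + (x + c3)) * (x * x))) (DF⊗ (DFcon _) (DFexp (DF⊗ (DF⊕ (DFs (DF⊗ (DFcon _) (DF⊗ (DF⊕ (DFvar _) (DFcon _)) (DF⊕ (DFvar _) (DFcon _))))) (DF⊕ (DFvar _) (DFcon _))) (DF⊗ (DFvar _) (DFvar _)))))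
        (λ x j → J* J1 (Jexp (J* (J+ (Js (J* (J+ Jn Jn) (J* (J+ j J3) (J+ j J3)))) (J+ j J3)) (J* j j)))) (proj₁ mn) (proj₁ (proj₂ mn)))
      where
      -- The smaller of the available rank and `B`: a price below it is affordable, and at the same
      -- time bounds the size of the new set by `B`.
      mn : Σ C (λ m → ¬ J m × (m ≤ r c × m ≤ B))
      mn with ≤⊎< (r c) B
      ... | inj₁ h = r c , r∉ c , ≤r , h
      ... | inj₂ h = B , nB , <⇒≤ h , ≤r
      Goal : Set
      Goal = Σ Cond (λ c' → c' ⊑ c × (Full (X c') (Q c') × (Unique (X c') × (SmallIn (X c') B × Stable G n (X c')))))
      fin : Σ C (λ l → ¬ J l × s z * exp2 ((s ((n + n) * ((l + c3) * (l + c3))) + (l + c3)) * (l * l)) ≤ proj₁ mn) → Goal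
      fin (l , nl , le') = go (Final.final (Q c1) G n l (>0 nl) (λ t mt → proj₂ (proj₁ (proj₂ (below (Q c) l) t) mt)) (X c1) (Rk-≤ x₀<b 0≤ (≤t le' (proj₁ (proj₂ (proj₂ mn)))) (rk c1)))
        where
        c1 : Cond
        c1 = withTypes c l nl
        E : C
        E = exp2 ((s ((n + n) * ((l + c3) * (l + c3))) + (l + c3)) * (l * l))
        E≤B : E ≤ B
        E≤B = ≤t (≤*' (s z) <s) (≤t le' (proj₂ (proj₂ (proj₂ mn))))
        go : Σ C (λ Y → (Y ⊆ X c1 × (Full Y (Q c1) × (Unique Y × (SmallIn Y E × Stable G n Y)))) × Rk (Q c1) Y l z x₀) → Goal
        go (Y , (sub , fl , un' , (h , b1 , b2) , st) , m) =
          cond Y (Q c1) l (λ y my → X⊆A c y (sub y my)) m nl (I⊆Q c1) , (sub , proj₂ (withTypes-⊑ c l nl)) , fl , un' , (h , (λ y my → <≤t (b1 y my) E≤B) , b2) , st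

    opaque
      without : ∀ Q t → Σ C (λ Q' → (n : C) → (Mem n Q' → Mem n Q × (n ≢ t)) × (Mem n Q × (n ≢ t) → Mem n Q'))
      without Q t = filt Q (λ n → n ≢ t) (D≢ (DFvar _) (DFcon _))

    -- Fewer types mean a weaker demand on the rank, so a removal is free.
    step-remove : ∀ c t → ¬ InI t → Σ Cond (λ c' → c' ⊑ c × ¬ Mem t (Q c'))
    step-remove c t nt = let (Q' , h) = without (Q c) t in
      cond (X c) Q' (r c) (X⊆A c) (Rk-types x₀<b 0≤ (λ n m → proj₁ (proj₁ (h n) m)) (rk c)) (r∉ c) (λ u i → proj₂ (h u) (I⊆Q c u i , λ { refl → nt i })) ,
      ((λ y m → m) , (λ n m → proj₁ (proj₁ (h n) m))) , λ m → proj₂ (proj₁ (h t) m) refl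

  -- Satisfaction in M as a definable predicate.

  DF-eval : ∀ {n m} (t : Term n) (f : Fin n → Env m → C) → (∀ i → DF m (f i)) → DF m (λ σ → eval M t (λ i → f i σ))
  DF-eval (Term.var i) f d = d i
  DF-eval 0ₜ f d = DFz
  DF-eval 1ₜ f d = DFo
  DF-eval (p +ₜ q) f d = DF⊕ (DF-eval p f d) (DF-eval q f d)
  DF-eval (p *ₜ q) f d = DF⊗ (DF-eval p f d) (DF-eval q f d)

  private
    ext : ∀ {n m} → (Fin n → Env m → C) → Fin (suc n) → Env (suc m) → C
    ext f zero σ = σ zero
    ext f (suc i) σ = f i (tail σ)

    ext-DF : ∀ {n m} (f : Fin n → Env m → C) → (∀ i → DF m (f i)) → ∀ i → DF (suc m) (ext f i)
    ext-DF f d zero = DFvar zero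
    ext-DF f d (suc i) = wkF (d i)

    ext-eq : ∀ {n m} (f : Fin n → Env m → C) (σ : Env (suc m)) i → (σ zero ∷ (λ i → f i (tail σ))) i ≡ ext f i σ
    ext-eq f σ zero = refl
    ext-eq f σ (suc i) = refl

  -- Variables are replaced by definable functions, because elements of the ultrapower are coded
  -- functions and satisfaction at a leaf has to be a definable property of the leaf.
  D-Sat : ∀ {n m} (φ : Fm false n) (f : Fin n → Env m → C) → (∀ i → DF m (f i)) → Dfn m (λ σ → SatL M φ (λ i → f i σ))
  D-Sat (p ≐ q) f d = D≡ (DF-eval p f d) (DF-eval q f d)
  D-Sat (p ≼ q) f d = D≤ (DF-eval p f d) (DF-eval q f d)
  D-Sat ⊥f f d = D⊥
  D-Sat (φ ⇒ ψ) f d = D→ (D-Sat φ f d) (D-Sat ψ f d)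
  D-Sat (φ ∧f ψ) f d = D× (D-Sat φ f d) (D-Sat ψ f d)
  D-Sat (φ ∨f ψ) f d = D⊎ (D-Sat φ f d) (D-Sat ψ f d)
  D-Sat (all φ) f d = D∀ {P = λ x σ → SatL M φ (x ∷ (λ i → f i σ))} (D-iff (λ σ → Sat-id φ (ext-eq f σ) , Sat-id φ (λ i → sym (ext-eq f σ i))) (D-Sat φ (ext f) (ext-DF f d)))
  D-Sat (ex φ) f d = D∃ {P = λ x σ → SatL M φ (x ∷ (λ i → f i σ))} (D-iff (λ σ → Sat-id φ (ext-eq f σ) , Sat-id φ (λ i → sym (ext-eq f σ i))) (D-Sat φ (ext f) (ext-DF f d)))

  leastℕ : (P : ℕ → Set) → Σ ℕ P → Σ ℕ (λ m → P m × (∀ j → j <ℕ m → ¬ P j))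
  leastℕ P (n , pn) = go n n ℕₚ.≤-refl pn
    where
    go : ∀ k n → n ≤ℕ k → P n → Σ ℕ (λ m → P m × (∀ j → j <ℕ m → ¬ P j))
    go k n l pn with lem (Σ ℕ (λ j → j <ℕ n × P j))
    ... | inj₂ none = n , pn , λ j l' pj → none (j , l' , pj)
    go zero n l pn | inj₁ (j , l' , pj) = ⊥-elim (ℕₚ.n≮0 (ℕₚ.<-≤-trans l' l))
    go (suc k) n l pn | inj₁ (j , l' , pj) = go k j (ℕₚ.≤-pred (ℕₚ.<-≤-trans l' l)) pj

  -- The generic sequence of conditions.

  module Generic (J : C → Set) (cut : IsCut M J) (expc : ExpClosed M J) (I : ℕ → Set) (cnt : Countable M) where
    open Forcing J cut expc I public

    -- `Stable` for orders pulled back along `f`, since `phi` compares values of an element of N and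
    -- not leaves.
    StableF : C → C → C → C → Set
    StableF f g n X = ∀ u y w κ y' w' → u < n → Mem y X → Mem w X → κ < ℓ → agree κ y w → dec y κ ≢ dec w κ →
      Mem y' X → Mem w' X → agree (s κ) y y' → agree (s κ) w w' → dec (dec g u) (dec f y) < dec (dec g u) (dec f w) → dec (dec g u) (dec f y') < dec (dec g u) (dec f w')

    -- One element of M is read in all its roles: as a set, a function, a family of sets, a bound,
    -- and, if it has the right form, as a function with a list of orders and a type to be removed.
    -- Running once through the countable model thus meets every requirement.
    record Handled (w : C) (c : Cond) : Set where
      field
        h-dec   : Decides w (X c)
        h-inj   : ConstOn w (X c) ⊎ Injective w (X c)
        h-large : ConstOn w (X c) ⊎ LargeOn w (X c)
        h-cod   : CodOn w (X c)
        h-full  : Full (X c) (Q c)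
        h-uniq  : Unique (X c)
        h-small : ¬ J w → SmallIn (X c) w
        h-align : ∀ f g n t → w ≡ pair f (pair g (pair n t)) → J n → ¬ InI t → ¬ Mem t (Q c) × ((ConstOn f (X c) ⊎ Injective f (X c)) × StableF f g n (X c))
    open Handled public

    Decides-sub : ∀ {w Y Y'} → Y' ⊆ Y → Decides w Y → Decides w Y'
    Decides-sub p (inj₁ h) = inj₁ (λ y m → h y (p y m))
    Decides-sub p (inj₂ h) = inj₂ (λ y m → h y (p y m))

    CI-sub : ∀ {w Y Y'} → Y' ⊆ Y → ConstOn w Y ⊎ Injective w Y → ConstOn w Y' ⊎ Injective w Y'
    CI-sub p (inj₁ (a , h)) = inj₁ (a , λ y m → h y (p y m))
    CI-sub p (inj₂ h) = inj₂ (λ y v my mv → h y v (p y my) (p v mv))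

    CL-sub : ∀ {w Y Y'} → Y' ⊆ Y → ConstOn w Y ⊎ LargeOn w Y → ConstOn w Y' ⊎ LargeOn w Y'
    CL-sub p (inj₁ (a , h)) = inj₁ (a , λ y m → h y (p y m))
    CL-sub p (inj₂ (l , nl , h)) = inj₂ (l , nl , λ y m → h y (p y m))

    Cod-sub : ∀ {w Y Y'} → Y' ⊆ Y → CodOn w Y → CodOn w Y'
    Cod-sub {w} {Y} {Y'} p (k , nk , h) = k , nk , λ a l → sub a (h a l)
      where
      sub : ∀ a → Decided w Y a → Decided w Y' a
      sub a (inj₁ q) = inj₁ (λ y m → q y (p y m))
      sub a (inj₂ q) = inj₂ (λ y m → q y (p y m))

    compose-family : ∀ f g n → Σ C (λ G → (u : C) → u < n → (x : C) → x < b → dec (dec G u) x ≡ dec (dec g u) (dec f x))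
    compose-family f g n = code-rel n (λ u h → (x : C) → x < b → dec h x ≡ dec (dec g u) (dec f x)) (D∀ (D→ (D< (DFvar _) (DFcon _)) (D≡ (DFdec (DFvar _) (DFvar _)) (DFdec (DFdec (DFcon _) (DFvar _)) (DFdec (DFcon _) (DFvar _))))))
      (λ u _ → code b (λ x → dec (dec g u) (dec f x)) (DFdec (DFcon _) (DFdec (DFcon _) (DFvar _))))

    Form : C → Set
    Form w = Σ C (λ f → Σ C (λ g → Σ C (λ n → Σ C (λ t → (w ≡ pair f (pair g (pair n t))) × (J n × ¬ InI t)))))

    private
     stage₀ : ∀ c w → Σ Cond (λ c' → c' ⊑ c × Handled w c')
     stage₀ c w = go (lem (Form w))
       where
       r1 = step-decide c w
       r2 = step-inj (proj₁ r1) w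
       r3 = step-large (proj₁ r2) w
       r4 = step-cod (proj₁ r3) w
       k1 = proj₁ r1
       k2 = proj₁ r2
       k3 = proj₁ r3
       k4 = proj₁ r4
       s43 : k4 ⊑ k3
       s43 = proj₁ (proj₂ r4)
       s42 : k4 ⊑ k2
       s42 = ⊑-trans {k4} {k3} {k2} s43 (proj₁ (proj₂ r3))
       s41 : k4 ⊑ k1
       s41 = ⊑-trans {k4} {k2} {k1} s42 (proj₁ (proj₂ r2))
       s40 : k4 ⊑ c
       s40 = ⊑-trans {k4} {k1} {c} s41 (proj₁ (proj₂ r1))
       -- For an element of J no small set is demanded; `w₀` is then a default bound.
       Bw : Σ C (λ B → ¬ J B × (¬ J w → B ≡ w))
       Bw with lem (J w)
       ... | inj₁ j = w₀ , w₀∉ , λ n → ⊥-elim (n j)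
       ... | inj₂ n = w , n , λ _ → refl
       -- `Full` does not pass to subsets, so the step that provides it comes last; the earlier
       -- decisions are inherited.
       finish : ∀ k5 → k5 ⊑ k4 → ∀ G n → J n →
         (∀ k6 → k6 ⊑ k5 → Stable G n (X k6) → ∀ f g n t → w ≡ pair f (pair g (pair n t)) → J n → ¬ InI t → ¬ Mem t (Q k6) × ((ConstOn f (X k6) ⊎ Injective f (X k6)) × StableF f g n (X k6))) →
         Σ Cond (λ c' → c' ⊑ c × Handled w c')
       finish k5 s54 G n jn al = fin (step-final k5 G n (proj₁ Bw) jn (proj₁ (proj₂ Bw)))
         where
         fin : Σ Cond (λ k6 → k6 ⊑ k5 × (Full (X k6) (Q k6) × (Unique (X k6) × (SmallIn (X k6) (proj₁ Bw) × Stable G n (X k6))))) → Σ Cond (λ c' → c' ⊑ c × Handled w c')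
         fin (k6 , s65 , fl , uq , sm , st) = k6 , ⊑-trans {k6} {k4} {c} s64 s40 , record
           { h-dec = Decides-sub {w} (proj₁ (⊑-trans {k6} {k4} {k1} s64 s41)) (proj₂ (proj₂ r1))
           ; h-inj = CI-sub {w} (proj₁ (⊑-trans {k6} {k4} {k2} s64 s42)) (proj₂ (proj₂ r2))
           ; h-large = CL-sub {w} (proj₁ (⊑-trans {k6} {k4} {k3} s64 s43)) (proj₂ (proj₂ r3))
           ; h-cod = Cod-sub {w} (proj₁ s64) (proj₂ (proj₂ r4))
           ; h-full = fl ; h-uniq = uq
           ; h-small = λ nw → subst (SmallIn (X k6)) (proj₂ (proj₂ Bw) nw) sm
           ; h-align = al k6 s65 st }
           where
           s64 : k6 ⊑ k4
           s64 = ⊑-trans {k6} {k5} {k4} s65 s54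
       go : Form w ⊎ ¬ Form w → Σ Cond (λ c' → c' ⊑ c × Handled w c')
       -- The default is a list of 0 orders.
       go (inj₂ nf) = finish k4 (⊑-refl {k4}) z z J0 (λ k6 _ _ f g n t e jn nt → ⊥-elim (nf (f , g , n , t , e , jn , nt)))
       go (inj₁ (f , g , n , t , e , jn , nt)) = finish m2 (⊑-trans {m2} {m1} {k4} s21 (proj₁ (proj₂ q1))) (proj₁ cf) n jn al
         where
         q1 = step-inj k4 f
         m1 = proj₁ q1
         q2 = step-remove m1 t nt
         m2 = proj₁ q2
         s21 : m2 ⊑ m1
         s21 = proj₁ (proj₂ q2)
         cf = compose-family f g n
         al : ∀ k6 → k6 ⊑ m2 → Stable (proj₁ cf) n (X k6) → ∀ f g n t → w ≡ pair f (pair g (pair n t)) → J n → ¬ InI t → ¬ Mem t (Q k6) × ((ConstOn f (X k6) ⊎ Injective f (X k6)) × StableF f g n (X k6))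
         al k6 s6 st f' g' n' t' e' jn' nt' = conv (pair-inj (trans (sym e) e'))
           where
           core' : ¬ Mem t (Q k6) × ((ConstOn f (X k6) ⊎ Injective f (X k6)) × StableF f g n (X k6))
           core' = (λ m → proj₂ (proj₂ q2) (proj₂ s6 t m)) , CI-sub {f} (proj₁ (⊑-trans {k6} {m2} {m1} s6 s21)) (proj₂ (proj₂ q1)) , sf
             where
             eq : ∀ {u x} → u < n → Mem x (X k6) → dec (dec (proj₁ cf) u) x ≡ dec (dec g u) (dec f x)
             eq lu mx = proj₂ cf _ lu _ (A<b (X⊆A k6 _ mx))
             sf : StableF f g n (X k6)
             sf u y v κ y' v' lu my mv lκ a d my' mv' ay av lt = subst₂ _<_ (eq lu my') (eq lu mv')
               (st u y v κ y' v' lu my mv lκ a d my' mv' ay av (subst₂ _<_ (sym (eq lu my)) (sym (eq lu mv)) lt))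
           conv : (f ≡ f') × (pair g (pair n t) ≡ pair g' (pair n' t')) → ¬ Mem t' (Q k6) × ((ConstOn f' (X k6) ⊎ Injective f' (X k6)) × StableF f' g' n' (X k6))
           conv (ef , e2) = let (eg , e3) = pair-inj e2 ; (en , et) = pair-inj e3 in
             subst (λ t → ¬ Mem t (Q k6)) et (proj₁ core') , subst (λ f → ConstOn f (X k6) ⊎ Injective f (X k6)) ef (proj₁ (proj₂ core')) ,
             subst (λ f → StableF f g' n' (X k6)) ef (subst (λ g → StableF f g n' (X k6)) eg (subst (λ n → StableF f g n (X k6)) en (proj₂ (proj₂ core'))))

    opaque
      stage : ∀ c w → Σ Cond (λ c' → c' ⊑ c × Handled w c')
      stage = stage₀

    enum : ℕ → C
    enum = proj₁ cnt

    cs : ℕ → Cond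
    cs zero = proj₁ (stage c₀ (enum zero))
    cs (suc i) = proj₁ (stage (cs i) (enum (suc i)))

    handled : ∀ i → Handled (enum i) (cs i)
    handled zero = proj₂ (proj₂ (stage c₀ (enum zero)))
    handled (suc i) = proj₂ (proj₂ (stage (cs i) (enum (suc i))))

    cs-suc : ∀ i → cs (suc i) ⊑ cs i
    cs-suc i = proj₁ (proj₂ (stage (cs i) (enum (suc i))))

    XX : ℕ → C
    XX i = X (cs i)

    XX-mono : ∀ {i j} → i ≤ℕ j → XX j ⊆ XX i
    XX-mono {i} {j} l = go (ℕₚ.≤⇒≤′ l)
      where
      open import Data.Nat using (_≤′_; ≤′-reflexive; ≤′-step)
      go : ∀ {j} → i ≤′ j → XX j ⊆ XX i
      go (≤′-reflexive refl) y m = m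
      go (≤′-step {j} l) y m = go l y (proj₁ (cs-suc j) y m)

    handle : ∀ w → Σ ℕ (λ i → Handled w (cs i))
    handle w = let (i , e) = proj₂ cnt w in i , subst (λ t → Handled t (cs i)) e (handled i)

    -- Truth on a set of the generic ultrafilter.
    Ev : (C → Set) → Set
    Ev P = Σ ℕ (λ i → ∀ x → Mem x (XX i) → P x)

    Ev-map : ∀ {P R : C → Set} → (∀ x → x < b → P x → R x) → Ev P → Ev R
    Ev-map f (i , h) = i , λ x m → f x (A<b (X⊆A (cs i) x m)) (h x m)

    Ev-× : ∀ {P R : C → Set} → Ev P → Ev R → Ev (λ x → P x × R x)
    Ev-× (i , h) (j , g) = i ⊔ j , λ x m → h x (XX-mono (ℕₚ.m≤m⊔n i j) x m) , g x (XX-mono (ℕₚ.m≤n⊔m i j) x m)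

    Ev-any : ∀ {P : C → Set} → Ev P → Σ C P
    Ev-any (i , h) = let (y , m , _) = Rk-leaf (rk (cs i)) in y , h y m

    Ev-triv : ∀ {P : C → Set} → (∀ x → x < b → P x) → Ev P
    Ev-triv h = 0 , λ x m → h x (A<b (X⊆A (cs 0) x m))

    -- A definable property has a coded trace on `A`, and this code was decided when its turn came.
    Ev-dec : ∀ {P : C → Set} → Dfn 1 (λ ρ → P (ρ zero)) → Ev P ⊎ Ev (λ x → ¬ P x)
    Ev-dec {P} d = fin (filt A P d)
      where
      fin : Σ C (λ Y → (y : C) → (Mem y Y → Mem y A × P y) × (Mem y A × P y → Mem y Y)) → Ev P ⊎ Ev (λ x → ¬ P x)
      fin (Y , h) = go (handle Y)
        where
        go : Σ ℕ (λ i → Handled Y (cs i)) → Ev P ⊎ Ev (λ x → ¬ P x)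
        go (i , hd) = cases' (h-dec hd)
          where
          cases' : Decides Y (XX i) → Ev P ⊎ Ev (λ x → ¬ P x)
          cases' (inj₁ q) = inj₁ (i , λ x m → proj₂ (proj₁ (h x) (q x m)))
          cases' (inj₂ q) = inj₂ (i , λ x m p → q x m (proj₂ (h x) (X⊆A (cs i) x m , p)))

    Ev-Fin : ∀ {n} {P : Fin n → C → Set} → (∀ i → Ev (P i)) → Ev (λ x → ∀ i → P i x)
    Ev-Fin {zero} h = 0 , λ x m ()
    Ev-Fin {suc n} {P} h = Ev-map (λ { x _ (p , q) zero → p ; x _ (p , q) (suc i) → q i }) (Ev-× (h zero) (Ev-Fin (λ i → h (suc i))))

    -- The ultrapower by coded functions.

    infix 4 _~_
    _~_ : C → C → Set
    a ~ c = Ev (λ x → dec a x ≡ dec c x)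

    ~refl : ∀ {a} → a ~ a
    ~refl = Ev-triv (λ x _ → refl)
    ~sym : ∀ {a c} → a ~ c → c ~ a
    ~sym = Ev-map (λ x _ e → sym e)
    ~trans : ∀ {a c d} → a ~ c → c ~ d → a ~ d
    ~trans p q = Ev-map (λ x _ (e , f) → trans e f) (Ev-× p q)

    opaque
      -- In place of a quotient, each class is represented by its member of least index in the
      -- enumeration of M.
      idx : ∀ a → Σ ℕ (λ m → (enum m ~ a) × (∀ j → j <ℕ m → ¬ (enum j ~ a)))
      idx a = leastℕ (λ k → enum k ~ a) (let (k , e) = proj₂ cnt a in k , subst (λ t → t ~ a) (sym e) ~refl)

    rep : C → C
    rep a = enum (proj₁ (idx a))

    rep~ : ∀ a → rep a ~ a
    rep~ a = proj₁ (proj₂ (idx a))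

    rep-cong : ∀ {a c} → a ~ c → rep a ≡ rep c
    rep-cong {a} {c} e = cong enum (fin (ℕₚ.<-cmp (proj₁ (idx a)) (proj₁ (idx c))))
      where
      open import Relation.Binary.Definitions using (tri<; tri≈; tri>) renaming (Tri to Trichotomy)
      fin : Trichotomy (proj₁ (idx a) <ℕ proj₁ (idx c)) (proj₁ (idx a) ≡ proj₁ (idx c)) (proj₁ (idx c) <ℕ proj₁ (idx a)) → proj₁ (idx a) ≡ proj₁ (idx c)
      fin (tri< l _ _) = ⊥-elim (proj₂ (proj₂ (idx c)) _ l (~trans (rep~ a) e))
      fin (tri≈ _ p _) = p
      fin (tri> _ _ l) = ⊥-elim (proj₂ (proj₂ (idx a)) _ l (~trans (rep~ c) (~sym e)))

    -- Elements of the ultrapower: canonical codes of functions on A.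
    CN : Set
    CN = Σ C (λ a → rep a ≡ a)

    cls : C → CN
    cls a = rep a , rep-cong (rep~ a)

    -- Excluded middle decides equality on `C`, so by Hedberg's theorem the second components agree.
    CN-eq : ∀ {u v : CN} → proj₁ u ≡ proj₁ v → u ≡ v
    CN-eq {a , p} {.a , q} refl = cong (a ,_) (Decidable⇒UIP.≡-irrelevant (λ x y → em) p q)

    eq~ : ∀ {u v : CN} → proj₁ u ~ proj₁ v → u ≡ v
    eq~ {u} {v} e = CN-eq (trans (sym (proj₂ u)) (trans (rep-cong e) (proj₂ v)))

    ~eq : ∀ {u v : CN} → u ≡ v → proj₁ u ~ proj₁ v
    ~eq refl = ~refl

    opaque
     mkN : (F : C → C) → DF 1 (λ ρ → F (ρ zero)) → Σ CN (λ u → Ev (λ x → dec (proj₁ u) x ≡ F x))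
     mkN F d = let (a , h) = code b F d in cls a , Ev-map (λ x l e → trans e (h x l)) (rep~ a)

    opaque
      addN mulN : CN → CN → CN
      addN u v = proj₁ (mkN (λ x → dec (proj₁ u) x + dec (proj₁ v) x) (DF⊕ (DFdec (DFcon _) (DFvar _)) (DFdec (DFcon _) (DFvar _))))
      mulN u v = proj₁ (mkN (λ x → dec (proj₁ u) x * dec (proj₁ v) x) (DF⊗ (DFdec (DFcon _) (DFvar _)) (DFdec (DFcon _) (DFvar _))))

      emb : C → CN
      emb c = proj₁ (mkN (λ _ → c) (DFcon c))

      add-val : ∀ u v → Ev (λ x → dec (proj₁ (addN u v)) x ≡ dec (proj₁ u) x + dec (proj₁ v) x)
      add-val u v = proj₂ (mkN (λ x → dec (proj₁ u) x + dec (proj₁ v) x) (DF⊕ (DFdec (DFcon _) (DFvar _)) (DFdec (DFcon _) (DFvar _))))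

      mul-val : ∀ u v → Ev (λ x → dec (proj₁ (mulN u v)) x ≡ dec (proj₁ u) x * dec (proj₁ v) x)
      mul-val u v = proj₂ (mkN (λ x → dec (proj₁ u) x * dec (proj₁ v) x) (DF⊗ (DFdec (DFcon _) (DFvar _)) (DFdec (DFcon _) (DFvar _))))

      emb-val : ∀ c → Ev (λ x → dec (proj₁ (emb c)) x ≡ c)
      emb-val c = proj₂ (mkN (λ _ → c) (DFcon c))

    N : Str
    N = record { C = CN ; z = emb z ; o = emb o ; _⊕_ = addN ; _⊗_ = mulN ; _≤_ = λ u v → Ev (λ x → dec (proj₁ u) x ≤ dec (proj₁ v) x) }

    at : ∀ {n} → (Fin n → CN) → C → Fin n → C
    at ρ x i = dec (proj₁ (ρ i)) x

    eval-N : ∀ {n} (t : Term n) (ρ : Fin n → CN) → Ev (λ x → dec (proj₁ (eval N t ρ)) x ≡ eval M t (at ρ x))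
    eval-N (Term.var i) ρ = ~refl
    eval-N 0ₜ ρ = emb-val z
    eval-N 1ₜ ρ = emb-val o
    eval-N (p +ₜ q) ρ = Ev-map (λ x _ (e , (f , g)) → trans e (cong₂ _+_ f g))
      (Ev-× (add-val (eval N p ρ) (eval N q ρ)) (Ev-× (eval-N p ρ) (eval-N q ρ)))
    eval-N (p *ₜ q) ρ = Ev-map (λ x _ (e , (f , g)) → trans e (cong₂ _*_ f g))
      (Ev-× (mul-val (eval N p ρ) (eval N q ρ)) (Ev-× (eval-N p ρ) (eval-N q ρ)))

    D-at : ∀ {n} (φ : Fm false n) (ρ : Fin n → CN) → Dfn 1 (λ σ → SatL M φ (at ρ (σ zero)))
    D-at φ ρ = D-Sat φ (λ i σ → dec (proj₁ (ρ i)) (σ zero)) (λ i → DFdec (DFcon _) (DFvar zero))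

    at-∷ : ∀ {n} (u : CN) (ρ : Fin n → CN) x {v} → dec (proj₁ u) x ≡ v → ∀ i → at (u ∷ ρ) x i ≡ (v ∷ at ρ x) i
    at-∷ u ρ x e zero = e
    at-∷ u ρ x e (suc i) = refl

    -- A Skolem function on the leaves, coded in M. The implication makes the relation total: where
    -- `φ` has no witness, any value satisfies it.
    witness : ∀ {n} (φ : Fm false (suc n)) (ρ : Fin n → CN) → Σ C (λ a → (x : C) → x < b → Σ C (λ v → SatL M φ (v ∷ at ρ x)) → SatL M φ (dec a x ∷ at ρ x))
    witness φ ρ = let (a , h) = code-rel b (λ x v → Σ C (λ v → SatL M φ (v ∷ at ρ x)) → SatL M φ (v ∷ at ρ x)) (D→ (D∃ {P = λ v σ → SatL M φ (v ∷ at ρ (σ zero))} d1) d2) (λ x _ → tot x (lem _)) in a , λ x l e → h x l e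
      where
      fs2 : Fin (suc _) → Env 2 → C
      fs2 zero σ = σ (suc zero)
      fs2 (suc i) σ = dec (proj₁ (ρ i)) (σ zero)
      fs2-DF : ∀ i → DF 2 (fs2 i)
      fs2-DF zero = DFvar (suc zero)
      fs2-DF (suc i) = DFdec (DFcon _) (DFvar zero)
      eq2 : ∀ (σ : Env 2) i → (σ (suc zero) ∷ at ρ (σ zero)) i ≡ fs2 i σ
      eq2 σ zero = refl
      eq2 σ (suc i) = refl
      d2 : Dfn 2 (λ σ → SatL M φ (σ (suc zero) ∷ at ρ (σ zero)))
      d2 = D-iff (λ σ → Sat-id φ (eq2 σ) , Sat-id φ (λ i → sym (eq2 σ i))) (D-Sat φ fs2 fs2-DF)
      sw : Fin 2 → Fin 3
      sw zero = suc zero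
      sw (suc zero) = zero
      d1 : Dfn 3 (λ σ → SatL M φ (σ zero ∷ at ρ (σ (suc zero))))
      d1 = D-ren {P = λ σ → SatL M φ (σ (suc zero) ∷ at ρ (σ zero))} sw d2
      tot : ∀ x → Σ C (λ v → SatL M φ (v ∷ at ρ x)) ⊎ ¬ Σ C (λ v → SatL M φ (v ∷ at ρ x)) → Σ C (λ v → Σ C (λ v → SatL M φ (v ∷ at ρ x)) → SatL M φ (v ∷ at ρ x))
      tot x (inj₁ (v , p)) = v , λ _ → p
      tot x (inj₂ n) = z , λ e → ⊥-elim (n e)

    -- The two usual ingredients hold in coded form: `Ev-dec` decides every set that a formula
    -- defines, and `witness` replaces choice.
    Łoś : ∀ {n} (φ : Fm false n) (ρ : Fin n → CN) → SatL N φ ρ ⇔ Ev (λ x → SatL M φ (at ρ x))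
    Łoś (p ≐ q) ρ =
      (λ e → Ev-map (λ x _ (f , (g , h)) → trans (sym f) (trans g h)) (Ev-× (eval-N p ρ) (Ev-× (~eq e) (eval-N q ρ)))) ,
      (λ e → eq~ (Ev-map (λ x _ (f , (g , h)) → trans f (trans g (sym h))) (Ev-× (eval-N p ρ) (Ev-× e (eval-N q ρ)))))
    Łoś (p ≼ q) ρ =
      (λ e → Ev-map (λ x _ (f , (g , h)) → subst₂ _≤_ f h g) (Ev-× (eval-N p ρ) (Ev-× e (eval-N q ρ)))) ,
      (λ e → Ev-map (λ x _ (f , (g , h)) → subst₂ _≤_ (sym f) (sym h) g) (Ev-× (eval-N p ρ) (Ev-× e (eval-N q ρ))))
    Łoś ⊥f ρ = ⊥-elim , (λ e → proj₂ (Ev-any e))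
    Łoś (φ ⇒ ψ) ρ = to (Ev-dec {P = λ x → SatL M φ (at ρ x)} (D-at φ ρ)) ,
      (λ e p → proj₂ (Łoś ψ ρ) (Ev-map (λ x _ (f , a) → f a) (Ev-× e (proj₁ (Łoś φ ρ) p))))
      where
      to : Ev (λ x → SatL M φ (at ρ x)) ⊎ Ev (λ x → ¬ SatL M φ (at ρ x)) → (SatL N φ ρ → SatL N ψ ρ) → Ev (λ x → SatL M φ (at ρ x) → SatL M ψ (at ρ x))
      to (inj₁ e) f = Ev-map (λ x _ p _ → p) (proj₁ (Łoś ψ ρ) (f (proj₂ (Łoś φ ρ) e)))
      to (inj₂ e) f = Ev-map (λ x _ n p → ⊥-elim (n p)) e
    Łoś (φ ∧f ψ) ρ =
      (λ (p , q) → Ev-× (proj₁ (Łoś φ ρ) p) (proj₁ (Łoś ψ ρ) q)) ,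
      (λ e → proj₂ (Łoś φ ρ) (Ev-map (λ x _ → proj₁) e) , proj₂ (Łoś ψ ρ) (Ev-map (λ x _ → proj₂) e))
    Łoś (φ ∨f ψ) ρ = to , from (Ev-dec {P = λ x → SatL M φ (at ρ x)} (D-at φ ρ))
      where
      to : SatL N φ ρ ⊎ SatL N ψ ρ → Ev (λ x → SatL M φ (at ρ x) ⊎ SatL M ψ (at ρ x))
      to (inj₁ p) = Ev-map (λ x _ → inj₁) (proj₁ (Łoś φ ρ) p)
      to (inj₂ p) = Ev-map (λ x _ → inj₂) (proj₁ (Łoś ψ ρ) p)
      from : Ev (λ x → SatL M φ (at ρ x)) ⊎ Ev (λ x → ¬ SatL M φ (at ρ x)) → Ev (λ x → SatL M φ (at ρ x) ⊎ SatL M ψ (at ρ x)) → SatL N φ ρ ⊎ SatL N ψ ρ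
      from (inj₁ e) _ = inj₁ (proj₂ (Łoś φ ρ) e)
      from (inj₂ e) h = inj₂ (proj₂ (Łoś ψ ρ) (Ev-map (λ { x _ (n , inj₁ p) → ⊥-elim (n p) ; x _ (n , inj₂ q) → q }) (Ev-× e h)))
    Łoś (ex φ) ρ = to , from
      where
      to : Σ CN (λ u → SatL N φ (u ∷ ρ)) → Ev (λ x → Σ C (λ v → SatL M φ (v ∷ at ρ x)))
      to (u , p) = Ev-map (λ x _ q → dec (proj₁ u) x , Sat-id φ (at-∷ u ρ x refl) q) (proj₁ (Łoś φ (u ∷ ρ)) p)
      from : Ev (λ x → Σ C (λ v → SatL M φ (v ∷ at ρ x))) → Σ CN (λ u → SatL N φ (u ∷ ρ))
      from e = let (a , h) = witness φ ρ in cls a , proj₂ (Łoś φ (cls a ∷ ρ))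
        (Ev-map (λ x l (p , q) → Sat-id φ (λ i → sym (at-∷ (cls a) ρ x q i)) (h x l p)) (Ev-× e (rep~ a)))
    Łoś (all φ) ρ = to , from
      where
      to : (∀ u → SatL N φ (u ∷ ρ)) → Ev (λ x → ∀ v → SatL M φ (v ∷ at ρ x))
      -- A function that takes a counterexample wherever there is one; since its class satisfies
      -- `φ`, almost nowhere there is one.
      to f = let (a , h) = witness (φ ⇒ ⊥f) ρ in
        Ev-map (λ x l (p , q) v → dne (λ n → h x l (v , n) (Sat-id φ (at-∷ (cls a) ρ x q) p))) (Ev-× (proj₁ (Łoś φ (cls a ∷ ρ)) (f (cls a))) (rep~ a))
      from : Ev (λ x → ∀ v → SatL M φ (v ∷ at ρ x)) → ∀ u → SatL N φ (u ∷ ρ)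
      from e u = proj₂ (Łoś φ (u ∷ ρ)) (Ev-map (λ x _ p → Sat-id φ (λ i → sym (at-∷ u ρ x refl i)) (p _)) e)

    elem : ∀ {n} (φ : Fm false n) (ρ : Fin n → C) → (SatL M φ ρ → SatL N φ (λ i → emb (ρ i))) × (SatL N φ (λ i → emb (ρ i)) → SatL M φ ρ)
    elem φ ρ = (λ p → proj₂ (Łoś φ _) (Ev-map (λ x _ h → Sat-id φ (λ i → sym (h i)) p) vals)) ,
               (λ p → proj₂ (Ev-any (Ev-map (λ x _ (q , h) → Sat-id φ h q) (Ev-× (proj₁ (Łoś φ _) p) vals))))
      where
      vals : Ev (λ x → ∀ i → dec (proj₁ (emb (ρ i))) x ≡ ρ i)
      vals = Ev-Fin (λ i → emb-val (ρ i))

    E : ElemEmb M N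
    E = record { f = emb ; elem = elem }

    valid : ∀ {n} (φ : Fm false n) → (∀ ρ → SatL M φ ρ) → ∀ ρ → SatL N φ ρ
    valid φ h ρ = proj₂ (Łoś φ ρ) (Ev-triv (λ x _ → h _))

    private
      v0 : ∀ {n} → Term (suc n)
      v0 = Term.var zero
      v1 : ∀ {n} → Term (suc (suc n))
      v1 = Term.var (suc zero)
      v2 : ∀ {n} → Term (suc (suc (suc n)))
      v2 = Term.var (suc (suc zero))
      e1 : CN → Fin 1 → CN
      e1 u _ = u
      e2 : CN → CN → Fin 2 → CN
      e2 u v = u ∷ (λ _ → v)
      e3 : CN → CN → CN → Fin 3 → CN
      e3 u v w = u ∷ (v ∷ (λ _ → w))

      -- The induction axiom with equations `y = 0` and `y = x + 1` in place of substituted terms,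
      -- so that renaming suffices.
      indF : ∀ {n} → Fm false (suc n) → Fm false n
      indF φ = all ((v0 ≐ 0ₜ) ⇒ φ) ⇒ (all (φ ⇒ all ((v0 ≐ (v1 +ₜ 1ₜ)) ⇒ ren (liftF suc) φ)) ⇒ all φ)

      skip : ∀ {S : Str} {n} (φ : Fm false (suc n)) (ρ : Fin n → Str.C S) x y → SatL S (ren (liftF suc) φ) (y ∷ (x ∷ ρ)) ⇔ SatL S φ (y ∷ ρ)
      skip {S} φ ρ x y = Semantics.Sat-ren S (liftF suc) φ (λ { zero → refl ; (suc i) → refl })

    paN : IsPA N
    paN = record
      { succ≢0 = λ x → valid (((v0 +ₜ 1ₜ) ≐ 0ₜ) ⇒ ⊥f) (λ ρ → s≢0) (e1 x)
      ; succ-inj = λ x y → valid (((v0 +ₜ 1ₜ) ≐ (v1 +ₜ 1ₜ)) ⇒ (v0 ≐ v1)) (λ ρ → s-inj) (e2 x y)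
      ; +-0 = λ x → valid ((v0 +ₜ 0ₜ) ≐ v0) (λ ρ → +0 _) (e1 x)
      ; +-succ = λ x y → valid ((v0 +ₜ (v1 +ₜ 1ₜ)) ≐ ((v0 +ₜ v1) +ₜ 1ₜ)) (λ ρ → +s _ _) (e2 x y)
      ; *-0 = λ x → valid ((v0 *ₜ 0ₜ) ≐ 0ₜ) (λ ρ → *0 _) (e1 x)
      ; *-succ = λ x y → valid ((v0 *ₜ (v1 +ₜ 1ₜ)) ≐ ((v0 *ₜ v1) +ₜ v0)) (λ ρ → *s _ _) (e2 x y)
      ; ≤-def₁ = λ x y → valid ((v0 ≼ v1) ⇒ ex ((v1 +ₜ v0) ≐ v2)) (λ ρ → un) (e2 x y)
      ; ≤-def₂ = λ x y w → valid (((v0 +ₜ v2) ≐ v1) ⇒ (v0 ≼ v1)) (λ ρ → le _) (e3 x y w)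
      ; induction = λ φ ρ base step → valid (indF φ) (indM φ) ρ (λ { x refl → base })
          (λ x p → λ { y refl → proj₂ (skip {N} φ ρ x y) (step x p) })
      }
      where
      indM : ∀ {n} (φ : Fm false (suc n)) ρ → SatL M (indF φ) ρ
      indM φ ρ base step = PA.induction φ ρ (base z refl) (λ x p → proj₁ (skip {M} φ ρ x (s x)) (step x p (s x) refl))

  -- Minimality of N, and the statements about J.

  module Extension (J : C → Set) (cut : IsCut M J) (expc : ExpClosed M J) (I : ℕ → Set) (cnt : Countable M) where
    open Generic J cut expc I cnt public

    full-node : ∀ c {n} → Mem n (Q c) → Σ C (λ κ → Σ C (λ y → (κ < ℓ × (dec τ κ ≡ n)) × (∀ j → j < n + c3 → Σ C (λ v → Mem v (X c) × (agree κ y v × (dec v κ ≡ j))))))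
    full-node c {n} mn = go (cases (r c))
      where
      go : (r c ≡ z) ⊎ Σ C (λ r' → r c ≡ s r') → Σ C (λ κ → Σ C (λ y → (κ < ℓ × (dec τ κ ≡ n)) × (∀ j → j < n + c3 → Σ C (λ v → Mem v (X c) × (agree κ y v × (dec v κ ≡ j))))))
      go (inj₁ e) = ⊥-elim (r∉ c (subst J (sym e) J0))
      go (inj₂ (r' , e)) = let (κ , y , _ , _ , κ<ℓ , _ , t , kids) = Rk-unfold (subst (λ t → Rk (Q c) (X c) t z x₀) e (rk c)) n mn in
        κ , y , (κ<ℓ , t) , λ j l → let (y' , _ , a , d , m) = kids j l ; (v , mv , av) = Rk-leaf m in
          v , mv , agree-trans a (agree-≤ ≤s av) , trans (sym (av κ <s)) d

    -- Type 0 belongs to every `Q`; the two points lie below the children 0 and 1 of a node of this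
    -- type.
    two : ∀ c → Σ C (λ v → Σ C (λ w → (Mem v (X c) × Mem w (X c)) × (v ≢ w)))
    two c = let (κ , y , _ , kids) = full-node c (I⊆Q c z (inj₁ refl))
                (v , mv , _ , dv) = kids z (≤t (s≤s 0≤) (≤+' z))
                (w , mw , _ , dw) = kids (s z) (≤t (s≤s (s≤s 0≤)) (≤+' z))
            in v , w , (mv , mw) , λ e → s≢0 (trans (sym dw) (trans (cong (λ t → dec t κ) (sym e)) dv))

    opaque
      gen : CN
      gen = proj₁ (mkN (λ x → x) (DFvar _))
      gen-val : Ev (λ x → dec (proj₁ gen) x ≡ x)
      gen-val = proj₂ (mkN (λ x → x) (DFvar _))

    const⇒img : ∀ {u a} → Ev (λ x → dec (proj₁ u) x ≡ a) → emb a ≡ u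
    const⇒img {u} {a} e = eq~ (Ev-map (λ x _ (p , q) → trans p (sym q)) (Ev-× (emb-val a) e))

    img⇒const : ∀ {u a} → emb a ≡ u → Ev (λ x → dec (proj₁ u) x ≡ a)
    img⇒const {u} {a} refl = emb-val a

    inj⇒¬const : ∀ {f a i} → Injective f (XX i) → Ev (λ x → dec f x ≡ a) → ⊥
    inj⇒¬const {f} {a} {i} h (j , g) =
      let (v , w , (mv , mw) , ne) = two (cs (i ⊔ j))
          li = XX-mono (ℕₚ.m≤m⊔n i j)
          lj = XX-mono (ℕₚ.m≤n⊔m i j)
      in ne (h v w (li v mv) (li w mw) (trans (g v (lj v mv)) (sym (g w (lj w mw)))))

    proper : Proper E
    proper = gen , λ { (a , e) → fin (Ev-map (λ x _ (p , q) → trans (sym p) q) (Ev-× gen-val (img⇒const e))) }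
      where
      fin : ∀ {a} → Ev (λ x → x ≡ a) → ⊥
      fin (i , h) = let (v , w , (mv , mw) , ne) = two (cs i) in ne (trans (h v mv) (sym (h w mw)))

    -- An element of K outside M is represented by a function that is injective on some set of the
    -- ultrafilter. Hence every `u` is definable from it with parameters in M, and the elementary
    -- submodel K contains `u`.
    minimal : Minimal E
    minimal K g h comm (k , k∉) (u , u∉) = go (handle f)
      where
      hf = ElemEmb.f h
      gf = ElemEmb.f g
      f a : C
      f = proj₁ (hf k)
      a = proj₁ u
      h-inj' : ∀ {x y} → hf x ≡ hf y → x ≡ y
      h-inj' {x} {y} e = proj₂ (ElemEmb.elem h (Term.var zero ≐ Term.var (suc zero)) (x ∷ (λ (_ : Fin 1) → y))) e
      go : Σ ℕ (λ i → Handled f (cs i)) → ⊥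
      go (i , hd) = cs' (h-inj hd)
        where
        cs' : ConstOn f (XX i) ⊎ Injective f (XX i) → ⊥
        cs' (inj₁ (c , cst)) = k∉ (c , h-inj' (trans (comm c) (const⇒img {hf k} (i , cst))))
        cs' (inj₂ inj) = fin (proj₂ (ElemEmb.elem h (ex fm) (k ∷ (gf ∘ par))) (u , Sat-ren-N))
          where
          Y : C
          Y = XX i
          Rel : C → C → Set
          Rel v w = Σ C (λ x → Mem x Y × ((w ≡ dec f x) × (v ≡ dec a x)))
          dR : Dfn 2 (λ σ → Rel (σ zero) (σ (suc zero)))
          dR = D∃ (D× (D-Mem (DFvar _) (DFcon _)) (D× (D≡ (DFvar _) (DFdec (DFcon _) (DFvar _))) (D≡ (DFvar _) (DFdec (DFcon _) (DFvar _)))))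
          kk = Dfn.k dR
          fm : Fm false (suc (suc kk))
          fm = Dfn.fm dR
          par : Env kk
          par = Dfn.par dR
          inM : ∀ v w → Rel v w ⇔ SatL M fm (v ∷ (w ∷ par))
          inM v w = Dfn.iff dR (v ∷ (λ _ → w))
          pars : Ev (λ x → ∀ j → dec (proj₁ (emb (par j))) x ≡ par j)
          pars = Ev-Fin (λ j → emb-val (par j))
          env : ∀ v x → (∀ j → dec (proj₁ (emb (par j))) x ≡ par j) → ∀ j → at (v ∷ (hf k ∷ (emb ∘ par))) x j ≡ (dec (proj₁ v) x ∷ (dec f x ∷ par)) j
          env v x p zero = refl
          env v x p (suc zero) = refl
          env v x p (suc (suc j)) = p j
          inN : ∀ v → SatL N fm (v ∷ (hf k ∷ (emb ∘ par))) ⇔ Ev (λ x → Rel (dec (proj₁ v) x) (dec f x))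
          inN v = (λ p → Ev-map (λ x _ (q , e) → proj₂ (inM _ _) (Sat-id fm (env v x e) q)) (Ev-× (proj₁ (Łoś fm _) p) pars)) ,
                  (λ p → proj₂ (Łoś fm _) (Ev-map (λ x _ (q , e) → Sat-id fm (λ j → sym (env v x e j)) (proj₁ (inM _ _) q)) (Ev-× p pars)))
          swap : ∀ v j → (v ∷ (hf k ∷ (emb ∘ par))) j ≡ (v ∷ (λ j → hf ((k ∷ (gf ∘ par)) j))) j
          swap v zero = refl
          swap v (suc zero) = refl
          swap v (suc (suc j)) = sym (comm (par j))
          Sat-ren-N : SatL N fm (u ∷ (λ j → hf ((k ∷ (gf ∘ par)) j)))
          Sat-ren-N = Semantics.Sat-id N fm (swap u) (proj₂ (inN u) (i , λ x m → x , m , refl , refl))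
          fin : Σ (Str.C K) (λ v → SatL K fm (v ∷ (k ∷ (gf ∘ par)))) → ⊥
          fin (v , p) = u∉ (v , eq~ (Ev-map (λ { x _ ((x' , m , e , e') , m0) → trans e' (cong (dec a) (inj x' x m m0 (sym e))) }) (Ev-× (proj₁ (inN (hf v)) inN') (i , λ x m → m))))
            where
            sw2 : ∀ j → hf ((v ∷ (k ∷ (gf ∘ par))) j) ≡ (hf v ∷ (hf k ∷ (emb ∘ par))) j
            sw2 zero = refl
            sw2 (suc zero) = refl
            sw2 (suc (suc j)) = comm (par j)
            inN' : SatL N fm (hf v ∷ (hf k ∷ (emb ∘ par)))
            inN' = Semantics.Sat-id N fm sw2 (proj₁ (ElemEmb.elem h fm (v ∷ (k ∷ (gf ∘ par)))) p)

    -- Below an element of J a function is not large, hence constant on a set of the ultrafilter.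
    -- For `c` outside J, the injection that `SmallIn` provides represents an element below `c` that
    -- is not in M.
    gcis : ∀ c → (J c → Gcis E c) × (Gcis E c → J c)
    gcis c = to , λ g → dne (λ n → from g n (handle c))
      where
      to : J c → Gcis E c
      to j u l = go (handle (proj₁ u))
        where
        go : Σ ℕ (λ i → Handled (proj₁ u) (cs i)) → Img E u
        go (i , hd) = cs' (h-large hd)
          where
          cs' : ConstOn (proj₁ u) (XX i) ⊎ LargeOn (proj₁ u) (XX i) → Img E u
          cs' (inj₁ (a , h)) = a , const⇒img (i , h)
          cs' (inj₂ (m , nm , h)) = ⊥-elim (nm (J≤ (proj₂ (Ev-any (Ev-map (λ x _ (p , (q , e)) → ≤t p (≤t q (≡⇒≤ e))) (Ev-× (i , h) (Ev-× l (emb-val c)))))) j))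
      from : Gcis E c → ¬ J c → Σ ℕ (λ i → Handled c (cs i)) → ⊥
      from g n (i , hd) = fin (h-small hd n)
        where
        fin : SmallIn (XX i) c → ⊥
        fin (h , lt , inj) = let (a , e) = g (cls h) (Ev-map (λ x _ (p , (q , e)) → ≤t (≡⇒≤ p) (≤t (<⇒≤ q) (≡⇒≤ (sym e)))) (Ev-× (rep~ h) (Ev-× (i , lt) (emb-val c))))
                             in inj⇒¬const {h} {i = i} inj (Ev-map (λ x _ (p , q) → trans (sym p) q) (Ev-× (rep~ h) (img⇒const e)))

    -- An element of M fills no cut of M, and any other element exceeds or equals some element of M
    -- outside J.
    no-fill : Fills E J → ⊥
    no-fill (u , lo , hi) = go (handle (proj₁ u))
      where
      go : Σ ℕ (λ i → Handled (proj₁ u) (cs i)) → ⊥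
      go (i , hd) = cs' (h-large hd)
        where
        cs' : ConstOn (proj₁ u) (XX i) ⊎ LargeOn (proj₁ u) (XX i) → ⊥
        cs' (inj₁ (a , h)) with lem (J a)
        ... | inj₁ j = proj₂ (lo a j) (const⇒img (i , h))
        ... | inj₂ n = proj₂ (hi a n) (sym (const⇒img (i , h)))
        cs' (inj₂ (m , nm , h)) = proj₂ (hi m nm) (eq~ (Ev-map (λ x _ (p , (q , e)) → ≤a q (≤t (≡⇒≤ e) p)) (Ev-× (i , h) (Ev-× (proj₁ (hi m nm)) (emb-val m)))))

    -- The parameters of a set definable in N are functions on the leaves, so this set is given by a
    -- family of sets definable in M, one for each leaf. Membership of all elements of J is decided
    -- on one condition, and then the member of the family at any point of that condition has the
    -- right trace on J.
    same-cod : SameCod E J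
    same-cod = down , up
      where
      up : ∀ B → Definable M B → Σ (CN → Set) (λ D → Definable N D × (∀ a → J a → (B a → D (emb a)) × (D (emb a) → B a)))
      up B (n , φ , ρ , h) = (λ u → SatL N φ (u ∷ (emb ∘ ρ))) , (n , φ , emb ∘ ρ , λ x → id , id) , λ a _ →
        (λ p → Semantics.Sat-id N φ (eq a) (proj₁ (elem φ (a ∷ ρ)) (proj₁ (h a) p))) ,
        (λ p → proj₂ (h a) (proj₂ (elem φ (a ∷ ρ)) (Semantics.Sat-id N φ (λ i → sym (eq a i)) p)))
        where
        eq : ∀ a i → emb ((a ∷ ρ) i) ≡ (emb a ∷ (emb ∘ ρ)) i
        eq a zero = refl
        eq a (suc i) = refl
      down : ∀ B → Definable N B → Σ (C → Set) (λ D → Definable M D × (∀ a → J a → (D a → B (emb a)) × (B (emb a) → D a)))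
      down B (n , φ , ρ , h) = go (handle (proj₁ gcode))
        where
        Ψ : C → C → Set
        Ψ a x = SatL M φ (a ∷ at ρ x)
        fs : Fin (suc n) → Env 2 → C
        fs zero σ = σ zero
        fs (suc i) σ = dec (proj₁ (ρ i)) (σ (suc zero))
        fs-DF : ∀ i → DF 2 (fs i)
        fs-DF zero = DFvar zero
        fs-DF (suc i) = DFdec (DFcon _) (DFvar (suc zero))
        fs-eq : ∀ (σ : Env 2) i → (σ zero ∷ at ρ (σ (suc zero))) i ≡ fs i σ
        fs-eq σ zero = refl
        fs-eq σ (suc i) = refl
        dΨ : Dfn 2 (λ σ → Ψ (σ zero) (σ (suc zero)))
        dΨ = D-iff (λ σ → Sat-id φ (fs-eq σ) , Sat-id φ (λ i → sym (fs-eq σ i))) (D-Sat φ fs fs-DF)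
        pw : C → Set
        pw w = Σ C (λ a → Σ C (λ x → (w ≡ pair a x) × Ψ a x))
        dpw : Dfn 1 (λ σ → pw (σ zero))
        dpw = D∃ (D∃ (D× (D≡ (DFvar (suc (suc zero))) (DFpair (DFvar (suc zero)) (DFvar zero))) (rel2 {R = Ψ} dΨ (DFvar (suc zero)) (DFvar zero))))
        gcode : Σ C (λ g → (w : C) → (Mem w g → w < s (pair w₀ b) × pw w) × (w < s (pair w₀ b) × pw w → Mem w g))
        gcode = comp (s (pair w₀ b)) pw dpw
        small : ∀ {a x} → J a → x < b → pair a x < s (pair w₀ b)
        small j l = let p = <⇒≤ (J<∉ j w₀∉) ; q = <⇒≤ l in s≤s (+mono (*mono (+mono p q) (+mono p q)) p)
        back : ∀ {a x} → Mem (pair a x) (proj₁ gcode) → Ψ a x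
        back m = let (_ , a' , x' , e , p) = proj₁ (proj₂ gcode _) m ; (e1 , e2) = pair-inj e in subst₂ Ψ (sym e1) (sym e2) p
        go : Σ ℕ (λ i → Handled (proj₁ gcode) (cs i)) → Σ (C → Set) (λ D → Definable M D × (∀ a → J a → (D a → B (emb a)) × (B (emb a) → D a)))
        go (i , hd) = fin (h-cod hd) (two (cs i))
          where
          fin : CodOn (proj₁ gcode) (XX i) → Σ C (λ v → Σ C (λ w → (Mem v (XX i) × Mem w (XX i)) × (v ≢ w))) → Σ (C → Set) (λ D → Definable M D × (∀ a → J a → (D a → B (emb a)) × (B (emb a) → D a)))
          fin (k , nk , dcd) (v , _ , (mv , _) , _) = (λ a → Ψ a v) , (n , φ , at ρ v , λ x → id , id) , λ a j → both a j (dcd a (J<∉ j nk))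
            where
            v<b : v < b
            v<b = A<b (X⊆A (cs i) v mv)
            inB : ∀ a → B (emb a) ⇔ Ev (λ x → Ψ a x)
            inB a = (λ p → Ev-map (λ x _ (q , e) → Sat-id φ (at-∷ (emb a) ρ x e) q) (Ev-× (proj₁ (Łoś φ _) (proj₁ (h (emb a)) p)) (emb-val a))) ,
                    (λ p → proj₂ (h (emb a)) (proj₂ (Łoś φ _) (Ev-map (λ x _ (q , e) → Sat-id φ (λ t → sym (at-∷ (emb a) ρ x e t)) q) (Ev-× p (emb-val a)))))
            both : ∀ a → J a → Decided (proj₁ gcode) (XX i) a → (Ψ a v → B (emb a)) × (B (emb a) → Ψ a v)
            both a j (inj₁ q) = (λ _ → proj₂ (inB a) (i , λ x m → back (q x m))) , (λ _ → back (q v mv))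
            both a j (inj₂ q) = (λ p → ⊥-elim (q v mv (proj₂ (proj₂ gcode _) (small j v<b , a , v , refl , p)))) ,
              (λ p → ⊥-elim (proj₂ (Ev-any (Ev-map (λ x l (ψ , m) → q x m (proj₂ (proj₂ gcode _) (small j l , a , x , refl , ψ))) (Ev-× (proj₁ (inB a) p) (i , λ x m → m))))))

  -- Lexicographic orders with prescribed leading digits.

  c4 : C
  c4 = s c3

  -- The digit j, with the digits a, a', a'' moved to 0, 1, 2 and the others out of the way.
  PermR : C → C → C → C → Set
  PermR y a w j = Σ C (λ a' → Σ C (λ a'' → (w ≡ pair a' a'') ×
    (((j ≡ a) × (y ≡ z)) ⊎ (((j ≢ a) × ((j ≡ a') × (y ≡ s z))) ⊎
    (((j ≢ a) × ((j ≢ a') × ((j ≡ a'') × (y ≡ s (s z))))) ⊎ ((j ≢ a) × ((j ≢ a') × ((j ≢ a'') × (y ≡ j + c3)))))))))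

  opaque
    D-PermR : ∀ {n} {f g h l : Env n → C} → DF n f → DF n g → DF n h → DF n l → Dfn n (λ ρ → PermR (f ρ) (g ρ) (h ρ) (l ρ))
    D-PermR = rel4 {R = PermR} (D∃ (D∃ (D× (D≡ (DFvar _) (DFpair (DFvar _) (DFvar _))) (D⊎ (D× (D≡ (DFvar _) (DFvar _)) (D≡ (DFvar _) (DFcon _))) (D⊎ (D× (D≢ (DFvar _) (DFvar _)) (D× (D≡ (DFvar _) (DFvar _)) (D≡ (DFvar _) (DFcon _)))) (D⊎ (D× (D≢ (DFvar _) (DFvar _)) (D× (D≢ (DFvar _) (DFvar _)) (D× (D≡ (DFvar _) (DFvar _)) (D≡ (DFvar _) (DFcon _))))) (D× (D≢ (DFvar _) (DFvar _)) (D× (D≢ (DFvar _) (DFvar _)) (D× (D≢ (DFvar _) (DFvar _)) (D≡ (DFvar _) (DF⊕ (DFvar _) (DFcon _))))))))))))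

  opaque
    perm-total : ∀ a a' a'' j → Σ C (λ y → PermR y a (pair a' a'') j)
    perm-total a a' a'' j = go (lem (j ≡ a)) (lem (j ≡ a')) (lem (j ≡ a''))
      where
      go : (j ≡ a) ⊎ ¬ (j ≡ a) → (j ≡ a') ⊎ ¬ (j ≡ a') → (j ≡ a'') ⊎ ¬ (j ≡ a'') → Σ C (λ y → PermR y a (pair a' a'') j)
      go (inj₁ p) _ _ = z , a' , a'' , refl , inj₁ (p , refl)
      go (inj₂ n) (inj₁ p) _ = s z , a' , a'' , refl , inj₂ (inj₁ (n , p , refl))
      go (inj₂ n) (inj₂ n') (inj₁ p) = s (s z) , a' , a'' , refl , inj₂ (inj₂ (inj₁ (n , n' , p , refl)))
      go (inj₂ n) (inj₂ n') (inj₂ n'') = j + c3 , a' , a'' , refl , inj₂ (inj₂ (inj₂ (n , n' , n'' , refl)))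

    perm-fun : ∀ {y y' a w j} → PermR y a w j → PermR y' a w j → y ≡ y'
    perm-fun (a' , a'' , e , p) (b' , b'' , e' , q) = go (pair-inj (trans (sym e) e')) p q
      where
      go : ∀ {y y' a a' a'' b' b'' j} → (a' ≡ b') × (a'' ≡ b'') →
        (((j ≡ a) × (y ≡ z)) ⊎ (((j ≢ a) × ((j ≡ a') × (y ≡ s z))) ⊎ (((j ≢ a) × ((j ≢ a') × ((j ≡ a'') × (y ≡ s (s z))))) ⊎ ((j ≢ a) × ((j ≢ a') × ((j ≢ a'') × (y ≡ j + c3))))))) →
        (((j ≡ a) × (y' ≡ z)) ⊎ (((j ≢ a) × ((j ≡ b') × (y' ≡ s z))) ⊎ (((j ≢ a) × ((j ≢ b') × ((j ≡ b'') × (y' ≡ s (s z))))) ⊎ ((j ≢ a) × ((j ≢ b') × ((j ≢ b'') × (y' ≡ j + c3))))))) → y ≡ y'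
      go (refl , refl) (inj₁ (p , e)) (inj₁ (_ , e')) = trans e (sym e')
      go (refl , refl) (inj₁ (p , e)) (inj₂ (inj₁ (n , _))) = ⊥-elim (n p)
      go (refl , refl) (inj₁ (p , e)) (inj₂ (inj₂ (inj₁ (n , _)))) = ⊥-elim (n p)
      go (refl , refl) (inj₁ (p , e)) (inj₂ (inj₂ (inj₂ (n , _)))) = ⊥-elim (n p)
      go (refl , refl) (inj₂ (inj₁ (n , p , e))) (inj₁ (p' , _)) = ⊥-elim (n p')
      go (refl , refl) (inj₂ (inj₁ (n , p , e))) (inj₂ (inj₁ (_ , _ , e'))) = trans e (sym e')
      go (refl , refl) (inj₂ (inj₁ (n , p , e))) (inj₂ (inj₂ (inj₁ (_ , n' , _)))) = ⊥-elim (n' p)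
      go (refl , refl) (inj₂ (inj₁ (n , p , e))) (inj₂ (inj₂ (inj₂ (_ , n' , _)))) = ⊥-elim (n' p)
      go (refl , refl) (inj₂ (inj₂ (inj₁ (n , n' , p , e)))) (inj₁ (p' , _)) = ⊥-elim (n p')
      go (refl , refl) (inj₂ (inj₂ (inj₁ (n , n' , p , e)))) (inj₂ (inj₁ (_ , p' , _))) = ⊥-elim (n' p')
      go (refl , refl) (inj₂ (inj₂ (inj₁ (n , n' , p , e)))) (inj₂ (inj₂ (inj₁ (_ , _ , _ , e')))) = trans e (sym e')
      go (refl , refl) (inj₂ (inj₂ (inj₁ (n , n' , p , e)))) (inj₂ (inj₂ (inj₂ (_ , _ , n'' , _)))) = ⊥-elim (n'' p)
      go (refl , refl) (inj₂ (inj₂ (inj₂ (n , n' , n'' , e)))) (inj₁ (p' , _)) = ⊥-elim (n p')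
      go (refl , refl) (inj₂ (inj₂ (inj₂ (n , n' , n'' , e)))) (inj₂ (inj₁ (_ , p' , _))) = ⊥-elim (n' p')
      go (refl , refl) (inj₂ (inj₂ (inj₂ (n , n' , n'' , e)))) (inj₂ (inj₂ (inj₁ (_ , _ , p' , _)))) = ⊥-elim (n'' p')
      go (refl , refl) (inj₂ (inj₂ (inj₂ (n , n' , n'' , e)))) (inj₂ (inj₂ (inj₂ (_ , _ , _ , e')))) = trans e (sym e')

  -- Lexicographic orders in which, at the nodes with Sel κ x q, the digits dec q a, dec q a', dec q a''
  -- come first in this order; the orders are indexed by the codes of the triples (a , a' , a'').
  module Lex (ℓ b : C) (Sel : C → C → C → Set) (dSel : Dfn 3 (λ ρ → Sel (ρ zero) (ρ (suc zero)) (ρ (suc (suc zero)))))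
    (Sel-fun : ∀ {κ x q q'} → Sel κ x q → Sel κ x q' → q ≡ q')
    (Sel-inv : ∀ {κ x y q} → agree κ x y → Sel κ x q → Sel κ y q) where

    Digit : C → C → C → C → Set
    Digit y t κ x = (Σ C (λ q → Σ C (λ a → Σ C (λ a' → Σ C (λ a'' → Sel κ x q × ((t ≡ pair a (pair a' a'')) × PermR y (dec q a) (pair (dec q a') (dec q a'')) (dec x κ))))))) ⊎ (¬ Σ C (λ q → Σ C (λ a → Σ C (λ a' → Σ C (λ a'' → Sel κ x q × (t ≡ pair a (pair a' a'')))))) × (y ≡ dec x κ))

    dDigit : Dfn 4 (λ ρ → Digit (ρ zero) (ρ (suc zero)) (ρ (suc (suc zero))) (ρ (suc (suc (suc zero)))))
    dDigit = D⊎ (D∃ (D∃ (D∃ (D∃ (D× (rel3 {R = Sel} dSel (DFvar _) (DFvar _) (DFvar _)) (D× (D≡ (DFvar _) (DFpair (DFvar _) (DFpair (DFvar _) (DFvar _)))) (D-PermR (DFvar _) (DFdec (DFvar _) (DFvar _)) (DFpair (DFdec (DFvar _) (DFvar _)) (DFdec (DFvar _) (DFvar _))) (DFdec (DFvar _) (DFvar _))))))))) (D× (D¬ (D∃ (D∃ (D∃ (D∃ (D× (rel3 {R = Sel} dSel (DFvar _) (DFvar _) (DFvar _)) (D≡ (DFvar _) (DFpair (DFvar _) (DFpair (DFvar _) (DFvar _)))))))))) (D≡ (DFvar _) (DFdec (DFvar _) (DFvar _))))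

    private
      Has : C → C → C → Set
      Has t κ x = Σ C (λ q → Σ C (λ a → Σ C (λ a' → Σ C (λ a'' → Sel κ x q × (t ≡ pair a (pair a' a''))))))

    opaque
      digit-total : ∀ t κ x → Σ C (λ y → Digit y t κ x)
      digit-total t κ x = go (lem (Has t κ x))
        where
        go : Has t κ x ⊎ ¬ Has t κ x → Σ C (λ y → Digit y t κ x)
        go (inj₁ (q , a , a' , a'' , sl , e)) = let (y , p) = perm-total (dec q a) (dec q a') (dec q a'') (dec x κ) in y , inj₁ (q , a , a' , a'' , sl , e , p)
        go (inj₂ n) = dec x κ , inj₂ (n , refl)

      digit-fun : ∀ {y y' t κ x} → Digit y t κ x → Digit y' t κ x → y ≡ y'
      digit-fun (inj₁ (q , a , a' , a'' , sl , e , p)) (inj₁ (q' , b₁ , b' , b'' , sl' , e' , p')) = go (Sel-fun sl sl') (pair-inj (trans (sym e) e')) p p'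
        where
        go : ∀ {y y' q q' a b₁ a' a'' b' b'' j} → q ≡ q' → (a ≡ b₁) × (pair a' a'' ≡ pair b' b'') → PermR y (dec q a) (pair (dec q a') (dec q a'')) j → PermR y' (dec q' b₁) (pair (dec q' b') (dec q' b'')) j → y ≡ y'
        go {y' = y'} {q = q} {a = a} {j = j} refl (refl , e2) p p' = let (e3 , e4) = pair-inj e2 in
          perm-fun p (subst₂ (λ u v → PermR y' (dec q a) (pair (dec q u) (dec q v)) j) (sym e3) (sym e4) p')
      digit-fun (inj₁ (q , a , a' , a'' , sl , e , p)) (inj₂ (n , _)) = ⊥-elim (n (q , a , a' , a'' , sl , e))
      digit-fun (inj₂ (n , _)) (inj₁ (q , a , a' , a'' , sl , e , p)) = ⊥-elim (n (q , a , a' , a'' , sl , e))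
      digit-fun (inj₂ (_ , e)) (inj₂ (_ , e')) = trans e (sym e')

      digit-inv : ∀ {y t κ x x'} → agree (s κ) x x' → Digit y t κ x → Digit y t κ x'
      digit-inv {y} {t} {κ} {x} {x'} ag (inj₁ (q , a , a' , a'' , sl , e , p)) = inj₁ (q , a , a' , a'' , Sel-inv (agree-≤ ≤s ag) sl , e , subst (PermR y _ _) (ag κ <s) p)
      digit-inv {y} {t} {κ} {x} {x'} ag (inj₂ (n , e)) = inj₂ ((λ { (q , a , a' , a'' , sl , e') → n (q , a , a' , a'' , Sel-inv (agree-sym (agree-≤ ≤s ag)) sl , e') }) , trans e (ag κ <s))

    δ : C → C → C → C
    δ t κ x = proj₁ (digit-total t κ x)

    δ-spec : ∀ t κ x → Digit (δ t κ x) t κ x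
    δ-spec t κ x = proj₂ (digit-total t κ x)

    opaque
      dδ : Dfn 4 (λ ρ → ρ zero ≡ δ (ρ (suc zero)) (ρ (suc (suc zero))) (ρ (suc (suc (suc zero)))))
      dδ = D-iff (λ ρ → (λ e → subst (λ y → Digit y _ _ _) (sym e) (δ-spec _ _ _)) , (λ p → digit-fun p (δ-spec _ _ _))) dDigit

      DFδ : ∀ {n} {f g h : Env n → C} → DF n f → DF n g → DF n h → DF n (λ ρ → δ (f ρ) (g ρ) (h ρ))
      DFδ = fun3 {F = δ} dδ

    Ordered : C → C → C → Set
    Ordered i t h = (x : C) → (y : C) → x < b → y < b → (agree i x y → dec h x ≡ dec h y) × ((κ : C) → κ < i → agree κ x y → δ t κ x < δ t κ y → dec h x < dec h y)

    opaque
      -- As in a positional system: adding level `i` multiplies the old value by a bound `B` on the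
      -- new digits and adds the digit.
      order : ∀ t i → Σ C (λ h → Ordered i t h)
      order t = ind (λ i → Σ C (λ h → (x : C) → (y : C) → x < b → y < b → (agree i x y → dec h x ≡ dec h y) × ((κ : C) → κ < i → agree κ x y → δ t κ x < δ t κ y → dec h x < dec h y))) (D∃ (D∀ (D∀ (D→ (D< (DFvar _) (DFcon _)) (D→ (D< (DFvar _) (DFcon _)) (D× (D→ (D-agree (DFvar _) (DFvar _) (DFvar _)) (D≡ (DFdec (DFvar _) (DFvar _)) (DFdec (DFvar _) (DFvar _)))) (D∀ (D→ (D< (DFvar _) (DFvar _)) (D→ (D-agree (DFvar _) (DFvar _) (DFvar _)) (D→ (D< (DFδ (DFcon _) (DFvar _) (DFvar _)) (DFδ (DFcon _) (DFvar _) (DFvar _))) (D< (DFdec (DFvar _) (DFvar _)) (DFdec (DFvar _) (DFvar _)))))))))))))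
        (let (h , e) = code b (λ _ → z) DFz in h , λ x y lx ly → (λ _ → trans (e x lx) (sym (e y ly))) , λ κ l → ⊥-elim (x≮0 l)) step
        where
        step : ∀ i → Σ C (λ h → Ordered i t h) → Σ C (λ h → Ordered (s i) t h)
        step i (h , o) = fin (coll b (λ x w → w ≡ δ t i x) (D≡ (DFvar _) (DFδ (DFcon _) (DFcon _) (DFvar _))) (λ x _ → δ t i x , refl))
          where
          fin : Σ C (λ B → (x : C) → x < b → Σ C (λ w → w < B × (w ≡ δ t i x))) → Σ C (λ h → Ordered (s i) t h)
          fin (B , bd) = fin2 (code b (λ x → dec h x * B + δ t i x) (DF⊕ (DF⊗ (DFdec (DFcon _) (DFvar _)) (DFcon _)) (DFδ (DFcon _) (DFcon _) (DFvar _))))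
            where
            δ<B : ∀ x → x < b → δ t i x < B
            δ<B x l = let (w , lw , e) = bd x l in ≤t (≡⇒≤ (cong s (sym e))) lw
            fin2 : Σ C (λ h' → (x : C) → x < b → dec h' x ≡ dec h x * B + δ t i x) → Σ C (λ h → Ordered (s i) t h)
            fin2 (h' , e) = h' , λ x y lx ly → eq x y lx ly , λ κ l → lt x y lx ly κ (<s⇒ l)
              where
              eq : ∀ x y → x < b → y < b → agree (s i) x y → dec h' x ≡ dec h' y
              eq x y lx ly a = trans (e x lx) (trans (cong₂ (λ u v → u * B + v) (proj₁ (o x y lx ly) (agree-≤ ≤s a)) (digit-fun (digit-inv a (δ-spec t i x)) (δ-spec t i y))) (sym (e y ly)))
              lt : ∀ x y → x < b → y < b → ∀ κ → κ < i ⊎ κ ≡ i → agree κ x y → δ t κ x < δ t κ y → dec h' x < dec h' y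
              lt x y lx ly κ (inj₁ l) a d = subst₂ _<_ (sym (e x lx)) (sym (e y ly))
                (<≤t (≤t (≡⇒≤ (sym (+s _ _))) (+mono (≤r {dec h x * B}) (δ<B x lx))) (≤t (≡⇒≤ (sym (s* (dec h x) B))) (≤t (*mono (proj₂ (o x y lx ly) κ l a d) ≤r) (≤+ _))))
              lt x y lx ly κ (inj₂ refl) a d = subst₂ _<_ (sym (e x lx)) (sym (e y ly))
                (≤t (≡⇒≤ (sym (+s _ _))) (+mono (≡⇒≤ (cong (_* B) (proj₁ (o x y lx ly) a))) d))

    opaque
      orders : ∀ n → Σ C (λ g → (t : C) → t < n → (κ : C) → (x : C) → (y : C) → κ < ℓ → x < b → y < b → agree κ x y → δ t κ x < δ t κ y → dec (dec g t) x < dec (dec g t) y)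
      orders n = let (g , h) = code-rel n (λ t h → (κ : C) → (x : C) → (y : C) → κ < ℓ → x < b → y < b → agree κ x y → δ t κ x < δ t κ y → dec h x < dec h y) (D∀ (D∀ (D∀ (D→ (D< (DFvar _) (DFcon _)) (D→ (D< (DFvar _) (DFcon _)) (D→ (D< (DFvar _) (DFcon _)) (D→ (D-agree (DFvar _) (DFvar _) (DFvar _)) (D→ (D< (DFδ (DFvar _) (DFvar _) (DFvar _)) (DFδ (DFvar _) (DFvar _) (DFvar _))) (D< (DFdec (DFvar _) (DFvar _)) (DFdec (DFvar _) (DFvar _)))))))))))
                       (λ t _ → let (h , o) = order t ℓ in h , λ κ x y l lx ly a d → proj₂ (o x y lx ly) κ l a d)
                 in g , h

    opaque
      -- At selected nodes every triple of selected children occurs in every order ...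
      lex-sel : ∀ {κ x q a a' a''} → Sel κ x q → dec x κ ≡ dec q a → δ (pair a (pair a' a'')) κ x ≡ z
      lex-sel {κ} {x} {q} {a} {a'} {a''} sl e = digit-fun (δ-spec _ κ x) (inj₁ (q , a , a' , a'' , sl , refl , dec q a' , dec q a'' , refl , inj₁ (e , refl)))

      lex-sel' : ∀ {κ x q a a' a''} → Sel κ x q → dec q a' ≢ dec q a → dec x κ ≡ dec q a' → δ (pair a (pair a' a'')) κ x ≡ s z
      lex-sel' {κ} {x} {q} {a} {a'} {a''} sl ne e = digit-fun (δ-spec _ κ x) (inj₁ (q , a , a' , a'' , sl , refl , dec q a' , dec q a'' , refl , inj₂ (inj₁ ((λ e' → ne (trans (sym e) e')) , e , refl))))

      lex-sel'' : ∀ {κ x q a a' a''} → Sel κ x q → dec q a'' ≢ dec q a → dec q a'' ≢ dec q a' → dec x κ ≡ dec q a'' → δ (pair a (pair a' a'')) κ x ≡ s (s z)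
      lex-sel'' {κ} {x} {q} {a} {a'} {a''} sl ne ne' e = digit-fun (δ-spec _ κ x) (inj₁ (q , a , a' , a'' , sl , refl , dec q a' , dec q a'' , refl , inj₂ (inj₂ (inj₁ ((λ e' → ne (trans (sym e) e')) , (λ e' → ne' (trans (sym e) e')) , e , refl)))))

      -- ... and elsewhere all the orders agree.
      lex-other : ∀ {κ x t} → ¬ Σ C (λ q → Sel κ x q) → δ t κ x ≡ dec x κ
      lex-other {κ} {x} n = digit-fun (δ-spec _ κ x) (inj₂ ((λ { (q , _ , _ , _ , sl , _) → n (q , sl) }) , refl))

  -- Free sets and the semantic form of `phi`.

  Ord : C → C → C → C
  Ord g t y = dec (dec g t) y

  Free : C → C → C → C → Set
  Free g n p m = ∀ i j k → i < m → j < m → k < m → i ≢ j → i ≢ k → j ≢ k → Σ C (λ t → t < n × (Ord g t (dec p j) < Ord g t (dec p i) × Ord g t (dec p i) < Ord g t (dec p k)))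

  module Decode (J : C → Set) (cut : IsCut M J) (expc : ExpClosed M J) (I : ℕ → Set) (cnt : Countable M) where
    open Extension J cut expc I cnt public

    Split : C → C → C → Set
    Split κ x y = κ < ℓ × (agree κ x y × (dec x κ ≢ dec y κ))

    split-sym : ∀ {κ x y} → Split κ x y → Split κ y x
    split-sym (l , a , d) = l , agree-sym a , λ e → d (sym e)

    splits : ∀ {X x y} → Unique X → Mem x X → Mem y X → x ≢ y → Σ C (λ κ → Split κ x y)
    splits {X} {x} {y} uq mx my ne = fin (¬∀⇒∃ (λ h → ne (uq x y mx my h)))
      where
      fin : Σ C (λ i → ¬ (i < ℓ → dec x i ≡ dec y i)) → Σ C (λ κ → Split κ x y)
      fin (i , ni) = let (κ , (l , d) , least) = lnp (λ i → i < ℓ × (dec x i ≢ dec y i)) (D× (D< (DFvar _) (DFcon _)) (D≢ (DFdec (DFcon _) (DFvar _)) (DFdec (DFcon _) (DFvar _)))) i (dne (λ h → ni (λ l → dne (λ d → h (l , d))))) in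
        κ , l , (λ t lt → dne (λ h → least t lt (<t lt l , h))) , d

    -- Free sets lie across a single node.
    module Transversal (X f g n p m : C) (uq : Unique X) (st : StableF f g n X) (m≥3 : c3 ≤ m) (pX : ∀ i → i < m → Mem (dec p i) X)
      (fr : ∀ i j k → i < m → j < m → k < m → i ≢ j → i ≢ k → j ≢ k → Σ C (λ t → t < n × (Ord g t (dec f (dec p j)) < Ord g t (dec f (dec p i)) × Ord g t (dec f (dec p i)) < Ord g t (dec f (dec p k))))) where

      -- Freeness speaks of triples, so using it for two indices takes a third one.
      third : ∀ i j → Σ C (λ k → k < m × ((i ≢ k) × (j ≢ k)))
      third i j = go (lem (i ≡ z)) (lem (j ≡ z)) (lem (i ≡ s z)) (lem (j ≡ s z))
        where
        l0 : z < m
        l0 = <≤t 0<s m≥3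
        l1 : s z < m
        l1 = <≤t (s≤s 0<s) m≥3
        l2 : s (s z) < m
        l2 = m≥3
        0≢1 : z ≢ s z
        0≢1 e = s≢0 (sym e)
        0≢2 : z ≢ s (s z)
        0≢2 e = s≢0 (sym e)
        1≢2 : s z ≢ s (s z)
        1≢2 e = 0≢1 (s-inj e)
        go : (i ≡ z) ⊎ ¬ (i ≡ z) → (j ≡ z) ⊎ ¬ (j ≡ z) → (i ≡ s z) ⊎ ¬ (i ≡ s z) → (j ≡ s z) ⊎ ¬ (j ≡ s z) → Σ C (λ k → k < m × ((i ≢ k) × (j ≢ k)))
        go (inj₂ a) (inj₂ c) _ _ = z , l0 , a , c
        go (inj₁ refl) _ _ (inj₂ d) = s z , l1 , 0≢1 , d
        go (inj₁ refl) _ _ (inj₁ refl) = s (s z) , l2 , 0≢2 , 1≢2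
        go (inj₂ a) (inj₁ refl) (inj₂ c) _ = s z , l1 , c , 0≢1
        go (inj₂ a) (inj₁ refl) (inj₁ refl) _ = s (s z) , l2 , 1≢2 , 0≢2

      distinct : ∀ i j → i < m → j < m → i ≢ j → dec p i ≢ dec p j
      distinct i j li lj ne e = let (k , lk , ik , jk) = third i j
                                    (t , _ , l , _) = fr i j k li lj lk ne ik jk in <irr (subst (λ u → Ord g t (dec f (dec p j)) < Ord g t (dec f u)) e l)

      level : ∀ i j → i < m → j < m → i ≢ j → Σ C (λ κ → Split κ (dec p i) (dec p j))
      level i j li lj ne = splits {X} uq (pX i li) (pX j lj) (distinct i j li lj ne)

      -- If `i` parts from `j` before `k` does, then `j` and `k` lie below the same child of the
      -- node where `i` branches off. Stability puts `i` on the same side of both in each order, but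
      -- freeness puts it between them in one.
      no-branch : ∀ i j k → i < m → j < m → k < m → i ≢ j → i ≢ k → j ≢ k → ∀ {κ κ'} → Split κ (dec p j) (dec p i) → Split κ' (dec p j) (dec p k) → ¬ κ < κ'
      no-branch i j k li lj lk ij ik jk {κ} (lκ , a , d) (_ , a' , _) lt =
        let (t , lt' , l1 , l2) = fr i j k li lj lk ij ik jk in
        <irr (<t l2 (st t (dec p j) (dec p i) κ (dec p k) (dec p i) lt' (pX j lj) (pX i li) lκ a d (pX k lk) (pX i li) (agree-≤ lt a') agree-refl l1))

      equal : ∀ i j k → i < m → j < m → k < m → i ≢ j → i ≢ k → j ≢ k → ∀ {κ κ'} → Split κ (dec p j) (dec p i) → Split κ' (dec p j) (dec p k) → κ ≡ κ'
      equal i j k li lj lk ij ik jk sp sp' = ≤a (≮⇒≥ (no-branch k j i lk lj li (λ e → jk (sym e)) (λ e → ik (sym e)) (λ e → ij (sym e)) sp' sp)) (≮⇒≥ (no-branch i j k li lj lk ij ik jk sp sp'))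

      l0 : z < m
      l0 = <≤t 0<s m≥3
      l1 : s z < m
      l1 = <≤t (s≤s 0<s) m≥3
      0≢1 : z ≢ s z
      0≢1 e = s≢0 (sym e)

      κ₀ : Σ C (λ κ → Split κ (dec p z) (dec p (s z)))
      κ₀ = level z (s z) l0 l1 0≢1

      from0 : ∀ i → i < m → z ≢ i → Split (proj₁ κ₀) (dec p z) (dec p i)
      from0 i li ne = go (lem (i ≡ s z)) (level z i l0 li ne)
        where
        go : (i ≡ s z) ⊎ ¬ (i ≡ s z) → Σ C (λ κ → Split κ (dec p z) (dec p i)) → Split (proj₁ κ₀) (dec p z) (dec p i)
        go (inj₁ refl) _ = proj₂ κ₀
        go (inj₂ n1) (κ , sp) = subst (λ t → Split t (dec p z) (dec p i)) (sym (equal (s z) z i l1 l0 li (λ e → 0≢1 (sym e)) (λ e → n1 (sym e)) ne (proj₂ κ₀) sp)) sp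

      all-split : ∀ i j → i < m → j < m → i ≢ j → Split (proj₁ κ₀) (dec p i) (dec p j)
      all-split i j li lj ne = go (lem (i ≡ z)) (lem (j ≡ z)) (level i j li lj ne)
        where
        go : (i ≡ z) ⊎ ¬ (i ≡ z) → (j ≡ z) ⊎ ¬ (j ≡ z) → Σ C (λ κ → Split κ (dec p i) (dec p j)) → Split (proj₁ κ₀) (dec p i) (dec p j)
        go (inj₁ refl) _ _ = from0 j lj ne
        go (inj₂ ni) (inj₁ refl) _ = split-sym (from0 i li (λ e → ni (sym e)))
        go (inj₂ ni) (inj₂ nj) (κ , sp) = subst (λ t → Split t (dec p i) (dec p j))
          (sym (equal z i j l0 li lj (λ e → ni (sym e)) (λ e → nj (sym e)) ne (split-sym (from0 i li (λ e → ni (sym e)))) sp)) sp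

    In : C → C → C → Set
    In p m X = ∀ i → i < m → Mem (dec p i) X

    -- The content of `phi` with everything except `d` read in M: a neighbourhood is a coded set
    -- that contains almost all values of `d`.
    Phi : C → Set
    Phi x = J x × Σ CN (λ d → Σ C (λ g → Σ C (λ n → J n ×
      ((∀ X → Ev (λ y → Mem (dec (proj₁ d) y) X) → Σ C (λ p → Free g n p (x + c4) × In p (x + c4) X)) ×
       (∀ g' n' → J n' → Σ C (λ X → Ev (λ y → Mem (dec (proj₁ d) y) X) ×
          (∀ p q → Free g n p (x + c4) → In p (x + c4) X → Free g' n' q (s (x + c4)) → In q (s (x + c4)) X → (∀ i → i < x + c4 → dec p i ≡ dec q i) → ⊥)))))))

    digit< : ∀ i {x κ} → Mem x (XX i) → κ < ℓ → dec x κ < dec τ κ + c3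
    digit< i {x} {κ} m l = proj₂ (proj₁ (proj₂ Acode x) (X⊆A (cs i) x m)) κ l

    XX<b : ∀ i {x} → Mem x (XX i) → x < b
    XX<b i m = A<b (X⊆A (cs i) _ m)

    idf : Σ C (λ f → (x : C) → x < b → dec f x ≡ x)
    idf = code b (λ x → x) (DFvar _)

    -- The number of orders: orders are indexed by codes of triples below `m`, and with `m` this
    -- bound stays in J.
    triples : C → C
    triples m = s (pair m (pair m m))

    triple< : ∀ {m a a' a''} → a < m → a' < m → a'' < m → pair a (pair a' a'') < triples m
    triple< p q r' = s≤s (pm (<⇒≤ p) (pm (<⇒≤ q) (<⇒≤ r')))
      where
      pm : ∀ {x y x' y'} → x ≤ x' → y ≤ y' → pair x y ≤ pair x' y'
      pm p q = +mono (*mono (+mono p q) (+mono p q)) p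

    Jpair : ∀ {x y} → J x → J y → J (pair x y)
    Jpair p q = J+ (J* (J+ p q) (J+ p q)) p

    Jtriples : ∀ {m} → J m → J (triples m)
    Jtriples j = Js (Jpair j (Jpair j j))

    digits : ∀ p m κ → Σ C (λ D → (i : C) → i < m → dec D i ≡ dec (dec p i) κ)
    digits p m κ = code m (λ i → dec (dec p i) κ) (DFdec (DFdec (DFcon _) (DFvar _)) (DFcon _))

    arity≥ : ∀ i p m κ → κ < ℓ → In p m (XX i) → (∀ a c → a < m → c < m → a ≢ c → dec (dec p a) κ ≢ dec (dec p c) κ) → m ≤ dec τ κ + c3
    arity≥ i p m κ l pX ne = let (D , h) = digits p m κ in
      php m (dec τ κ + c3) D (λ a la → ≤t (≡⇒≤ (cong s (h a la))) (digit< i (pX a la) l))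
        (λ a c la lc e → dne (λ n → ne a c la lc n (trans (sym (h a la)) (trans e (h c lc)))))

  -- Which elements satisfy `Phi`.

  module Coding (J : C → Set) (cut : IsCut M J) (expc : ExpClosed M J) (I : ℕ → Set) (cnt : Countable M) where
    open Decode J cut expc I cnt public

    module LexFree (Sel : C → C → C → Set) (dSel : Dfn 3 (λ ρ → Sel (ρ zero) (ρ (suc zero)) (ρ (suc (suc zero)))))
      (Sel-fun : ∀ {κ x q q'} → Sel κ x q → Sel κ x q' → q ≡ q')
      (Sel-inv : ∀ {κ x y q} → agree κ x y → Sel κ x q → Sel κ y q) (m : C) where
      open Lex ℓ b Sel dSel Sel-fun Sel-inv public

      n g : C
      n = triples m
      g = proj₁ (orders n)

      ordered : ∀ {t κ x y} → t < n → κ < ℓ → x < b → y < b → agree κ x y → δ t κ x < δ t κ y → Ord g t x < Ord g t y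
      ordered lt lκ lx ly a d = proj₂ (orders n) _ lt _ _ _ lκ lx ly a d

      free : ∀ {κ x q v} → κ < ℓ → Sel κ x q → (∀ i → i < m → dec v i < b × (agree κ x (dec v i) × (dec (dec v i) κ ≡ dec q i))) →
             (∀ i j → i < m → j < m → i ≢ j → dec q i ≢ dec q j) → Free g n v m
      free {κ} {x} {q} {v} lκ sl pts ne i j k li lj lk ij ik jk = t , lt ,
          ordered lt lκ (proj₁ (pts j lj)) (proj₁ (pts i li)) (agree-trans (agree-sym (ag j lj)) (ag i li)) (subst₂ _<_ (sym dj) (sym di) <s) ,
          ordered lt lκ (proj₁ (pts i li)) (proj₁ (pts k lk)) (agree-trans (agree-sym (ag i li)) (ag k lk)) (subst₂ _<_ (sym di) (sym dk) <s)
        where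
        t : C
        -- In the order with this index the digits with numbers `j`, `i`, `k` come first, in this
        -- sequence.
        t = pair j (pair i k)
        lt : t < n
        lt = triple< lj li lk
        ag : ∀ u → u < m → agree κ x (dec v u)
        ag u lu = proj₁ (proj₂ (pts u lu))
        dj : δ t κ (dec v j) ≡ z
        dj = lex-sel (Sel-inv (ag j lj) sl) (proj₂ (proj₂ (pts j lj)))
        di : δ t κ (dec v i) ≡ s z
        di = lex-sel' (Sel-inv (ag i li) sl) (ne i j li lj ij) (proj₂ (proj₂ (pts i li)))
        dk : δ t κ (dec v k) ≡ s (s z)
        dk = lex-sel'' (Sel-inv (ag k lk) sl) (ne k j lk lj (λ e → jk (sym e))) (ne k i lk li (λ e → ik (sym e))) (proj₂ (proj₂ (pts k lk)))

    arity-eq : ∀ x → s x + c3 ≡ x + c4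
    arity-eq x = trans (s+ x c3) (sym (+s x c3))

    c3≤ : ∀ x → c3 ≤ x + c4
    c3≤ x = ≤t ≤s (≤+' x)

    module Truth (k : ℕ) (ik : I k) where
      x σ m : C
      x = num M k
      σ = s x
      m = x + c4

      Jm : J m
      Jm = J+ (Jnum k) (Js J3)

      idc : Σ C (λ c → (i : C) → i < m → dec c i ≡ i)
      idc = code m (λ i → i) (DFvar _)

      Sel : C → C → C → Set
      Sel κ y q = (dec τ κ ≡ σ) × (q ≡ proj₁ idc)

      dSel : Dfn 3 (λ ρ → Sel (ρ zero) (ρ (suc zero)) (ρ (suc (suc zero))))
      dSel = D× (D≡ (DFdec (DFcon τ) (DFvar zero)) (DFcon σ)) (D≡ (DFvar (suc (suc zero))) (DFcon (proj₁ idc)))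

      module L = LexFree Sel dSel (λ p q → trans (proj₂ p) (sym (proj₂ q))) (λ _ p → p) m

      -- The type `σ` that codes `k` stays in every condition, so each set of the ultrafilter meets
      -- all cones below the children of some node of this type.
      partA : ∀ Y → Ev (λ y → Mem (dec (proj₁ gen) y) Y) → Σ C (λ p → Free L.g L.n p m × In p m Y)
      partA Y ev = go (Ev-map (λ y _ (p , e) → subst (λ t → Mem t Y) e p) (Ev-× ev gen-val))
        where
        go : Ev (λ y → Mem y Y) → Σ C (λ p → Free L.g L.n p m × In p m Y)
        go (i , h) = fin (full-node (cs i) (I⊆Q (cs i) σ (inj₂ (k , ik , refl))))
          where
          fin : Σ C (λ κ → Σ C (λ y → (κ < ℓ × (dec τ κ ≡ σ)) × (∀ j → j < σ + c3 → Σ C (λ v → Mem v (XX i) × (agree κ y v × (dec v κ ≡ j)))))) → Σ C (λ p → Free L.g L.n p m × In p m Y)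
          fin (κ , y , (lκ , t) , kids) = p , L.free {κ} {y} {proj₁ idc} lκ (t , refl)
                (λ j lj → XX<b i (proj₁ (pv j lj)) , proj₁ (proj₂ (pv j lj)) , trans (proj₂ (proj₂ (pv j lj))) (sym (proj₂ idc j lj)))
                (λ a c la lc ne e → ne (trans (sym (proj₂ idc a la)) (trans e (proj₂ idc c lc)))) ,
              λ j lj → h _ (proj₁ (pv j lj))
            where
            cd : Σ C (λ p → (j : C) → j < m → Mem (dec p j) (XX i) × (agree κ y (dec p j) × (dec (dec p j) κ ≡ j)))
            cd = code-rel m (λ j v → Mem v (XX i) × (agree κ y v × (dec v κ ≡ j))) (D× (D-Mem (DFvar _) (DFcon _)) (D× (D-agree (DFcon _) (DFcon _) (DFvar _)) (D≡ (DFdec (DFvar _) (DFcon _)) (DFvar _)))) (λ j lj → kids j (≤t lj (≡⇒≤ (sym (arity-eq x)))))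
            p : C
            p = proj₁ cd
            pv : (j : C) → j < m → Mem (dec p j) (XX i) × (agree κ y (dec p j) × (dec (dec p j) κ ≡ j))
            pv = proj₂ cd

      -- A set of `m + 1` points that is free for the rival orders lies across a node with more than
      -- `m` children, hence not of type `σ`. There the orders `L.g` all coincide, and three points
      -- cannot be free for them.
      partB : ∀ g' n' → J n' → Σ C (λ Y → Ev (λ y → Mem (dec (proj₁ gen) y) Y) ×
          (∀ p q → Free L.g L.n p m → In p m Y → Free g' n' q (s m) → In q (s m) Y → (∀ i → i < m → dec p i ≡ dec q i) → ⊥))
      -- The values of `gen` are the leaves, so `f` is the identity; `w₀` fills the place of a type
      -- that does not come from I.
      partB g' n' jn = go (handle (pair f (pair g' (pair n' w₀))))
        where
        f : C
        f = proj₁ idf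
        go : Σ ℕ (λ i → Handled (pair f (pair g' (pair n' w₀))) (cs i)) → Σ C (λ Y → Ev (λ y → Mem (dec (proj₁ gen) y) Y) ×
          (∀ p q → Free L.g L.n p m → In p m Y → Free g' n' q (s m) → In q (s m) Y → (∀ i → i < m → dec p i ≡ dec q i) → ⊥))
        go (i , hd) = XX i , Ev-map (λ y _ (e , mm) → subst (λ t → Mem t (XX i)) (sym e) mm) (Ev-× gen-val (i , λ y mm → mm)) , bad
          where
          st : StableF f g' n' (XX i)
          st = proj₂ (proj₂ (h-align hd f g' n' w₀ refl jn (λ h → w₀∉ (InI-J h))))
          bad : ∀ p q → Free L.g L.n p m → In p m (XX i) → Free g' n' q (s m) → In q (s m) (XX i) → (∀ i → i < m → dec p i ≡ dec q i) → ⊥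
          bad p q fp pX fq qX pq = fin (lem (dec τ κ ≡ σ))
            where
            idq : ∀ j → j < s m → dec f (dec q j) ≡ dec q j
            idq j lj = proj₂ idf _ (XX<b i (qX j lj))
            fq' : ∀ a c d → a < s m → c < s m → d < s m → a ≢ c → a ≢ d → c ≢ d →
                  Σ C (λ t → t < n' × (Ord g' t (dec f (dec q c)) < Ord g' t (dec f (dec q a)) × Ord g' t (dec f (dec q a)) < Ord g' t (dec f (dec q d))))
            fq' a c d la lc ld ac ad cd = let (t , lt , u , v) = fq a c d la lc ld ac ad cd in
                t , lt , subst₂ (λ y w → Ord g' t y < Ord g' t w) (sym (idq c lc)) (sym (idq a la)) u , subst₂ (λ y w → Ord g' t y < Ord g' t w) (sym (idq a la)) (sym (idq d ld)) v
            module T = Transversal (XX i) f g' n' q (s m) (h-uniq hd) st (≤t (c3≤ x) ≤s) qX fq'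
            κ : C
            κ = proj₁ T.κ₀
            lκ : κ < ℓ
            lκ = proj₁ (proj₂ T.κ₀)
            ar : s m ≤ dec τ κ + c3
            ar = arity≥ i q (s m) κ lκ qX (λ a c la lc ne → proj₂ (proj₂ (T.all-split a c la lc ne)))
            l0 : z < m
            l0 = <≤t 0<s (c3≤ x)
            l1 : s z < m
            l1 = <≤t (s≤s 0<s) (c3≤ x)
            l2 : s (s z) < m
            l2 = c3≤ x
            0≢1 : z ≢ s z
            0≢1 e = s≢0 (sym e)
            0≢2 : z ≢ s (s z)
            0≢2 e = s≢0 (sym e)
            1≢2 : s z ≢ s (s z)
            1≢2 e = 0≢1 (s-inj e)
            sp : Split κ (dec p z) (dec p (s z))
            sp = subst₂ (Split κ) (sym (pq z l0)) (sym (pq (s z) l1)) (proj₂ T.κ₀)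
            fin : (dec τ κ ≡ σ) ⊎ ¬ (dec τ κ ≡ σ) → ⊥
            fin (inj₁ e) = <irr (≤t ar (≡⇒≤ (trans (cong (_+ c3) e) (arity-eq x))))
            fin (inj₂ n) = cs' (≢⇒<> (proj₂ (proj₂ sp)))
              where
              dd : ∀ y t → L.δ t κ y ≡ dec y κ
              dd y t = L.lex-other (λ { (_ , (e , _)) → n e })
              lt-all : ∀ y w t → t < L.n → y < b → w < b → agree κ y w → dec y κ < dec w κ → Ord L.g t y < Ord L.g t w
              lt-all y w t lt ly lw a d = L.ordered lt lκ ly lw a (subst₂ _<_ (sym (dd y t)) (sym (dd w t)) d)
              -- All the orders list two points by their digits at `κ`, while freeness yields an
              -- order for either direction.
              cs' : dec (dec p z) κ < dec (dec p (s z)) κ ⊎ dec (dec p (s z)) κ < dec (dec p z) κ → ⊥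
              cs' (inj₁ d) = let (t , lt , u , _) = fp z (s z) (s (s z)) l0 l1 l2 0≢1 0≢2 1≢2 in
                <irr (<t u (lt-all _ _ t lt (XX<b i (pX z l0)) (XX<b i (pX (s z) l1)) (proj₁ (proj₂ sp)) d))
              cs' (inj₂ d) = let (t , lt , u , _) = fp (s z) z (s (s z)) l1 l0 l2 (λ e → 0≢1 (sym e)) 1≢2 0≢2 in
                <irr (<t u (lt-all _ _ t lt (XX<b i (pX (s z) l1)) (XX<b i (pX z l0)) (agree-sym (proj₁ (proj₂ sp))) d))

      truth : Phi x
      truth = Jnum k , gen , L.g , L.n , Jtriples Jm , partA , partB

    -- Elements of J outside I do not satisfy `Phi`.

    module Falsity (x : C) (Jx : J x) (nI : ¬ Σ ℕ (λ k → (num M k ≡ x) × I k)) (d : CN) (g n : C) (Jn : J n)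
      (pA : ∀ X → Ev (λ y → Mem (dec (proj₁ d) y) X) → Σ C (λ p → Free g n p (x + c4) × In p (x + c4) X))
      (pB : ∀ g' n' → J n' → Σ C (λ X → Ev (λ y → Mem (dec (proj₁ d) y) X) ×
          (∀ p q → Free g n p (x + c4) → In p (x + c4) X → Free g' n' q (s (x + c4)) → In q (s (x + c4)) X → (∀ i → i < x + c4 → dec p i ≡ dec q i) → ⊥))) where
      f σ m : C
      f = proj₁ d
      σ = s x
      m = x + c4

      Jm : J m
      Jm = J+ Jx (Js J3)

      σ∉ : ¬ InI σ
      σ∉ (inj₁ e) = s≢0 e
      σ∉ (inj₂ (k , ik , e)) = nI (k , sym (s-inj e) , ik)

      st0 : Σ ℕ (λ i → Handled (pair f (pair g (pair n σ))) (cs i))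
      st0 = handle (pair f (pair g (pair n σ)))

      i₀ : ℕ
      i₀ = proj₁ st0
      Xi : C
      Xi = XX i₀
      hd : Handled (pair f (pair g (pair n σ))) (cs i₀)
      hd = proj₂ st0
      al : ¬ Mem σ (Q (cs i₀)) × ((ConstOn f Xi ⊎ Injective f Xi) × StableF f g n Xi)
      al = h-align hd f g n σ refl Jn σ∉

      l0 : z < m
      l0 = <≤t 0<s (c3≤ x)
      l1 : s z < m
      l1 = <≤t (s≤s 0<s) (c3≤ x)
      l2 : s (s z) < m
      l2 = c3≤ x
      0≢1 : z ≢ s z
      0≢1 e = s≢0 (sym e)
      0≢2 : z ≢ s (s z)
      0≢2 e = s≢0 (sym e)
      1≢2 : s z ≢ s (s z)
      1≢2 e = 0≢1 (s-inj e)

      -- With `f` constant a singleton would be a neighbourhood of `d`, and it contains no free set.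
      not-const : ¬ ConstOn f Xi
      not-const (a , h) = fin (comp (s a) (λ y → y ≡ a) (D≡ (DFvar _) (DFcon _)))
        where
        fin : Σ C (λ Y → (y : C) → (Mem y Y → y < s a × (y ≡ a)) × (y < s a × (y ≡ a) → Mem y Y)) → ⊥
        fin (Y , hY) = let (p , fr , pY) = pA Y (i₀ , λ y my → proj₂ (hY _) (≤t (≡⇒≤ (cong s (h y my))) ≤r , h y my))
                           (t , _ , u , _) = fr z (s z) (s (s z)) l0 l1 l2 0≢1 0≢2 1≢2
                       in <≢ u (cong (Ord g t) (trans (proj₂ (proj₁ (hY _) (pY (s z) l1))) (sym (proj₂ (proj₁ (hY _) (pY z l0))))))

      inj : Injective f Xi
      inj = go (proj₁ (proj₂ al))
        where
        go : ConstOn f Xi ⊎ Injective f Xi → Injective f Xi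
        go (inj₁ c) = ⊥-elim (not-const c)
        go (inj₂ h) = h

      -- q lists the digits of a free set across the node, followed by a further digit.
      Good' : C → C → C → Set
      Good' κ x q = Σ C (λ p → ((i : C) → i < m → Mem (dec p i) Xi × (agree κ x (dec p i) × (dec q i ≡ dec (dec p i) κ))) × (((i : C) → (j : C) → i < m → j < m → i ≢ j → dec q i ≢ dec q j) × (((i : C) → (j : C) → (k : C) → i < m → j < m → k < m → i ≢ j → i ≢ k → j ≢ k → Σ C (λ t → t < n × (dec (dec g t) (dec f (dec p j)) < dec (dec g t) (dec f (dec p i)) × dec (dec g t) (dec f (dec p i)) < dec (dec g t) (dec f (dec p k))))) × ((dec q m < dec τ κ + c3) × ((i : C) → i < m → dec q m ≢ dec q i)))))

      dGood : Dfn 3 (λ ρ → Good' (ρ zero) (ρ (suc zero)) (ρ (suc (suc zero))))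
      dGood = D∃ (D× (D∀ (D→ (D< (DFvar _) (DFcon _)) (D× (D-Mem (DFdec (DFvar _) (DFvar _)) (DFcon _)) (D× (D-agree (DFvar _) (DFvar _) (DFdec (DFvar _) (DFvar _))) (D≡ (DFdec (DFvar _) (DFvar _)) (DFdec (DFdec (DFvar _) (DFvar _)) (DFvar _))))))) (D× (D∀ (D∀ (D→ (D< (DFvar _) (DFcon _)) (D→ (D< (DFvar _) (DFcon _)) (D→ (D≢ (DFvar _) (DFvar _)) (D≢ (DFdec (DFvar _) (DFvar _)) (DFdec (DFvar _) (DFvar _)))))))) (D× (D∀ (D∀ (D∀ (D→ (D< (DFvar _) (DFcon _)) (D→ (D< (DFvar _) (DFcon _)) (D→ (D< (DFvar _) (DFcon _)) (D→ (D≢ (DFvar _) (DFvar _)) (D→ (D≢ (DFvar _) (DFvar _)) (D→ (D≢ (DFvar _) (DFvar _)) (D∃ (D× (D< (DFvar _) (DFcon _)) (D× (D< (DFdec (DFdec (DFcon _) (DFvar _)) (DFdec (DFcon _) (DFdec (DFvar _) (DFvar _)))) (DFdec (DFdec (DFcon _) (DFvar _)) (DFdec (DFcon _) (DFdec (DFvar _) (DFvar _))))) (D< (DFdec (DFdec (DFcon _) (DFvar _)) (DFdec (DFcon _) (DFdec (DFvar _) (DFvar _)))) (DFdec (DFdec (DFcon _) (DFvar _)) (DFdec (DFcon _) (DFdec (DFvar _) (DFvar _))))))))))))))))) (D× (D< (DFdec (DFvar _) (DFcon _)) (DF⊕ (DFdec (DFcon _) (DFvar _)) (DFcon _))) (D∀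 (D→ (D< (DFvar _) (DFcon _)) (D≢ (DFdec (DFvar _) (DFcon _)) (DFdec (DFvar _) (DFvar _)))))))))

      -- `pB` reveals its neighbourhood only after the orders are given, so these cannot refer to a
      -- free set found there. The least `q` depends on the node and on `Xi` only, and works
      -- wherever the free set will appear.
      Sel : C → C → C → Set
      Sel κ x q = Good' κ x q × ((q' : C) → q' < q → ¬ Good' κ x q')

      dSel : Dfn 3 (λ ρ → Sel (ρ zero) (ρ (suc zero)) (ρ (suc (suc zero))))
      dSel = D× dGood (D∀ (D→ (D< (DFvar zero) (DFvar (suc (suc (suc zero))))) (D¬ (rel3 {R = Good'} dGood (DFvar (suc zero)) (DFvar (suc (suc zero))) (DFvar zero)))))

      Good-inv : ∀ {κ x y q} → agree κ x y → Good' κ x q → Good' κ y q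
      Good-inv a (p , h , r') = p , (λ i li → let (u , v , w) = h i li in u , agree-trans (agree-sym a) v , w) , r'

      Sel-fun : ∀ {κ x q q'} → Sel κ x q → Sel κ x q' → q ≡ q'
      Sel-fun {κ} {x} {q} {q'} (p , l) (p' , l') with tri q q'
      ... | inj₁ lt = ⊥-elim (l' q lt p)
      ... | inj₂ (inj₁ e) = e
      ... | inj₂ (inj₂ lt) = ⊥-elim (l q' lt p')

      Sel-inv : ∀ {κ x y q} → agree κ x y → Sel κ x q → Sel κ y q
      Sel-inv a (p , l) = Good-inv a p , λ q' lt p' → l q' lt (Good-inv (agree-sym a) p')

      module L = LexFree Sel dSel Sel-fun Sel-inv (s m)

      -- Rival orders must compare values of `d`; since `f` is injective on `Xi`, the orders of
      -- leaves factor through it.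
      transport : Σ C (λ g' → (t : C) → t < L.n → (y : C) → Mem y Xi → dec (dec g' t) (dec f y) ≡ dec (dec L.g t) y)
      transport = code-rel L.n (λ t h → (y : C) → Mem y Xi → dec h (dec f y) ≡ dec (dec L.g t) y) (D∀ (D→ (D-Mem (DFvar _) (DFcon _)) (D≡ (DFdec (DFvar _) (DFdec (DFcon _) (DFvar _))) (DFdec (DFdec (DFcon _) (DFvar _)) (DFvar _))))) (λ t _ → one t)
        where
        bd : Σ C (λ B → (y : C) → y < b → Σ C (λ w → w < B × (w ≡ dec f y)))
        bd = coll b (λ y w → w ≡ dec f y) (D≡ (DFvar _) (DFdec (DFcon _) (DFvar _))) (λ y _ → dec f y , refl)
        one : ∀ t → Σ C (λ h → (y : C) → Mem y Xi → dec h (dec f y) ≡ dec (dec L.g t) y)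
        one t = fin (code-rel (proj₁ bd) (λ w v → (y : C) → Mem y Xi → w ≡ dec f y → v ≡ dec (dec L.g t) y) (D∀ (D→ (D-Mem (DFvar _) (DFcon _)) (D→ (D≡ (DFvar _) (DFdec (DFcon _) (DFvar _))) (D≡ (DFvar _) (DFdec (DFcon _) (DFvar _)))))) (λ w _ → tot w (lem _)))
          where
          tot : ∀ w → Σ C (λ y → Mem y Xi × (w ≡ dec f y)) ⊎ ¬ Σ C (λ y → Mem y Xi × (w ≡ dec f y)) → Σ C (λ v → (y : C) → Mem y Xi → w ≡ dec f y → v ≡ dec (dec L.g t) y)
          tot w (inj₁ (y , my , e)) = dec (dec L.g t) y , λ y' my' e' → cong (dec (dec L.g t)) (inj y y' my my' (trans (sym e) e'))
          tot w (inj₂ none) = z , λ y my e → ⊥-elim (none (y , my , e))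
          fin : Σ C (λ h → (w : C) → w < proj₁ bd → (y : C) → Mem y Xi → w ≡ dec f y → dec h w ≡ dec (dec L.g t) y) → Σ C (λ h → (y : C) → Mem y Xi → dec h (dec f y) ≡ dec (dec L.g t) y)
          fin (h , e) = h , λ y my → e (dec f y) (let (w , lw , e') = proj₂ bd y (XX<b i₀ my) in ≤t (≡⇒≤ (cong s (sym e'))) lw) y my refl

      g' : C
      g' = proj₁ transport

      Xb : Σ C (λ X → Ev (λ y → Mem (dec f y) X) ×
          (∀ p q → Free g n p m → In p m X → Free g' L.n q (s m) → In q (s m) X → (∀ i → i < m → dec p i ≡ dec q i) → ⊥))
      Xb = pB g' L.n (Jtriples (Js Jm))

      -- Late enough that `X1` lies in `Xi` and that `f` maps it into the neighbourhood given by
      -- `pB`; fullness is available at every stage, so also at this one.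
      i₁ : ℕ
      i₁ = i₀ ⊔ proj₁ (proj₁ (proj₂ Xb))

      X1 : C
      X1 = XX i₁

      X1⊆ : X1 ⊆ Xi
      X1⊆ = XX-mono (ℕₚ.m≤m⊔n i₀ _)

      X1b : ∀ y → Mem y X1 → Mem (dec f y) (proj₁ Xb)
      X1b y my = proj₂ (proj₁ (proj₂ Xb)) y (XX-mono (ℕₚ.m≤n⊔m i₀ _) y my)

      Q-mono : ∀ {i j} → i ≤ℕ j → Q (cs j) ⊆ Q (cs i)
      Q-mono {i} {j} l = go (ℕₚ.≤⇒≤′ l)
        where
        open import Data.Nat using (_≤′_; ≤′-reflexive; ≤′-step)
        go : ∀ {j} → i ≤′ j → Q (cs j) ⊆ Q (cs i)
        go (≤′-reflexive refl) y mm = mm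
        go (≤′-step {j} l) y mm = go l y (proj₂ (cs-suc j) y mm)

      σ∉1 : ¬ Mem σ (Q (cs i₁))
      σ∉1 mm = proj₁ al (Q-mono (ℕₚ.m≤m⊔n i₀ _) σ mm)

      img : Σ C (λ Y → (y : C) → (Mem y Y → Σ C (λ v → Mem v X1 × (dec f v ≡ y))) × (Σ C (λ v → Mem v X1 × (dec f v ≡ y)) → Mem y Y))
      img = fin (coll b (λ y w → w ≡ dec f y) (D≡ (DFvar _) (DFdec (DFcon _) (DFvar _))) (λ y _ → dec f y , refl))
        where
        fin : Σ C (λ B → (y : C) → y < b → Σ C (λ w → w < B × (w ≡ dec f y))) → Σ C (λ Y → (y : C) → (Mem y Y → Σ C (λ v → Mem v X1 × (dec f v ≡ y))) × (Σ C (λ v → Mem v X1 × (dec f v ≡ y)) → Mem y Y))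
        fin (B , h) = let (Y , k) = comp B (λ y → Σ C (λ v → Mem v X1 × (dec f v ≡ y))) (D∃ (D× (D-Mem (DFvar _) (DFcon _)) (D≡ (DFdec (DFcon _) (DFvar _)) (DFvar _)))) in
          Y , λ y → (λ mm → proj₂ (proj₁ (k y) mm)) , λ { (v , mv , refl) → proj₂ (k _) ((let (w , lw , e) = h v (XX<b i₁ mv) in ≤t (≡⇒≤ (cong s (sym e))) lw) , v , mv , refl) }

      p₀ : Σ C (λ p → Free g n p m × In p m (proj₁ img))
      p₀ = pA (proj₁ img) (i₁ , λ y my → proj₂ (proj₂ img _) (y , my , refl))

      pull : Σ C (λ p → (i : C) → i < m → Mem (dec p i) X1 × (dec f (dec p i) ≡ dec (proj₁ p₀) i))
      pull = code-rel m (λ i v → Mem v X1 × (dec f v ≡ dec (proj₁ p₀) i)) (D× (D-Mem (DFvar _) (DFcon _)) (D≡ (DFdec (DFcon _) (DFvar _)) (DFdec (DFcon _) (DFvar _)))) (λ i li → proj₁ (proj₂ img _) (proj₂ (proj₂ p₀) i li))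

      p : C
      p = proj₁ pull

      pX : In p m Xi
      pX i li = X1⊆ _ (proj₁ (proj₂ pull i li))

      FreeF : C → Set
      FreeF p = ((i : C) → (j : C) → (k : C) → i < m → j < m → k < m → i ≢ j → i ≢ k → j ≢ k → Σ C (λ t → t < n × (dec (dec g t) (dec f (dec p j)) < dec (dec g t) (dec f (dec p i)) × dec (dec g t) (dec f (dec p i)) < dec (dec g t) (dec f (dec p k)))))

      p-free : FreeF p
      p-free i j k li lj lk ij ik jk = let (t , lt , u , v) = proj₁ (proj₂ p₀) i j k li lj lk ij ik jk in
        t , lt , subst₂ (λ y w → Ord g t y < Ord g t w) (e j lj) (e i li) u , subst₂ (λ y w → Ord g t y < Ord g t w) (e i li) (e k lk) v
        where
        e : ∀ i → i < m → dec (proj₁ p₀) i ≡ dec f (dec p i)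
        e i li = sym (proj₂ (proj₂ pull i li))

      module T = Transversal Xi f g n p m (h-uniq hd) (proj₂ (proj₂ al)) (c3≤ x) pX p-free

      κ : C
      κ = proj₁ T.κ₀
      lκ : κ < ℓ
      lκ = proj₁ (proj₂ T.κ₀)
      x1 : C
      x1 = dec p z

      fullness : Mem (dec τ κ) (Q (cs i₁)) × (∀ j → j < dec τ κ + c3 → Σ C (λ v → Mem v X1 × (agree κ x1 v × (dec v κ ≡ j))))
      fullness = h-full (handled i₁) x1 (dec p (s z)) κ (proj₁ (proj₂ pull z l0)) (proj₁ (proj₂ pull (s z) l1)) lκ (proj₁ (proj₂ (proj₂ T.κ₀))) (proj₂ (proj₂ (proj₂ T.κ₀)))

      -- The free set has at most one point below each child of the node. If it met all children,
      -- the type of the node would be `σ`, which was removed by stage `i₀`.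
      m<ar : m < dec τ κ + c3
      m<ar = go (≤⇒<⊎≡ (arity≥ i₀ p m κ lκ pX (λ a c la lc ne → proj₂ (proj₂ (T.all-split a c la lc ne)))))
        where
        go : m < dec τ κ + c3 ⊎ m ≡ dec τ κ + c3 → m < dec τ κ + c3
        go (inj₁ l) = l
        go (inj₂ e) = ⊥-elim (σ∉1 (subst (λ t → Mem t (Q (cs i₁))) (+cancelʳ c3 (trans (sym e) (sym (arity-eq x)))) (proj₁ fullness)))

      agp : ∀ i → i < m → agree κ x1 (dec p i)
      agp i li = go (lem (z ≡ i))
        where
        go : (z ≡ i) ⊎ ¬ (z ≡ i) → agree κ x1 (dec p i)
        go (inj₁ refl) = agree-refl
        go (inj₂ ne) = proj₁ (proj₂ (T.all-split z i l0 li ne))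

      good : Σ C (Good' κ x1)
      good = fin (digits p m κ)
        where
        fin : Σ C (λ D → (i : C) → i < m → dec D i ≡ dec (dec p i) κ) → Σ C (Good' κ x1)
        -- Some number up to `m` is not among the digits of the free set; as there are more than `m`
        -- children, it is the digit of a child.
        fin (D , hD) = fin2 (missed m D)
          where
          fin2 : Σ C (λ j → j ≤ m × ((i : C) → i < m → dec D i ≢ j)) → Σ C (Good' κ x1)
          fin2 (j , j≤m , nj) = fin3 (code-rel (s m) (λ i v → ((i < m) × (v ≡ dec D i)) ⊎ ((i ≡ m) × (v ≡ j))) (D⊎ (D× (D< (DFvar _) (DFcon _)) (D≡ (DFvar _) (DFdec (DFcon _) (DFvar _)))) (D× (D≡ (DFvar _) (DFcon _)) (D≡ (DFvar _) (DFcon _)))) (λ i li → tot i (<s⇒ li)))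
            where
            tot : ∀ i → i < m ⊎ i ≡ m → Σ C (λ v → ((i < m) × (v ≡ dec D i)) ⊎ ((i ≡ m) × (v ≡ j)))
            tot i (inj₁ l) = dec D i , inj₁ (l , refl)
            tot i (inj₂ e) = j , inj₂ (e , refl)
            fin3 : Σ C (λ q → (i : C) → i < s m → ((i < m) × (dec q i ≡ dec D i)) ⊎ ((i ≡ m) × (dec q i ≡ j))) → Σ C (Good' κ x1)
            fin3 (q , hq) = q , p , (λ i li → pX i li , agp i li , trans (lo i li) (hD i li)) ,
                (λ i i' li li' ne e → proj₂ (proj₂ (T.all-split i i' li li' ne)) (trans (sym (hD i li)) (trans (sym (lo i li)) (trans e (trans (lo i' li') (hD i' li')))))) ,
                p-free , ≤<t (≤t (≡⇒≤ hi) j≤m) m<ar , λ i li e → nj i li (trans (sym (lo i li)) (trans (sym e) hi))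
              where
              lo : ∀ i → i < m → dec q i ≡ dec D i
              lo i li = go (hq i (<t li <s))
                where
                go : ((i < m) × (dec q i ≡ dec D i)) ⊎ ((i ≡ m) × (dec q i ≡ j)) → dec q i ≡ dec D i
                go (inj₁ (_ , e)) = e
                go (inj₂ (e , _)) = ⊥-elim (<≢ li e)
              hi : dec q m ≡ j
              hi = go (hq m <s)
                where
                go : ((m < m) × (dec q m ≡ dec D m)) ⊎ ((m ≡ m) × (dec q m ≡ j)) → dec q m ≡ j
                go (inj₁ (l , _)) = ⊥-elim (<irr l)
                go (inj₂ (_ , e)) = e

      sel : Σ C (Sel κ x1)
      sel = lnp (Good' κ x1) (rel3 {R = Good'} dGood (DFcon κ) (DFcon x1) (DFvar zero)) (proj₁ good) (proj₂ good)

      absurd : ⊥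
      absurd = fin sel
        where
        fin : Σ C (Sel κ x1) → ⊥
        -- The selected `q` may list the digits of another free set `P` than `p`. Only digits
        -- matter: points of `X1` with the digits in `q` inherit from `P`, by stability, that the
        -- first `m` of them are free for `g`, and all `m + 1` are free for the lexicographic
        -- orders.
        fin (q , sl@((P , hP , qne , frP , qm , qmne) , _)) = proj₂ (proj₂ Xb) p* q* p*-free (λ i li → subst (λ t → Mem t (proj₁ Xb)) (sym (ep i li)) (X1b _ (zX i (<t li <s))))
            q*-free (λ i li → subst (λ t → Mem t (proj₁ Xb)) (sym (eq i li)) (X1b _ (zX i li))) (λ i li → trans (ep i li) (sym (eq i (<t li <s))))
          where
          q< : ∀ i → i < s m → dec q i < dec τ κ + c3
          q< i li = go (<s⇒ li)
            where
            go : i < m ⊎ i ≡ m → dec q i < dec τ κ + c3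
            go (inj₁ l) = let (u , v , w) = hP i l in ≤t (≡⇒≤ (cong s w)) (digit< i₀ u lκ)
            go (inj₂ refl) = qm
          zc : Σ C (λ zs → (i : C) → i < s m → Mem (dec zs i) X1 × (agree κ x1 (dec zs i) × (dec (dec zs i) κ ≡ dec q i)))
          zc = code-rel (s m) (λ i v → Mem v X1 × (agree κ x1 v × (dec v κ ≡ dec q i))) (D× (D-Mem (DFvar _) (DFcon _)) (D× (D-agree (DFcon _) (DFcon _) (DFvar _)) (D≡ (DFdec (DFvar _) (DFcon _)) (DFdec (DFcon _) (DFvar _))))) (λ i li → proj₂ fullness (dec q i) (q< i li))
          zs : C
          zs = proj₁ zc
          zX : ∀ i → i < s m → Mem (dec zs i) X1
          zX i li = proj₁ (proj₂ zc i li)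
          zXi : ∀ i → i < s m → Mem (dec zs i) Xi
          zXi i li = X1⊆ _ (zX i li)
          qc : Σ C (λ q* → (i : C) → i < s m → dec q* i ≡ dec f (dec zs i))
          qc = code (s m) (λ i → dec f (dec zs i)) (DFdec (DFcon _) (DFdec (DFcon _) (DFvar _)))
          q* : C
          q* = proj₁ qc
          eq : ∀ i → i < s m → dec q* i ≡ dec f (dec zs i)
          eq = proj₂ qc
          p* : C
          p* = q*
          ep : ∀ i → i < m → dec p* i ≡ dec f (dec zs i)
          ep i li = eq i (<t li <s)
          ne : ∀ i j → i < s m → j < s m → i ≢ j → dec q i ≢ dec q j
          ne i j li lj ij = go (<s⇒ li) (<s⇒ lj)
            where
            go : i < m ⊎ i ≡ m → j < m ⊎ j ≡ m → dec q i ≢ dec q j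
            go (inj₁ a) (inj₁ c) = qne i j a c ij
            go (inj₁ a) (inj₂ refl) e = qmne i a (sym e)
            go (inj₂ refl) (inj₁ c) = qmne j c
            go (inj₂ refl) (inj₂ refl) = ⊥-elim (ij refl)
          same : ∀ i → i < m → agree (s κ) (dec P i) (dec zs i)
          same i li = let (u , v , w) = hP i li ; (_ , v' , w') = proj₂ zc i (<t li <s) in agree-s (agree-trans (agree-sym v) v') (trans (sym w) (sym w'))
          stab : ∀ t i j → t < n → i < m → j < m → i ≢ j → Ord g t (dec f (dec P i)) < Ord g t (dec f (dec P j)) → Ord g t (dec f (dec zs i)) < Ord g t (dec f (dec zs j))
          stab t i j lt li lj ij = let (u , v , w) = hP i li ; (u' , v' , w') = hP j lj in
            proj₂ (proj₂ al) t (dec P i) (dec P j) κ (dec zs i) (dec zs j) lt u u' lκ (agree-trans (agree-sym v) v')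
              (λ e → qne i j li lj ij (trans w (trans e (sym w')))) (zXi i (<t li <s)) (zXi j (<t lj <s)) (same i li) (same j lj)
          p*-free : Free g n p* m
          p*-free i j k li lj lk ij ik jk = let (t , lt , u , v) = frP i j k li lj lk ij ik jk in
            t , lt , subst₂ (λ y w → Ord g t y < Ord g t w) (sym (ep j lj)) (sym (ep i li)) (stab t j i lt lj li (λ e → ij (sym e)) u) ,
                     subst₂ (λ y w → Ord g t y < Ord g t w) (sym (ep i li)) (sym (ep k lk)) (stab t i k lt li lk ik v)
          zfree : Free L.g L.n zs (s m)
          zfree = L.free {κ} {x1} {q} lκ sl (λ i li → XX<b i₁ (zX i li) , proj₂ (proj₂ zc i li)) ne
          q*-free : Free g' L.n q* (s m)
          q*-free i j k li lj lk ij ik jk = let (t , lt , u , v) = zfree i j k li lj lk ij ik jk in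
            t , lt , subst₂ _<_ (tr t lt j lj) (tr t lt i li) u , subst₂ _<_ (tr t lt i li) (tr t lt k lk) v
            where
            tr : ∀ t → t < L.n → ∀ i → i < s m → Ord L.g t (dec zs i) ≡ Ord g' t (dec q* i)
            tr t lt i li = sym (trans (cong (Ord g' t) (eq i li)) (proj₂ transport t lt (dec zs i) (zXi i li)))

    falsity : ∀ x → Phi x → Σ ℕ (λ k → (num M k ≡ x) × I k)
    falsity x (Jx , d , g , n , Jn , pA , pB) = dne (λ nI → Falsity.absurd x Jx nI d g n Jn pA pB)

  -- What `phi` says in the pair (N , M).

  open Formulas

  module Definability (J : C → Set) (cut : IsCut M J) (expc : ExpClosed M J) (I : ℕ → Set) (cnt : Countable M) where
    open Coding J cut expc I cnt public

    is-dec : ∀ {y a x} → IsVal y a x → y ≡ dec a x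
    is-dec {a = a} {x} p = val-unique p (dec-val a x)

    FreeIn : C → C → C → C → C → Set
    FreeIn p X n g m = Free g n p m × In p m X

    opaque
      unfolding freeF
      freeM : ∀ p X n g m → SatL M freeF (pick p X n g m) ⇔ FreeIn p X n g m
      freeM p X n g m = to , from
        where
        to : SatL M freeF (pick p X n g m) → FreeIn p X n g m
        to (F , G) = (λ i j k li lj lk ij ik jk → fr i j k (F i j k li lj lk ij ik jk)) , λ i li → let (y , v , my) = G i li in subst (λ t → Mem t X) (is-dec v) my
          where
          fr : ∀ i j k → Σ C (λ t → t < n × Σ C (λ h → IsVal h g t × Σ C (λ a → IsVal a p j × Σ C (λ a' → IsVal a' p i × Σ C (λ a'' → IsVal a'' p k ×
                 Σ C (λ c → IsVal c h a × Σ C (λ c' → IsVal c' h a' × Σ C (λ c'' → IsVal c'' h a'' × (c < c' × c' < c''))))))))) →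
               Σ C (λ t → t < n × (Ord g t (dec p j) < Ord g t (dec p i) × Ord g t (dec p i) < Ord g t (dec p k)))
          fr i j k (t , lt , h , vh , a , va , a' , va' , a'' , va'' , c , vc , c' , vc' , c'' , vc'' , l , l') = t , lt ,
            subst₂ _<_ (ev vh va vc) (ev vh va' vc') l , subst₂ _<_ (ev vh va' vc') (ev vh va'' vc'') l'
            where
            ev : ∀ {h t a j c} → IsVal h g t → IsVal a p j → IsVal c h a → c ≡ Ord g t (dec p j)
            ev vh va vc = trans (is-dec vc) (cong₂ dec (is-dec vh) (is-dec va))
        from : FreeIn p X n g m → SatL M freeF (pick p X n g m)
        from (F , G) = (λ i j k li lj lk ij ik jk → let (t , lt , l , l') = F i j k li lj lk ij ik jk in
            t , lt , dec g t , dec-val g t , dec p j , dec-val p j , dec p i , dec-val p i , dec p k , dec-val p k ,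
            _ , dec-val (dec g t) (dec p j) , _ , dec-val (dec g t) (dec p i) , _ , dec-val (dec g t) (dec p k) , l , l') ,
          λ i li → dec p i , dec-val p i , G i li

    r5-eq : ∀ (m p X n g x : C) i → (m ∷ pick p X n g x) (r5 i) ≡ pick p X n g m i
    r5-eq m p X n g x zero = refl
    r5-eq m p X n g x (suc zero) = refl
    r5-eq m p X n g x (suc (suc zero)) = refl
    r5-eq m p X n g x (suc (suc (suc zero))) = refl
    r5-eq m p X n g x (suc (suc (suc (suc zero)))) = refl

    plus4 : ∀ x → s (s (s (s x))) ≡ x + c4
    plus4 x = sym (trans (+s x _) (cong s (trans (+s x _) (cong s (trans (+s x _) (cong s (trans (+s x z) (cong s (+0 x)))))))))

    opaque
      unfolding free4
      free4M : ∀ p X n g x → SatL M free4 (pick p X n g x) ⇔ FreeIn p X n g (x + c4)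
      free4M p X n g x =
        (λ { (m , e , h) → subst (FreeIn p X n g) (trans e (plus4 x)) (proj₁ (freeM p X n g m) (proj₁ (Sat-ren {P = λ _ → ⊤} r5 freeF (r5-eq m p X n g x)) h)) }) ,
        (λ h → s (s (s (s x))) , refl , proj₂ (Sat-ren {P = λ _ → ⊤} r5 freeF (r5-eq _ p X n g x)) (proj₂ (freeM p X n g _) (subst (FreeIn p X n g) (sym (plus4 x)) h)))

    opaque
      unfolding free5
      free5M : ∀ p X n g x → SatL M free5 (pick p X n g x) ⇔ FreeIn p X n g (s (x + c4))
      free5M p X n g x =
        (λ { (m , e , h) → subst (FreeIn p X n g) (trans e (cong s (plus4 x))) (proj₁ (freeM p X n g m) (proj₁ (Sat-ren {P = λ _ → ⊤} r5 freeF (r5-eq m p X n g x)) h)) }) ,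
        (λ h → s (s (s (s (s x)))) , refl , proj₂ (Sat-ren {P = λ _ → ⊤} r5 freeF (r5-eq _ p X n g x)) (proj₂ (freeM p X n g _) (subst (FreeIn p X n g) (sym (cong s (plus4 x))) h)))

    opaque
      unfolding extF
      extM : ∀ p q x → SatL M extF (pick3 p q x) ⇔ (∀ i → i < x + c4 → dec p i ≡ dec q i)
      extM p q x =
        (λ { (m , e , h) i li → let (y , v , w) = h i (≤t li (≡⇒≤ (sym (trans e (plus4 x))))) in trans (sym (is-dec v)) (is-dec w) }) ,
        (λ h → s (s (s (s x))) , refl , λ i li → dec p i , dec-val p i , subst (λ y → IsVal y q i) (sym (h i (≤t li (≡⇒≤ (plus4 x))))) (dec-val q i))

    opaque
      unfolding inF
      memM : ∀ x X → SatL M inF (pick2 x X) ⇔ Mem x X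
      memM x X = id , id

    Sat* : ∀ {n} → Fm true n → (Fin n → CN) → Set
    Sat* = Sat N (Img E)

    -- All arguments come from M, so elementarity moves the evaluation from N to M.
    inM : ∀ {n k} (α : Fm false k) (r : Fin k → Fin n) (ρ : Fin n → CN) (σ : Fin k → C) → (∀ i → ρ (r i) ≡ emb (σ i)) → Sat* (lift (ren r α)) ρ ⇔ SatL M α σ
    inM α r ρ σ h =
      (λ p → proj₂ (elem α σ) (proj₁ (Semantics.Sat-ren N r α h) (proj₁ (Sat-lift N (ren r α) ρ) p))) ,
      (λ p → proj₂ (Sat-lift N (ren r α) ρ) (proj₂ (Semantics.Sat-ren N r α h) (proj₁ (elem α σ) p)))

    -- Here `d` may lie outside M, so Łoś takes the place of elementarity.
    inN : ∀ {n} (r : Fin 2 → Fin n) (ρ : Fin n → CN) d X → ρ (r zero) ≡ d → ρ (r (suc zero)) ≡ emb X → Sat* (lift (ren r inF)) ρ ⇔ Ev (λ y → Mem (dec (proj₁ d) y) X)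
    inN r ρ d X e e' =
      (λ p → Ev-map (λ y _ (q , v) → proj₁ (memM _ X) (Sat-id inF (vals y v) q)) (Ev-× (proj₁ (Łoś inF (pick2 d (emb X))) (proj₁ (Semantics.Sat-ren N r inF eqs) (proj₁ (Sat-lift N (ren r inF) ρ) p))) (emb-val X))) ,
      (λ p → proj₂ (Sat-lift N (ren r inF) ρ) (proj₂ (Semantics.Sat-ren N r inF eqs) (proj₂ (Łoś inF (pick2 d (emb X))) (Ev-map (λ y _ (q , v) → Sat-id inF (λ i → sym (vals y v i)) (proj₂ (memM _ X) q)) (Ev-× p (emb-val X))))))
      where
      eqs : ∀ i → ρ (r i) ≡ pick2 d (emb X) i
      eqs zero = e
      eqs (suc zero) = e'
      vals : ∀ y → dec (proj₁ (emb X)) y ≡ X → ∀ i → at (pick2 d (emb X)) y i ≡ pick2 (dec (proj₁ d) y) X i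
      vals y v zero = refl
      vals y v (suc zero) = v

    five : ∀ {n} {ρ : Fin n → CN} {a c d e f} {p X m g x} → ρ a ≡ emb p → ρ c ≡ emb X → ρ d ≡ emb m → ρ e ≡ emb g → ρ f ≡ emb x →
           ∀ i → ρ (pick a c d e f i) ≡ emb (pick p X m g x i)
    five h1 h2 h3 h4 h5 zero = h1
    five h1 h2 h3 h4 h5 (suc zero) = h2
    five h1 h2 h3 h4 h5 (suc (suc zero)) = h3
    five h1 h2 h3 h4 h5 (suc (suc (suc zero))) = h4
    five h1 h2 h3 h4 h5 (suc (suc (suc (suc zero)))) = h5

    three' : ∀ {n} {ρ : Fin n → CN} {a c d} {p X m} → ρ a ≡ emb p → ρ c ≡ emb X → ρ d ≡ emb m → ∀ i → ρ (pick3 a c d i) ≡ emb (pick3 p X m i)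
    three' h1 h2 h3 zero = h1
    three' h1 h2 h3 (suc zero) = h2
    three' h1 h2 h3 (suc (suc zero)) = h3

    env4 : CN → C → C → C → Fin 4 → CN
    env4 d g n x = emb n ∷ (emb g ∷ (d ∷ (λ _ → emb x)))

    AM : CN → C → C → C → Set
    AM d g n x = ∀ X → Ev (λ y → Mem (dec (proj₁ d) y) X) → Σ C (λ p → FreeIn p X n g (x + c4))

    BM : CN → C → C → C → Set
    BM d g n x = ∀ g' n' → J n' → Σ C (λ X → Ev (λ y → Mem (dec (proj₁ d) y) X) ×
      (∀ p q → Free g n p (x + c4) → In p (x + c4) X → Free g' n' q (s (x + c4)) → In q (s (x + c4)) X → (∀ i → i < x + c4 → dec p i ≡ dec q i) → ⊥))

    opaque
      unfolding partA
      partA-to : ∀ d g n x → Sat* partA (env4 d g n x) → AM d g n x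
      partA-to d g n x h X ev = go (h (emb X) (X , refl) (proj₂ (inN rAin (emb X ∷ env4 d g n x) d X refl refl) ev))
        where
        go : Σ CN (λ u → Img E u × Sat* (lift (ren rA4 free4)) (u ∷ (emb X ∷ env4 d g n x))) → Σ C (λ p → FreeIn p X n g (x + c4))
        go (_ , (p , refl) , q) = p , proj₁ (free4M p X n g x) (proj₁ (inM free4 rA4 (emb p ∷ (emb X ∷ env4 d g n x)) (pick p X n g x) (five {ρ = emb p ∷ (emb X ∷ env4 d g n x)} refl refl refl refl refl)) q)

    opaque
      unfolding partA
      partA-from : ∀ d g n x → AM d g n x → Sat* partA (env4 d g n x)
      partA-from d g n x h _ (X , refl) i = let (p , fr) = h X (proj₁ (inN rAin (emb X ∷ env4 d g n x) d X refl refl) i) in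
        emb p , (p , refl) , proj₂ (inM free4 rA4 (emb p ∷ (emb X ∷ env4 d g n x)) (pick p X n g x) (five {ρ = emb p ∷ (emb X ∷ env4 d g n x)} refl refl refl refl refl)) (proj₂ (free4M p X n g x) fr)

    module PB (d : CN) (g n x g' n' : C) where
      ρ6 : Fin 6 → CN
      ρ6 = emb n' ∷ (emb g' ∷ env4 d g n x)
      ρ7 : C → Fin 7 → CN
      ρ7 X = emb X ∷ ρ6
      ρ9 : C → C → C → Fin 9 → CN
      ρ9 X p q = emb q ∷ (emb p ∷ ρ7 X)
      f4 : ∀ X p q → Sat* (lift (ren rB4 free4)) (ρ9 X p q) ⇔ FreeIn p X n g (x + c4)
      f4 X p q = let e = inM free4 rB4 (ρ9 X p q) (pick p X n g x) (five {ρ = ρ9 X p q} refl refl refl refl refl) ; e' = free4M p X n g x in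
        (λ h → proj₁ e' (proj₁ e h)) , (λ h → proj₂ e (proj₂ e' h))
      f5 : ∀ X p q → Sat* (lift (ren rB5 free5)) (ρ9 X p q) ⇔ FreeIn q X n' g' (s (x + c4))
      f5 X p q = let e = inM free5 rB5 (ρ9 X p q) (pick q X n' g' x) (five {ρ = ρ9 X p q} refl refl refl refl refl) ; e' = free5M q X n' g' x in
        (λ h → proj₁ e' (proj₁ e h)) , (λ h → proj₂ e (proj₂ e' h))
      ex' : ∀ X p q → Sat* (lift (ren rBx extF)) (ρ9 X p q) ⇔ (∀ i → i < x + c4 → dec p i ≡ dec q i)
      ex' X p q = let e = inM extF rBx (ρ9 X p q) (pick3 p q x) (three' {ρ = ρ9 X p q} refl refl refl) ; e' = extM p q x in
        (λ h → proj₁ e' (proj₁ e h)) , (λ h → proj₂ e (proj₂ e' h))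
      inX : ∀ X → Sat* (lift (ren rBin inF)) (ρ7 X) ⇔ Ev (λ y → Mem (dec (proj₁ d) y) X)
      inX X = inN rBin (ρ7 X) d X refl refl

    opaque
      unfolding partA
      partB-to : ∀ d g n x → Sat* partB (env4 d g n x) → BM d g n x
      partB-to d g n x h g' n' jn = go (h (emb g') (emb n') (g' , refl) ((n' , refl) , proj₁ (gcis n') jn))
        where
        open PB d g n x g' n'
        go : Σ CN (λ v → Img E v × (Sat* (lift (ren rBin inF)) (v ∷ ρ6) × (∀ a c → Img E a → Img E c → Sat* (lift (ren rB4 free4)) (c ∷ (a ∷ (v ∷ ρ6))) → Sat* (lift (ren rB5 free5)) (c ∷ (a ∷ (v ∷ ρ6))) → Sat* (lift (ren rBx extF)) (c ∷ (a ∷ (v ∷ ρ6))) → ⊥))) → Σ C (λ X → Ev (λ y → Mem (dec (proj₁ d) y) X) ×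
          (∀ p q → Free g n p (x + c4) → In p (x + c4) X → Free g' n' q (s (x + c4)) → In q (s (x + c4)) X → (∀ i → i < x + c4 → dec p i ≡ dec q i) → ⊥))
        go (_ , (X , refl) , i , k) = X , proj₁ (inX X) i , λ p q fp ip fq iq e →
          k (emb p) (emb q) (p , refl) (q , refl) (proj₂ (f4 X p q) (fp , ip)) (proj₂ (f5 X p q) (fq , iq)) (proj₂ (ex' X p q) e)

    opaque
      unfolding partA
      partB-from : ∀ d g n x → BM d g n x → Sat* partB (env4 d g n x)
      partB-from d g n x h _ _ (g' , refl) ((n' , refl) , jn) = let (X , i , k) = h g' n' (proj₂ (gcis n') jn) in
        emb X , (X , refl) , proj₂ (inX X) i , λ { _ _ (p , refl) (q , refl) a c e →
          let (fp , ip) = proj₁ (f4 X p q) a ; (fq , iq) = proj₁ (f5 X p q) c in k p q fp ip fq iq (proj₁ (ex' X p q) e) }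
        where
        open PB d g n x g' n'

    phi-to : ∀ x → Sat* phi (emb x ∷ (λ ())) → Phi x
    phi-to x ((_ , jx) , d , _ , _ , (g , refl) , ((n , refl) , jn) , hA , hB) =
      proj₂ (gcis x) jx , d , g , n , proj₂ (gcis n) jn , partA-to d g n x (conv partA hA) , partB-to d g n x (conv partB hB)
      where
      conv : ∀ φ → Sat* φ (emb n ∷ (emb g ∷ (d ∷ (emb x ∷ (λ ()))))) → Sat* φ (env4 d g n x)
      conv φ = Semantics.Sat-id N φ (λ { zero → refl ; (suc zero) → refl ; (suc (suc zero)) → refl ; (suc (suc (suc zero))) → refl })

    phi-from : ∀ x → Phi x → Sat* phi (emb x ∷ (λ ()))
    phi-from x (jx , d , g , n , jn , hA , hB) = ((x , refl) , proj₁ (gcis x) jx) , d , emb g , emb n , (g , refl) , ((n , refl) , proj₁ (gcis n) jn) ,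
        conv partA (partA-from d g n x hA) , conv partB (partB-from d g n x hB)
      where
      conv : ∀ φ → Sat* φ (env4 d g n x) → Sat* φ (emb n ∷ (emb g ∷ (d ∷ (emb x ∷ (λ ())))))
      conv φ = Semantics.Sat-id N φ (λ { zero → refl ; (suc zero) → refl ; (suc (suc zero)) → refl ; (suc (suc (suc zero))) → refl })

    emb-num : ∀ k → emb (num M k) ≡ num N k
    emb-num zero = refl
    emb-num (suc k) = trans (proj₁ (elem (Term.var zero ≐ (Term.var (suc zero) +ₜ 1ₜ)) (pick2 (s (num M k)) (num M k))) refl) (cong (λ u → addN u (emb o)) (emb-num k))

    defines : DefinesStd E phi I
    defines u = to , from
      where
      to : Sat* phi (u ∷ (λ ())) → Σ ℕ (λ k → (num N k ≡ u) × I k)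
      -- The conjunct `mem` in `cutF` places `u` in M.
      to h@(((x , refl) , _) , _) = let (k , e , ik) = falsity x (phi-to x h) in k , trans (sym (emb-num k)) (cong emb e) , ik
      from : Σ ℕ (λ k → (num N k ≡ u) × I k) → Sat* phi (u ∷ (λ ()))
      from (k , refl , ik) = subst (λ v → Sat* phi (v ∷ (λ ()))) (emb-num k) (phi-from (num M k) (Truth.truth k ik))

theoremB : ExcludedMiddle 0ℓ →
    Σ (Fm true 1) (λ φ →
    ∀ (M : Str) → IsPA M → Countable M →
    ∀ (J : Str.C M → Set) → IsCut M J → ExpClosed M J →
    ∀ (I : ℕ → Set) →
    Σ Str (λ N → Σ (ElemEmb M N) (λ e →
    IsPA N
    × Proper e
    × Minimal e
    × (∀ b → (J b → Gcis e b) × (Gcis e b → J b))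
    × SameCod e J
    × (Fills e J → ⊥)
    × DefinesStd e φ I)))
theoremB em = Formulas.phi , λ M pa cnt J cut expc I →
  let open InModel.Definability em M pa J cut expc I cnt in
  N , E , paN , proper , minimal , gcis , same-cod , no-fill , defines
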